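{- For every integer $n\ge 1$ with $n\not\equiv 0 \pmod 4$, let $E(n)=F(n)-F_1(n)$ (counted with the weights described in the context). Then $$E(n)=\begin{cases} H(4n), & n\equiv 1,2 \pmod 4,\\ 2H(n), & n\equiv 3\pmod 8,\\ 0, & n\equiv 7 \pmod 8.\end{cases}$$
   Context: A classical binary quadratic form is written $(a,2b,c)$ and denotes $ax^2+2bxy+cy^2$ with $a,b,c\in\mathbb Z$; its determinant is $D=b^2-ac$. Only positive definite forms ($a>0$, $D<0$) are considered, and two forms are equivalent if one is obtained from the other by a change of variables in $SL_2(\mathbb Z)$. The divisor of $(a,2b,c)$ is $\delta=\gcd(a,b,c)$; the form is primitive if $\delta=1$ and derived otherwise. A primitive form $(a,2b,c)$ is uneven if $a$ and $c$ are not both even, and even otherwise; a derived form of divisor $\delta$ is uneven (resp. even) when $(a/\delta,2b/\delta,c/\delta)$ is uneven (resp. even). For $n>0$, $F(n)$ (resp. $F_1(n)$) is the number of equivalence classes of uneven (resp. even) forms, primitive or derived, of determinant $-n$, where each class of $(t,2\cdot 0,t)$ ($t\ge1$, i.e. the class of $(1,2\cdot0,1)$ or derived from it) is counted with weight $1/2$, each class of $(2t,2\cdot t,2t)$ ($t\ge 1$, i.e. the class of $(2,2\cdot1,2)$ or derived from it) is counted with weight $1/3$, and all other classes with weight $1$. For a negative integer $\Delta\equiv 0,1\pmod 4$, $h(\Delta)$ denotes the number of $SL_2(\mathbb Z)$-classes of primitive positive definite forms $ax^2+bxy+cy^2$ with $b^2-4ac=\Delta$; set $h_\omega(\Delta)=h(\Delta)$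 if $\Delta<-4$, $h_\omega(-4)=1/2$, $h_\omega(-3)=1/3$. For such $\Delta$, write $\Delta=f^2\Delta_1$ with $\Delta_1$ a fundamental discriminant and $f\ge1$; the Hurwitz class number is $H(|\Delta|)=\sum_{t\mid f} h_\omega(\Delta/t^2)$. -}

module Defs where

open import Data.Bool.Base using (if_then_else_)
open import Data.Empty using (⊥-elim)
open import Data.Integer.Base as ℤ
  using (ℤ; +_; -[1+_]; 0ℤ; 1ℤ; -1ℤ; ∣_∣; _+_; _*_; _-_; -_; +<+; -<+; +≤+)
import Data.Integer.Properties as ℤ
import Data.Integer.DivMod as ℤ
open import Data.Integer.Divisibility using (_∣_)
import Data.Integer.Divisibility.Signed as Signed
open import Data.Integer.GCD using (gcd; gcd[i,j]∣i; gcd[i,j]∣j; gcd-greatest)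
open import Data.Integer.Tactic.RingSolver using (solve-∀)
open import Data.List.Base
  using (List; []; _∷_; _++_; map; filter; foldr; length; upTo; cartesianProductWith)
open import Data.List.Membership.Propositional using (_∈_; lose)
open import Data.List.Membership.Propositional.Properties
  using (∈-map⁺; ∈-++⁺ˡ; ∈-++⁺ʳ; ∈-upTo⁺; ∈-cartesianProductWith⁺; ∈-filter⁺)
open import Data.List.Relation.Unary.All using (All; []; _∷_)
open import Data.List.Relation.Unary.All.Properties using (all-filter; ¬Any⇒All¬)
open import Data.List.Relation.Unary.AllPairs using (AllPairs; []; _∷_)
open import Data.List.Relation.Unary.Any as Any using (Any; here; there)
open import Data.Nat.Base as ℕ using (ℕ; zero; suc; z≤n; s≤s)
import Data.Nat.Divisibility as ℕ
open import Data.Nat.Induction using (<-wellFounded)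
import Data.Nat.Properties as ℕ
open import Data.Nat.Tactic.RingSolver using () renaming (solve-∀ to solveℕ-∀)
open import Data.Product.Base using (Σ; ∃; _×_; _,_; proj₁; proj₂)
open import Data.Rational.Base as ℚ using (ℚ; 0ℚ; 1ℚ)
open import Data.Sum.Base using (_⊎_; inj₁; inj₂)
open import Function.Base using (_∘_)
open import Induction.WellFounded using (Acc; acc)
open import Level using (Level)
open import Relation.Binary.Core using (Rel)
open import Relation.Binary.Definitions using (Transitive)
open import Relation.Binary.PropositionalEquality
  using (_≡_; _≢_; refl; sym; trans; cong; cong₂; subst; subst₂; module ≡-Reasoning)
open import Relation.Nullary using (¬_; Dec; yes; no; ¬?; does; contradiction)
open import Relation.Nullary.Decidable using (map′; _×-dec_; _⊎-dec_)
open import Relation.Unary using (Pred)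

record Form : Set where
  constructor form
  field a b c : ℤ

eval : Form → ℤ → ℤ → ℤ
eval (form a b c) x y = a * (x * x) + b * (x * y) + c * (y * y)

disc : Form → ℤ
disc (form a b c) = b * b - + 4 * (a * c)

PositiveDefinite : Form → Set
PositiveDefinite f = 0ℤ ℤ.< Form.a f × disc f ℤ.< 0ℤ

content : Form → ℤ
content (form a b c) = gcd (gcd a b) c

Primitive : Form → Set
Primitive f = content f ≡ 1ℤ

record SL₂ : Set where
  constructor sl₂
  field
    p q r s : ℤ
    p*s-q*r≡1 : p * s - q * r ≡ 1ℤ

infixl 7 _⊙_ _⊡_ _·_
infix 4 _∼_ _≈_

-- The coefficients of f (p x + q y , r x + s y); see eval-⊙.
_⊙_ : Form → SL₂ → Form
f@(form a b c) ⊙ sl₂ p q r s _ = form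
  (eval f p r)
  (+ 2 * (a * (p * q)) + b * (p * s + q * r) + + 2 * (c * (r * s)))
  (eval f q s)

eval-⊙ : ∀ f γ x y → let open SL₂ γ in
         eval (f ⊙ γ) x y ≡ eval f (p * x + q * y) (r * x + s * y)
eval-⊙ (form a b c) (sl₂ p q r s _) = identity a b c p q r s
  where
  identity : ∀ a b c p q r s x y →
    (a * (p * p) + b * (p * r) + c * (r * r)) * (x * x)
    + (+ 2 * (a * (p * q)) + b * (p * s + q * r) + + 2 * (c * (r * s))) * (x * y)
    + (a * (q * q) + b * (q * s) + c * (s * s)) * (y * y)
    ≡ a * ((p * x + q * y) * (p * x + q * y))
    + b * ((p * x + q * y) * (r * x + s * y))
    + c * ((r * x + s * y) * (r * x + s * y))
  identity = solve-∀

record _∼_ (f g : Form) : Set where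
  constructor via
  field
    γ      : SL₂
    g≡f⊙γ : g ≡ f ⊙ γ

-- ⟨ a ,2· b , c ⟩ stores b, not the middle coefficient 2b.
record Classical : Set where
  constructor ⟨_,2·_,_⟩
  field a b c : ℤ

⟦_⟧ : Classical → Form
⟦ ⟨ a ,2· b , c ⟩ ⟧ = form a (+ 2 * b) c

_≈_ : Rel Classical Level.zero
f ≈ g = ⟦ f ⟧ ∼ ⟦ g ⟧

determinant : Classical → ℤ
determinant ⟨ a ,2· b , c ⟩ = b * b - a * c

PositiveDefiniteᶜ : Classical → Set
PositiveDefiniteᶜ f = 0ℤ ℤ.< Classical.a f × determinant f ℤ.< 0ℤ

divisor : Classical → ℤ
divisor ⟨ a ,2· b , c ⟩ = gcd (gcd a b) c

Primitiveᶜ : Classical → Set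
Primitiveᶜ f = divisor f ≡ 1ℤ

_·_ : ℤ → Classical → Classical
d · ⟨ a ,2· b , c ⟩ = ⟨ d * a ,2· d * b , d * c ⟩

OuterEven : Classical → Set
OuterEven ⟨ a ,2· b , c ⟩ = (+ 2 ∣ a) × (+ 2 ∣ c)

-- Here g is forced to be (a/δ,2b/δ,c/δ), which is f itself when f is primitive.
Uneven Even : Classical → Set
Uneven f = ∃ λ g → f ≡ divisor f · g × Primitiveᶜ g × ¬ OuterEven g
Even   f = ∃ λ g → f ≡ divisor f · g × Primitiveᶜ g × OuterEven g

record Representatives {a ℓ p : Level} {A : Set a} (_~_ : Rel A ℓ) (P : Pred A p)
                       : Set (a Level.⊔ ℓ Level.⊔ p) where
  field
    reps       : List A
    sound      : All P reps
    distinct   : AllPairs (λ x y → ¬ (x ~ y)) reps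
    exhaustive : ∀ x → P x → Any (x ~_) reps

open Representatives public using (reps)

module _ {a ℓ p : Level} {A : Set a} {_~_ : Rel A ℓ} {P : Pred A p}
         (~-trans : Transitive _~_)
         (P? : ∀ x → Dec (P x))
         (_~?_ : ∀ {x y} → P x → P y → Dec (x ~ y)) where

  any~? : ∀ {x} → P x → ∀ {ys} → All P ys → Dec (Any (x ~_) ys)
  any~? px []         = no λ ()
  any~? px (py ∷ pys) with px ~? py | any~? px pys
  ... | yes x~y | _       = yes (here x~y)
  ... | no _    | yes any = yes (there any)
  ... | no x≁y  | no ¬any = no λ { (here x~y) → x≁y x~y ; (there any) → ¬any any }

  thin : (xs : List A) → All P xs →
         Σ (List A) λ ys → All P ys × AllPairs (λ x y → ¬ (x ~ y)) ys
                         × (∀ x → P x → Any (λ y → x ~ y) xs → Any (x ~_) ys)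
  thin [] [] = [] , [] , [] , λ _ _ any → any
  thin (x ∷ xs) (px ∷ pxs) with thin xs pxs
  ... | ys , pys , dys , cover with any~? px pys
  ...   | yes any = ys , pys , dys , λ where
            z pz (here z~x)  → Any.map (~-trans z~x) any
            z pz (there z~) → cover z pz z~
  ...   | no ¬any = x ∷ ys , px ∷ pys , ¬Any⇒All¬ ys ¬any ∷ dys , λ where
            z pz (here z~x)  → here z~x
            z pz (there z~) → there (cover z pz z~)

  representatives : (xs : List A) → (∀ x → P x → ∃ λ y → y ∈ xs × P y × x ~ y) →
                    Representatives _~_ P
  representatives xs candidates with thin (filter P? xs) (all-filter P? xs)
  ... | ys , pys , dys , cover = record
    { reps       = ys
    ; sound      = pys
    ; distinct   = dys
    ; exhaustive = λ x px → let y , y∈xs , py , x~y = candidates x px in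
                     cover x px (lose (∈-filter⁺ P? y∈xs py) x~y)
    }

form-cong : ∀ {a b c a′ b′ c′} → a ≡ a′ → b ≡ b′ → c ≡ c′ → form a b c ≡ form a′ b′ c′
form-cong refl refl refl = refl

classical-cong : ∀ {a b c a′ b′ c′} → a ≡ a′ → b ≡ b′ → c ≡ c′ →
                 ⟨ a ,2· b , c ⟩ ≡ ⟨ a′ ,2· b′ , c′ ⟩
classical-cong refl refl refl = refl

identityₛₗ : SL₂
identityₛₗ = sl₂ 1ℤ 0ℤ 0ℤ 1ℤ refl

inverse : SL₂ → SL₂
inverse (sl₂ p q r s eq) = sl₂ s (- q) (- r) p (trans (identity p q r s) eq)
  where
  identity : ∀ p q r s → s * p - (- q) * (- r) ≡ p * s - q * r
  identity = solve-∀

_⊡_ : SL₂ → SL₂ → SL₂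
sl₂ p q r s eq ⊡ sl₂ p′ q′ r′ s′ eq′ =
  sl₂ (p * p′ + q * r′) (p * q′ + q * s′) (r * p′ + s * r′) (r * q′ + s * s′)
      (trans (identity p q r s p′ q′ r′ s′) (cong₂ _*_ eq eq′))
  where
  identity : ∀ p q r s p′ q′ r′ s′ →
    (p * p′ + q * r′) * (r * q′ + s * s′) - (p * q′ + q * s′) * (r * p′ + s * r′)
    ≡ (p * s - q * r) * (p′ * s′ - q′ * r′)
  identity = solve-∀

⊙-⊡ : ∀ f γ δ → (f ⊙ γ) ⊙ δ ≡ f ⊙ (γ ⊡ δ)
⊙-⊡ f@(form a b c) γ@(sl₂ p q r s _) δ@(sl₂ p′ q′ r′ s′ _) =
  form-cong (eval-⊙ f γ p′ r′) (identity a b c p q r s p′ q′ r′ s′) (eval-⊙ f γ q′ s′)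
  where
  identity : ∀ a b c p q r s p′ q′ r′ s′ →
    + 2 * ((a * (p * p) + b * (p * r) + c * (r * r)) * (p′ * q′))
    + (+ 2 * (a * (p * q)) + b * (p * s + q * r) + + 2 * (c * (r * s))) * (p′ * s′ + q′ * r′)
    + + 2 * ((a * (q * q) + b * (q * s) + c * (s * s)) * (r′ * s′))
    ≡ + 2 * (a * ((p * p′ + q * r′) * (p * q′ + q * s′)))
    + b * ((p * p′ + q * r′) * (r * q′ + s * s′) + (p * q′ + q * s′) * (r * p′ + s * r′))
    + + 2 * (c * ((r * p′ + s * r′) * (r * q′ + s * s′)))
  identity = solve-∀

⊙-identity : ∀ f → f ⊙ identityₛₗ ≡ f
⊙-identity (form a b c) = form-cong (i₁ a b c) (i₂ a b c) (i₃ a b c)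
  where
  i₁ : ∀ a b c → a * (1ℤ * 1ℤ) + b * (1ℤ * 0ℤ) + c * (0ℤ * 0ℤ) ≡ a
  i₁ = solve-∀
  i₂ : ∀ a b c → + 2 * (a * (1ℤ * 0ℤ)) + b * (1ℤ * 1ℤ + 0ℤ * 0ℤ) + + 2 * (c * (0ℤ * 1ℤ)) ≡ b
  i₂ = solve-∀
  i₃ : ∀ a b c → a * (0ℤ * 0ℤ) + b * (0ℤ * 1ℤ) + c * (1ℤ * 1ℤ) ≡ c
  i₃ = solve-∀

sl₂-det² : ∀ (γ : SL₂) x → let open SL₂ γ in
           (p * s - q * r) * (p * s - q * r) * x ≡ x
sl₂-det² γ x = trans (cong (λ d → d * d * x) (SL₂.p*s-q*r≡1 γ)) (ℤ.*-identityˡ x)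

⊙-inverse : ∀ f γ → (f ⊙ γ) ⊙ inverse γ ≡ f
⊙-inverse (form a b c) γ@(sl₂ p q r s _) = form-cong
  (trans (i₁ a b c p q r s) (sl₂-det² γ a))
  (trans (i₂ a b c p q r s) (sl₂-det² γ b))
  (trans (i₃ a b c p q r s) (sl₂-det² γ c))
  where
  i₁ : ∀ a b c p q r s →
    (a * (p * p) + b * (p * r) + c * (r * r)) * (s * s)
    + (+ 2 * (a * (p * q)) + b * (p * s + q * r) + + 2 * (c * (r * s))) * (s * (- r))
    + (a * (q * q) + b * (q * s) + c * (s * s)) * ((- r) * (- r))
    ≡ (p * s - q * r) * (p * s - q * r) * a
  i₁ = solve-∀
  i₂ : ∀ a b c p q r s →
    + 2 * ((a * (p * p) + b * (p * r) + c * (r * r)) * (s * (- q)))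
    + (+ 2 * (a * (p * q)) + b * (p * s + q * r) + + 2 * (c * (r * s))) * (s * p + (- q) * (- r))
    + + 2 * ((a * (q * q) + b * (q * s) + c * (s * s)) * ((- r) * p))
    ≡ (p * s - q * r) * (p * s - q * r) * b
  i₂ = solve-∀
  i₃ : ∀ a b c p q r s →
    (a * (p * p) + b * (p * r) + c * (r * r)) * ((- q) * (- q))
    + (+ 2 * (a * (p * q)) + b * (p * s + q * r) + + 2 * (c * (r * s))) * ((- q) * p)
    + (a * (q * q) + b * (q * s) + c * (s * s)) * (p * p)
    ≡ (p * s - q * r) * (p * s - q * r) * c
  i₃ = solve-∀

∼-refl : ∀ {f} → f ∼ f
∼-refl {f} = via identityₛₗ (sym (⊙-identity f))

∼-sym : ∀ {f g} → f ∼ g → g ∼ f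
∼-sym {f} (via γ refl) = via (inverse γ) (sym (⊙-inverse f γ))

∼-trans : ∀ {f g h} → f ∼ g → g ∼ h → f ∼ h
∼-trans {f} (via γ refl) (via δ refl) = via (γ ⊡ δ) (⊙-⊡ f γ δ)

disc-⊙ : ∀ f γ → disc (f ⊙ γ) ≡ disc f
disc-⊙ (form a b c) γ@(sl₂ p q r s _) =
  trans (identity a b c p q r s) (sl₂-det² γ (b * b - + 4 * (a * c)))
  where
  identity : ∀ a b c p q r s →
    (+ 2 * (a * (p * q)) + b * (p * s + q * r) + + 2 * (c * (r * s)))
    * (+ 2 * (a * (p * q)) + b * (p * s + q * r) + + 2 * (c * (r * s)))
    - + 4 * ((a * (p * p) + b * (p * r) + c * (r * r)) * (a * (q * q) + b * (q * s) + c * (s * s)))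
    ≡ (p * s - q * r) * (p * s - q * r) * (b * b - + 4 * (a * c))
  identity = solve-∀

disc-∼ : ∀ {f g} → f ∼ g → disc g ≡ disc f
disc-∼ {f} (via γ refl) = disc-⊙ f γ

disc-⟦⟧ : ∀ f → disc ⟦ f ⟧ ≡ + 4 * determinant f
disc-⟦⟧ ⟨ a ,2· b , c ⟩ = identity a b c
  where
  identity : ∀ a b c → (+ 2 * b) * (+ 2 * b) - + 4 * (a * c) ≡ + 4 * (b * b - a * c)
  identity = solve-∀

determinant-≈ : ∀ f g → f ≈ g → determinant g ≡ determinant f
determinant-≈ f g f≈g = ℤ.*-cancelˡ-≡ (+ 4) _ _
  (trans (sym (disc-⟦⟧ g)) (trans (disc-∼ f≈g) (disc-⟦⟧ f)))

pos-4* : ∀ {x} → x ℤ.< 0ℤ → + 4 * x ℤ.< 0ℤ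
pos-4* {x} x<0 = ℤ.*-monoˡ-<-pos (+ 4) x<0

neg-4* : ∀ {x} → + 4 * x ℤ.< 0ℤ → x ℤ.< 0ℤ
neg-4* 4x<0 = ℤ.*-cancelˡ-<-nonNeg (+ 4) 4x<0

⟦⟧-posdef : ∀ f → PositiveDefiniteᶜ f → PositiveDefinite ⟦ f ⟧
⟦⟧-posdef f (a>0 , D<0) = a>0 , subst (ℤ._< 0ℤ) (sym (disc-⟦⟧ f)) (pos-4* D<0)

⟦⟧-posdef⁻¹ : ∀ f → PositiveDefinite ⟦ f ⟧ → PositiveDefiniteᶜ f
⟦⟧-posdef⁻¹ f (a>0 , Δ<0) = a>0 , neg-4* (subst (ℤ._< 0ℤ) (disc-⟦⟧ f) Δ<0)

⟦⟧-injective : ∀ {f g} → ⟦ f ⟧ ≡ ⟦ g ⟧ → f ≡ g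
⟦⟧-injective {⟨ a ,2· b , c ⟩} {⟨ a′ ,2· b′ , c′ ⟩} eq = classical-cong
  (cong Form.a eq) (ℤ.*-cancelˡ-≡ (+ 2) b b′ (cong Form.b eq)) (cong Form.c eq)

_⊙ᶜ_ : Classical → SL₂ → Classical
⟨ a ,2· b , c ⟩ ⊙ᶜ sl₂ p q r s _ =
  ⟨ a * (p * p) + + 2 * b * (p * r) + c * (r * r)
  ,2· a * (p * q) + b * (p * s + q * r) + c * (r * s)
  , a * (q * q) + + 2 * b * (q * s) + c * (s * s) ⟩

⟦⊙ᶜ⟧ : ∀ f γ → ⟦ f ⊙ᶜ γ ⟧ ≡ ⟦ f ⟧ ⊙ γ
⟦⊙ᶜ⟧ ⟨ a ,2· b , c ⟩ (sl₂ p q r s _) = form-cong refl (identity a b c p q r s) refl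
  where
  identity : ∀ a b c p q r s →
    + 2 * (a * (p * q) + b * (p * s + q * r) + c * (r * s))
    ≡ + 2 * (a * (p * q)) + + 2 * b * (p * s + q * r) + + 2 * (c * (r * s))
  identity = solve-∀

≈⇒⊙ᶜ : ∀ f g → f ≈ g → ∃ λ γ → g ≡ f ⊙ᶜ γ
≈⇒⊙ᶜ f g (via γ eq) = γ , ⟦⟧-injective (trans eq (sym (⟦⊙ᶜ⟧ f γ)))

⊙ᶜ⇒≈ : ∀ f γ → f ≈ f ⊙ᶜ γ
⊙ᶜ⇒≈ f γ = via γ (⟦⊙ᶜ⟧ f γ)

module _ {e a b c : ℤ} where

  ∣gcd₃⇒ : e ∣ gcd (gcd a b) c → (e ∣ a) × (e ∣ b) × (e ∣ c)
  ∣gcd₃⇒ e∣g =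
    let e∣ab = ℕ.∣-trans e∣g (gcd[i,j]∣i (gcd a b) c) in
    ℕ.∣-trans e∣ab (gcd[i,j]∣i a b) ,
    ℕ.∣-trans e∣ab (gcd[i,j]∣j a b) ,
    ℕ.∣-trans e∣g (gcd[i,j]∣j (gcd a b) c)

  ∣gcd₃⇐ : (e ∣ a) × (e ∣ b) × (e ∣ c) → e ∣ gcd (gcd a b) c
  ∣gcd₃⇐ (e∣a , e∣b , e∣c) =
    gcd-greatest {gcd a b} {c} {e} (gcd-greatest {a} {b} {e} e∣a e∣b) e∣c

  ∣-linear : e ∣ a → e ∣ b → e ∣ c → ∀ x y z → e ∣ a * x + b * y + c * z
  ∣-linear e∣a e∣b e∣c x y z = Signed.∣⇒∣ᵤ
    (Signed.∣m∣n⇒∣m+n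
      (Signed.∣m∣n⇒∣m+n
        (Signed.∣m⇒∣m*n x (Signed.∣ᵤ⇒∣ {e} {a} e∣a))
        (Signed.∣m⇒∣m*n y (Signed.∣ᵤ⇒∣ {e} {b} e∣b)))
      (Signed.∣m⇒∣m*n z (Signed.∣ᵤ⇒∣ {e} {c} e∣c)))

CommonDivisor : ℤ → Form → Set
CommonDivisor e (form a b c) = (e ∣ a) × (e ∣ b) × (e ∣ c)

content-unique : ∀ f g → (∀ e → CommonDivisor e f → CommonDivisor e g) →
                 (∀ e → CommonDivisor e g → CommonDivisor e f) → content f ≡ content g
content-unique f@(form a b c) g@(form a′ b′ c′) to from = cong +_ (ℕ.∣-antisym
  (∣gcd₃⇐ {content f} {a′} {b′} {c′}
    (to   (content f) (∣gcd₃⇒ {content f} {a}  {b}  {c}  ℕ.∣-refl)))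
  (∣gcd₃⇐ {content g} {a} {b} {c}
    (from (content g) (∣gcd₃⇒ {content g} {a′} {b′} {c′} ℕ.∣-refl))))

commonDivisor-⊙ : ∀ e f γ → CommonDivisor e f → CommonDivisor e (f ⊙ γ)
commonDivisor-⊙ e (form a b c) (sl₂ p q r s _) (e∣a , e∣b , e∣c) =
  ∣-linear {e} {a} {b} {c} e∣a e∣b e∣c (p * p) (p * r) (r * r) ,
  subst (e ∣_) (identity a b c p q r s)
    (∣-linear {e} {a} {b} {c} e∣a e∣b e∣c (+ 2 * (p * q)) (p * s + q * r) (+ 2 * (r * s))) ,
  ∣-linear {e} {a} {b} {c} e∣a e∣b e∣c (q * q) (q * s) (s * s)
  where
  identity : ∀ a b c p q r s →
    a * (+ 2 * (p * q)) + b * (p * s + q * r) + c * (+ 2 * (r * s))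
    ≡ + 2 * (a * (p * q)) + b * (p * s + q * r) + + 2 * (c * (r * s))
  identity = solve-∀

primitive-⊙ : ∀ f γ → Primitive f → Primitive (f ⊙ γ)
primitive-⊙ f γ = trans (content-unique (f ⊙ γ) f
  (λ e e∣ → subst (CommonDivisor e) (⊙-inverse f γ)
              (commonDivisor-⊙ e (f ⊙ γ) (inverse γ) e∣))
  (λ e → commonDivisor-⊙ e f γ))

⊙ᶜ-inverse : ∀ f γ → (f ⊙ᶜ γ) ⊙ᶜ inverse γ ≡ f
⊙ᶜ-inverse f γ = ⟦⟧-injective (begin
  ⟦ (f ⊙ᶜ γ) ⊙ᶜ inverse γ ⟧   ≡⟨ ⟦⊙ᶜ⟧ (f ⊙ᶜ γ) (inverse γ) ⟩
  ⟦ f ⊙ᶜ γ ⟧ ⊙ inverse γ      ≡⟨ cong (_⊙ inverse γ) (⟦⊙ᶜ⟧ f γ) ⟩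
  (⟦ f ⟧ ⊙ γ) ⊙ inverse γ     ≡⟨ ⊙-inverse ⟦ f ⟧ γ ⟩
  ⟦ f ⟧                       ∎)
  where open ≡-Reasoning

-- Not compatible with substitutions; only used to express divisor as a content.
halve : Classical → Form
halve ⟨ a ,2· b , c ⟩ = form a b c

CommonDivisorᶜ : ℤ → Classical → Set
CommonDivisorᶜ e f = CommonDivisor e (halve f)

commonDivisor-⊙ᶜ : ∀ e f γ → CommonDivisorᶜ e f → CommonDivisorᶜ e (f ⊙ᶜ γ)
commonDivisor-⊙ᶜ e ⟨ a ,2· b , c ⟩ (sl₂ p q r s _) (e∣a , e∣b , e∣c) =
  subst (e ∣_) (identity a b c p r)
    (∣-linear {e} {a} {b} {c} e∣a e∣b e∣c (p * p) (+ 2 * (p * r)) (r * r)) ,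
  ∣-linear {e} {a} {b} {c} e∣a e∣b e∣c (p * q) (p * s + q * r) (r * s) ,
  subst (e ∣_) (identity a b c q s)
    (∣-linear {e} {a} {b} {c} e∣a e∣b e∣c (q * q) (+ 2 * (q * s)) (s * s))
  where
  identity : ∀ a b c x y → a * (x * x) + b * (+ 2 * (x * y)) + c * (y * y)
                         ≡ a * (x * x) + + 2 * b * (x * y) + c * (y * y)
  identity = solve-∀

divisor-⊙ᶜ : ∀ f γ → divisor (f ⊙ᶜ γ) ≡ divisor f
divisor-⊙ᶜ f γ = content-unique (halve (f ⊙ᶜ γ)) (halve f)
  (λ e e∣ → subst (CommonDivisorᶜ e) (⊙ᶜ-inverse f γ)
              (commonDivisor-⊙ᶜ e (f ⊙ᶜ γ) (inverse γ) e∣))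
  (λ e → commonDivisor-⊙ᶜ e f γ)

·-⊙ᶜ : ∀ d f γ → (d · f) ⊙ᶜ γ ≡ d · (f ⊙ᶜ γ)
·-⊙ᶜ d ⟨ a ,2· b , c ⟩ (sl₂ p q r s _) =
  classical-cong (i₁ d a b c p r) (i₂ d a b c p q r s) (i₁ d a b c q s)
  where
  i₁ : ∀ d a b c x y →
    d * a * (x * x) + + 2 * (d * b) * (x * y) + d * c * (y * y)
    ≡ d * (a * (x * x) + + 2 * b * (x * y) + c * (y * y))
  i₁ = solve-∀
  i₂ : ∀ d a b c p q r s →
    d * a * (p * q) + d * b * (p * s + q * r) + d * c * (r * s)
    ≡ d * (a * (p * q) + b * (p * s + q * r) + c * (r * s))
  i₂ = solve-∀

outerEven-⊙ᶜ : ∀ f γ → OuterEven f → OuterEven (f ⊙ᶜ γ)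
outerEven-⊙ᶜ ⟨ a ,2· b , c ⟩ (sl₂ p q r s _) (2∣a , 2∣c) =
  ∣-linear {+ 2} {a} {+ 2 * b} {c} 2∣a 2∣2b 2∣c (p * p) (p * r) (r * r) ,
  ∣-linear {+ 2} {a} {+ 2 * b} {c} 2∣a 2∣2b 2∣c (q * q) (q * s) (s * s)
  where
  2∣2b : + 2 ∣ + 2 * b
  2∣2b = Signed.∣⇒∣ᵤ (Signed.∣m⇒∣m*n b (Signed.∣-refl {+ 2}))

scaled-⊙ᶜ : ∀ {f g} γ → f ≡ divisor f · g → f ⊙ᶜ γ ≡ divisor (f ⊙ᶜ γ) · (g ⊙ᶜ γ)
scaled-⊙ᶜ {f} {g} γ f≡δg = begin
  f ⊙ᶜ γ                          ≡⟨ cong (_⊙ᶜ γ) f≡δg ⟩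
  (divisor f · g) ⊙ᶜ γ            ≡⟨ ·-⊙ᶜ (divisor f) g γ ⟩
  divisor f · (g ⊙ᶜ γ)            ≡⟨ cong (_· (g ⊙ᶜ γ)) (divisor-⊙ᶜ f γ) ⟨
  divisor (f ⊙ᶜ γ) · (g ⊙ᶜ γ)     ∎
  where open ≡-Reasoning

even-⊙ᶜ : ∀ f γ → Even f → Even (f ⊙ᶜ γ)
even-⊙ᶜ f γ (g , f≡δg , g-prim , g-even) =
  g ⊙ᶜ γ , scaled-⊙ᶜ γ f≡δg , trans (divisor-⊙ᶜ g γ) g-prim , outerEven-⊙ᶜ g γ g-even

uneven-⊙ᶜ : ∀ f γ → Uneven f → Uneven (f ⊙ᶜ γ)
uneven-⊙ᶜ f γ (g , f≡δg , g-prim , g-uneven) =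
  g ⊙ᶜ γ , scaled-⊙ᶜ γ f≡δg , trans (divisor-⊙ᶜ g γ) g-prim ,
  λ even → g-uneven (subst OuterEven (⊙ᶜ-inverse g γ) (outerEven-⊙ᶜ (g ⊙ᶜ γ) (inverse γ) even))

outerEven? : ∀ f → Dec (OuterEven f)
outerEven? ⟨ a ,2· b , c ⟩ = (2 ℕ.∣? ∣ a ∣) ×-dec (2 ℕ.∣? ∣ c ∣)

divisor-common : ∀ f → CommonDivisorᶜ (divisor f) f
divisor-common f@(⟨ a ,2· b , c ⟩) = ∣gcd₃⇒ {divisor f} {a} {b} {c} ℕ.∣-refl

divisor≢0 : ∀ f → PositiveDefiniteᶜ f → ℤ.NonZero (divisor f)
divisor≢0 f@(⟨ a ,2· b , c ⟩) (a>0 , _) = ℤ.≢-nonZero {divisor f} λ δ≡0 →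
  ℤ.<⇒≢ a>0 (sym (ℤ.∣i∣≡0⇒i≡0 (ℕ.0∣⇒≡0
    (subst (_∣ a) δ≡0 (proj₁ (divisor-common f))))))

quotient : ∀ f → ∃ λ g → f ≡ divisor f · g
quotient f@(⟨ a ,2· b , c ⟩)
  with δ∣a , δ∣b , δ∣c ← divisor-common f
  with Signed.∣ᵤ⇒∣ {divisor f} {a} δ∣a | Signed.∣ᵤ⇒∣ {divisor f} {b} δ∣b
     | Signed.∣ᵤ⇒∣ {divisor f} {c} δ∣c
... | Signed.divides a′ a≡ | Signed.divides b′ b≡ | Signed.divides c′ c≡ =
  ⟨ a′ ,2· b′ , c′ ⟩ ,
  classical-cong (trans a≡ (ℤ.*-comm a′ _)) (trans b≡ (ℤ.*-comm b′ _)) (trans c≡ (ℤ.*-comm c′ _))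

·-cancelˡ : ∀ d .{{_ : ℤ.NonZero d}} {f g} → d · f ≡ d · g → f ≡ g
·-cancelˡ d {⟨ a ,2· b , c ⟩} {⟨ a′ ,2· b′ , c′ ⟩} eq = classical-cong
  (ℤ.*-cancelˡ-≡ d a a′ (cong Classical.a eq))
  (ℤ.*-cancelˡ-≡ d b b′ (cong Classical.b eq))
  (ℤ.*-cancelˡ-≡ d c c′ (cong Classical.c eq))

quotient? : ∀ {ℓ} {R : Pred Classical ℓ} → (∀ g → Dec (R g)) →
            ∀ f → PositiveDefiniteᶜ f → Dec (∃ λ g → f ≡ divisor f · g × R g)
quotient? {R = R} R? f f>0 with quotient f
... | g , f≡δg = map′
  (λ r → g , f≡δg , r)
  (λ (g′ , f≡δg′ , r) →
     subst R (·-cancelˡ (divisor f) {{divisor≢0 f f>0}} (trans (sym f≡δg′) f≡δg)) r)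
  (R? g)

uneven? : ∀ f → PositiveDefiniteᶜ f → Dec (Uneven f)
uneven? = quotient? λ g → (divisor g ℤ.≟ 1ℤ) ×-dec ¬? (outerEven? g)

even? : ∀ f → PositiveDefiniteᶜ f → Dec (Even f)
even? = quotient? λ g → (divisor g ℤ.≟ 1ℤ) ×-dec outerEven? g

_≟ᶠ_ : (f g : Form) → Dec (f ≡ g)
form a b c ≟ᶠ form a′ b′ c′ = map′
  (λ (a≡ , b≡ , c≡) → form-cong a≡ b≡ c≡)
  (λ eq → cong Form.a eq , cong Form.b eq , cong Form.c eq)
  ((a ℤ.≟ a′) ×-dec (b ℤ.≟ b′) ×-dec (c ℤ.≟ c′))

square : ∀ x → x * x ≡ + (∣ x ∣ ℕ.* ∣ x ∣)
square (+ n)    = sym (ℤ.pos-* n n)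
square -[1+ n ] = refl

0≤square : ∀ x → 0ℤ ℤ.≤ x * x
0≤square x = subst (0ℤ ℤ.≤_) (sym (square x)) (+≤+ z≤n)

n≤n*n : ∀ n → n ℕ.≤ n ℕ.* n
n≤n*n zero    = z≤n
n≤n*n (suc n) = ℕ.m≤m*n (suc n) (suc n)

square-bound : ∀ {N X} y {M} → 0ℤ ℤ.< N → 0ℤ ℤ.≤ X → N * (y * y) + X ≡ M → ∣ y ∣ ℕ.≤ ∣ M ∣
square-bound {+ suc k} {+ x} y (+<+ _) (+≤+ _) refl
  rewrite square y | sym (ℤ.pos-* (suc k) (∣ y ∣ ℕ.* ∣ y ∣)) = begin
    ∣ y ∣                               ≤⟨ n≤n*n ∣ y ∣ ⟩
    ∣ y ∣ ℕ.* ∣ y ∣                     ≤⟨ ℕ.m≤n*m (∣ y ∣ ℕ.* ∣ y ∣) (suc k) ⟩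
    suc k ℕ.* (∣ y ∣ ℕ.* ∣ y ∣)         ≤⟨ ℕ.m≤m+n _ x ⟩
    suc k ℕ.* (∣ y ∣ ℕ.* ∣ y ∣) ℕ.+ x   ∎
  where open ℕ.≤-Reasoning

module _ (f : Form) (Δ<0 : disc f ℤ.< 0ℤ) where
  open Form f

  x-bound : ∀ x y {m} → m ≡ eval f x y → ∣ x ∣ ℕ.≤ ∣ + 4 * (c * m) ∣
  x-bound x y refl = square-bound x (ℤ.neg-mono-< Δ<0) (0≤square (b * x + + 2 * c * y))
                       (identity a b c x y)
    where
    identity : ∀ a b c x y →
      - (b * b - + 4 * (a * c)) * (x * x) + (b * x + + 2 * c * y) * (b * x + + 2 * c * y)
      ≡ + 4 * (c * (a * (x * x) + b * (x * y) + c * (y * y)))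
    identity = solve-∀

  y-bound : ∀ x y {m} → m ≡ eval f x y → ∣ y ∣ ℕ.≤ ∣ + 4 * (a * m) ∣
  y-bound x y refl = square-bound y (ℤ.neg-mono-< Δ<0) (0≤square (+ 2 * a * x + b * y))
                       (identity a b c x y)
    where
    identity : ∀ a b c x y →
      - (b * b - + 4 * (a * c)) * (y * y) + (+ 2 * a * x + b * y) * (+ 2 * a * x + b * y)
      ≡ + 4 * (a * (a * (x * x) + b * (x * y) + c * (y * y)))
    identity = solve-∀

boundedℤ? : ∀ {ℓ} {P : Pred ℤ ℓ} B → (∀ z → Dec (P z)) → (∀ z → P z → ∣ z ∣ ℕ.≤ B) → Dec (∃ P)
boundedℤ? {P = P} B P? bound = map′ to from
  (ℕ.anyUpTo? (λ n → P? (+ n) ⊎-dec P? (- + n)) (suc B))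
  where
  to : (∃ λ n → n ℕ.< suc B × (P (+ n) ⊎ P (- + n))) → ∃ P
  to (n , _ , inj₁ pn) = + n , pn
  to (n , _ , inj₂ pn) = - + n , pn
  from : ∃ P → ∃ λ n → n ℕ.< suc B × (P (+ n) ⊎ P (- + n))
  from (+ n      , pn) = n , s≤s (bound _ pn) , inj₁ pn
  from (-[1+ n ] , pn) = suc n , s≤s (bound _ pn) , inj₂ pn

abstract
  -- The entries of a matrix taking f to g are bounded.
  _∼?_ : ∀ {f} → disc f ℤ.< 0ℤ → ∀ g → Dec (f ∼ g)
  _∼?_ {f} Δ<0 g@(form a′ b′ c′) = map′
    (λ (p , r , q , s , det , eq) → via (sl₂ p q r s det) eq)
    (λ { (via (sl₂ p q r s det) eq) → p , r , q , s , det , eq })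
    (boundedℤ? ∣ + 4 * (c * a′) ∣ (λ p →
      boundedℤ? ∣ + 4 * (a * a′) ∣ (λ r →
        boundedℤ? ∣ + 4 * (c * c′) ∣ (λ q →
          boundedℤ? ∣ + 4 * (a * c′) ∣ (λ s →
            (p * s - q * r ℤ.≟ 1ℤ) ×-dec (g ≟ᶠ result p q r s))
          (λ s (_ , eq) → y-bound f Δ<0 q s (cong Form.c eq)))
        (λ q (s , _ , eq) → x-bound f Δ<0 q s (cong Form.c eq)))
      (λ r (_ , _ , _ , eq) → y-bound f Δ<0 p r (cong Form.a eq)))
    (λ p (r , _ , _ , _ , eq) → x-bound f Δ<0 p r (cong Form.a eq)))
    where
    open Form f
    result : ℤ → ℤ → ℤ → ℤ → Form
    result p q r s = form (eval f p r)
      (+ 2 * (a * (p * q)) + b * (p * s + q * r) + + 2 * (c * (r * s))) (eval f q s)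

positive-c : ∀ f → PositiveDefinite f → 0ℤ ℤ.< Form.c f
positive-c (form _ _ (+ suc _)) _ = +<+ (s≤s z≤n)
positive-c (form a@(+ suc _) b (+ zero)) (_ , Δ<0)
  rewrite square b | ℤ.*-zeroʳ a = ⊥-elim (ℤ.<⇒≱ Δ<0 (+≤+ z≤n))
positive-c (form (+ suc _) b -[1+ _ ]) (_ , Δ<0)
  rewrite square b = ⊥-elim (ℤ.<⇒≱ Δ<0 (+≤+ z≤n))
positive-c (form (+ zero) _ _) (+<+ () , _)

shift : ∀ b n → ∃ λ k → ∣ b + k * (+ 2 * + suc n) ∣ ℕ.≤ suc n
shift b n = - k , subst (λ z → ∣ z ∣ ℕ.≤ suc n) (sym lemma) bound
  where
  d = 2 ℕ.* suc n
  k = (b + + suc n) ℤ./ℕ d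
  r = (b + + suc n) ℤ.%ℕ d

  r<d : r ℕ.< d
  r<d = ℤ.n%ℕd<d (b + + suc n) d

  identity₁ : ∀ b k m a → b + - k * m ≡ (b + a) - a - k * m
  identity₁ = solve-∀
  identity₂ : ∀ r k m a → (r + k * m) - a - k * m ≡ r - a
  identity₂ = solve-∀

  lemma : b + - k * (+ 2 * + suc n) ≡ r ℤ.⊖ suc n
  lemma = begin
    b + - k * + d                        ≡⟨ identity₁ b k (+ d) (+ suc n) ⟩
    (b + + suc n) - + suc n - k * + d
      ≡⟨ cong (λ z → z - + suc n - k * + d) (ℤ.a≡a%ℕn+[a/ℕn]*n (b + + suc n) d) ⟩
    (+ r + k * + d) - + suc n - k * + d  ≡⟨ identity₂ (+ r) k (+ d) (+ suc n) ⟩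
    + r - + suc n                        ≡⟨ ℤ.m-n≡m⊖n r (suc n) ⟩
    r ℤ.⊖ suc n                          ∎
    where open ≡-Reasoning

  bound : ∣ r ℤ.⊖ suc n ∣ ℕ.≤ suc n
  bound with ℕ.≤-total r (suc n)
  ... | inj₁ r≤a rewrite ℤ.∣⊖∣-≤ r≤a = ℕ.m∸n≤m (suc n) r
  ... | inj₂ a≤r rewrite ℤ.⊖-≥ a≤r = ℕ.≤-trans (ℕ.∸-monoˡ-≤ (suc n) (ℕ.<⇒≤ r<d))
    (ℕ.≤-reflexive (trans (ℕ.m+n∸m≡n (suc n) (suc n ℕ.+ 0)) (ℕ.+-identityʳ (suc n))))

record Reduced (f : Form) : Set where
  constructor reduced
  field
    posdef  : PositiveDefinite f
    ∣b∣≤∣a∣ : ∣ Form.b f ∣ ℕ.≤ ∣ Form.a f ∣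
    ∣a∣≤∣c∣ : ∣ Form.a f ∣ ℕ.≤ ∣ Form.c f ∣

translation : ℤ → SL₂
translation k = sl₂ 1ℤ k 0ℤ 1ℤ (identity k)
  where
  identity : ∀ k → 1ℤ * 1ℤ - k * 0ℤ ≡ 1ℤ
  identity = solve-∀

inversion : SL₂
inversion = sl₂ 0ℤ -1ℤ 1ℤ 0ℤ refl

translate : ∀ a b c k → form a b c ∼ form a (b + k * (+ 2 * a)) (a * (k * k) + b * k + c)
translate a b c k = via (translation k) (form-cong (i₁ a b c) (i₂ a b c k) (i₃ a b c k))
  where
  i₁ : ∀ a b c → a ≡ a * (1ℤ * 1ℤ) + b * (1ℤ * 0ℤ) + c * (0ℤ * 0ℤ)
  i₁ = solve-∀
  i₂ : ∀ a b c k → b + k * (+ 2 * a)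
     ≡ + 2 * (a * (1ℤ * k)) + b * (1ℤ * 1ℤ + k * 0ℤ) + + 2 * (c * (0ℤ * 1ℤ))
  i₂ = solve-∀
  i₃ : ∀ a b c k → a * (k * k) + b * k + c ≡ a * (k * k) + b * (k * 1ℤ) + c * (1ℤ * 1ℤ)
  i₃ = solve-∀

invert : ∀ a b c → form a b c ∼ form c (- b) a
invert a b c = via inversion (form-cong (i₁ a b c) (i₂ a b c) (i₃ a b c))
  where
  i₁ : ∀ a b c → c ≡ a * (0ℤ * 0ℤ) + b * (0ℤ * 1ℤ) + c * (1ℤ * 1ℤ)
  i₁ = solve-∀
  i₂ : ∀ a b c → - b
     ≡ + 2 * (a * (0ℤ * -1ℤ)) + b * (0ℤ * 0ℤ + -1ℤ * 1ℤ) + + 2 * (c * (1ℤ * 0ℤ))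
  i₂ = solve-∀
  i₃ : ∀ a b c → a ≡ a * (-1ℤ * -1ℤ) + b * (-1ℤ * 0ℤ) + c * (0ℤ * 0ℤ)
  i₃ = solve-∀

reduce : ∀ f → PositiveDefinite f → ∃ λ g → Reduced g × f ∼ g
reduce f f>0 = go f f>0 (<-wellFounded ∣ Form.a f ∣)
  where
  go : ∀ f → PositiveDefinite f → Acc ℕ._<_ ∣ Form.a f ∣ → ∃ λ g → Reduced g × f ∼ g
  go f@(form a@(+ suc n) b c) f>0@(a>0 , Δ<0) (acc rs) with shift b n
  ... | k , ∣b′∣≤a with ∣ c′ ∣ ℕ.<? suc n
    where c′ = a * (k * k) + b * k + c
  ...   | no c′≮a = _ , reduced (a>0 , subst (ℤ._< 0ℤ) (sym (disc-∼ f∼g)) Δ<0)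
                                ∣b′∣≤a (ℕ.≮⇒≥ c′≮a) , f∼g
    where f∼g = translate a b c k
  ...   | yes c′<a =
    let r , r-reduced , h∼r = go h h>0 (rs c′<a)
    in r , r-reduced , ∼-trans f∼h h∼r
    where
    g h : Form
    g = form a (b + k * (+ 2 * a)) (a * (k * k) + b * k + c)
    h = form (Form.c g) (- Form.b g) a
    f∼g : f ∼ g
    f∼g = translate a b c k
    f∼h : f ∼ h
    f∼h = ∼-trans f∼g (invert a (Form.b g) (Form.c g))
    h>0 : PositiveDefinite h
    h>0 = positive-c g (a>0 , subst (ℤ._< 0ℤ) (sym (disc-∼ f∼g)) Δ<0) ,
          subst (ℤ._< 0ℤ) (sym (disc-∼ f∼h)) Δ<0
  go (form (+ zero) _ _) (+<+ () , _) _

reduced-bound : ∀ f → Reduced f → ∣ Form.c f ∣ ℕ.≤ ∣ disc f ∣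
reduced-bound f@(form (+ A) b c) (reduced (+<+ A>0 , Δ<0) B≤A A≤C)
  with c | positive-c f (+<+ A>0 , Δ<0)
... | + C | _ = begin
  C                           ≤⟨ ℕ.m+n≤o⇒m≤o∸n C (begin
    C ℕ.+ B ℕ.* B               ≤⟨ ℕ.+-mono-≤ C≤AC (ℕ.*-mono-≤ B≤A (ℕ.≤-trans B≤A A≤C)) ⟩
    A ℕ.* C ℕ.+ A ℕ.* C         ≤⟨ ℕ.m≤m+n _ (A ℕ.* C ℕ.+ A ℕ.* C) ⟩
    _                           ≡⟨ identity (A ℕ.* C) ⟩
    4 ℕ.* (A ℕ.* C)             ∎) ⟩
  4 ℕ.* (A ℕ.* C) ℕ.∸ B ℕ.* B ≡⟨ ℤ.∣⊖∣-≤ BB≤4AC ⟨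
  ∣ B ℕ.* B ℤ.⊖ 4 ℕ.* (A ℕ.* C) ∣ ≡⟨ cong ∣_∣ disc≡ ⟨
  ∣ disc (form (+ A) b (+ C)) ∣ ∎
  where
  open ℕ.≤-Reasoning
  B = ∣ b ∣
  instance A≢0 = ℕ.>-nonZero A>0
  C≤AC : C ℕ.≤ A ℕ.* C
  C≤AC = ℕ.m≤n*m C A
  identity : ∀ x → x ℕ.+ x ℕ.+ (x ℕ.+ x) ≡ 4 ℕ.* x
  identity = solveℕ-∀
  BB≤4AC : B ℕ.* B ℕ.≤ 4 ℕ.* (A ℕ.* C)
  BB≤4AC = ℕ.≤-trans (ℕ.*-mono-≤ B≤A (ℕ.≤-trans B≤A A≤C)) (ℕ.m≤n*m (A ℕ.* C) 4)
  disc≡ : disc (form (+ A) b (+ C)) ≡ B ℕ.* B ℤ.⊖ 4 ℕ.* (A ℕ.* C)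
  disc≡ = trans
    (cong₂ _-_ (square b) (trans (cong (+ 4 *_) (sym (ℤ.pos-* A C))) (sym (ℤ.pos-* 4 (A ℕ.* C)))))
    (ℤ.m-n≡m⊖n (B ℕ.* B) (4 ℕ.* (A ℕ.* C)))

box : ℕ → List ℤ
box N = map +_ (upTo (suc N)) ++ map (λ n → - + n) (upTo (suc N))

∈-box : ∀ {N} z → ∣ z ∣ ℕ.≤ N → z ∈ box N
∈-box     (+ n)    n≤N = ∈-++⁺ˡ (∈-map⁺ +_ (∈-upTo⁺ (s≤s n≤N)))
∈-box {N} -[1+ n ] n≤N = ∈-++⁺ʳ (map +_ (upTo (suc N))) (∈-map⁺ (λ n → - + n) (∈-upTo⁺ (s≤s n≤N)))

cube : ∀ {ℓ} {A : Set ℓ} → (ℤ → ℤ → ℤ → A) → ℕ → List A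
cube F N = cartesianProductWith (λ k z → k z) (cartesianProductWith F (box N) (box N)) (box N)

∈-cube : ∀ {ℓ} {A : Set ℓ} (F : ℤ → ℤ → ℤ → A) {N} x y z →
         ∣ x ∣ ℕ.≤ N → ∣ y ∣ ℕ.≤ N → ∣ z ∣ ℕ.≤ N → F x y z ∈ cube F N
∈-cube F x y z x≤ y≤ z≤ = ∈-cartesianProductWith⁺ (λ k z → k z)
  (∈-cartesianProductWith⁺ F (∈-box x x≤) (∈-box y y≤)) (∈-box z z≤)

positiveDefinite? : ∀ f → Dec (PositiveDefinite f)
positiveDefinite? f = (0ℤ ℤ.<? Form.a f) ×-dec (disc f ℤ.<? 0ℤ)

positiveDefiniteᶜ? : ∀ f → Dec (PositiveDefiniteᶜ f)
positiveDefiniteᶜ? f = (0ℤ ℤ.<? Classical.a f) ×-dec (determinant f ℤ.<? 0ℤ)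

abstract
  formClasses : ∀ {ℓ} (Q : Pred Form ℓ) → (∀ f → Dec (Q f)) → (∀ f γ → Q f → Q (f ⊙ γ)) →
                ∀ Δ → Representatives _∼_ (λ f → PositiveDefinite f × disc f ≡ Δ × Q f)
  formClasses Q Q? Q-⊙ Δ = representatives ∼-trans
    (λ f → positiveDefinite? f ×-dec (disc f ℤ.≟ Δ) ×-dec Q? f)
    (λ { {f} {g} ((_ , Δ<0) , _) _ → _∼?_ {f} Δ<0 g })
    (cube form ∣ Δ ∣) candidates
    where
    candidates : ∀ f → PositiveDefinite f × disc f ≡ Δ × Q f →
                 ∃ λ g → g ∈ cube form ∣ Δ ∣ × (PositiveDefinite g × disc g ≡ Δ × Q g) × f ∼ g
    candidates f (f>0 , refl , Qf) with reduce f f>0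
    ... | g@(form a b c) , g-red@(reduced g>0 b≤a a≤c) , f∼g@(via γ refl) =
      g , ∈-cube form a b c a≤N (ℕ.≤-trans b≤a a≤N) c≤N , (g>0 , disc-∼ f∼g , Q-⊙ f γ Qf) , f∼g
      where
      c≤N : ∣ c ∣ ℕ.≤ ∣ disc f ∣
      c≤N = subst (λ Δ → ∣ c ∣ ℕ.≤ ∣ Δ ∣) (disc-∼ f∼g) (reduced-bound g g-red)
      a≤N : ∣ a ∣ ℕ.≤ ∣ disc f ∣
      a≤N = ℕ.≤-trans a≤c c≤N

  classicalClasses : ∀ {ℓ} (Q : Pred Classical ℓ) → (∀ f → PositiveDefiniteᶜ f → Dec (Q f)) →
    (∀ f γ → Q f → Q (f ⊙ᶜ γ)) →
    ∀ D → Representatives _≈_ (λ f → PositiveDefiniteᶜ f × determinant f ≡ D × Q f)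
  classicalClasses {ℓ} Q Q? Q-⊙ᶜ D = representatives (λ {f} {g} {h} → ∼-trans {⟦ f ⟧} {⟦ g ⟧} {⟦ h ⟧}) P?
    (λ { {f} {g} (f>0 , _) _ → _∼?_ {⟦ f ⟧} (proj₂ (⟦⟧-posdef f f>0)) ⟦ g ⟧ })
    (cube ⟨_,2·_,_⟩ ∣ + 4 * D ∣) candidates
    where
    P : Pred Classical ℓ
    P f = PositiveDefiniteᶜ f × determinant f ≡ D × Q f

    P? : ∀ f → Dec (P f)
    P? f with positiveDefiniteᶜ? f
    ... | no  f≯0 = no λ (f>0 , _) → f≯0 f>0
    ... | yes f>0 = map′ (f>0 ,_) proj₂ ((determinant f ℤ.≟ D) ×-dec Q? f f>0)

    candidates : ∀ f → P f → ∃ λ g → g ∈ cube ⟨_,2·_,_⟩ ∣ + 4 * D ∣ × P g × f ≈ g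
    candidates f (f>0 , refl , Qf) with reduce ⟦ f ⟧ (⟦⟧-posdef f f>0)
    ... | _ , g-red , via γ refl =
      g , ∈-cube ⟨_,2·_,_⟩ (Classical.a g) (Classical.b g) (Classical.c g) a≤N b≤N c≤N ,
      (⟦⟧-posdef⁻¹ g (Reduced.posdef g-red′) , determinant-≈ f g f≈g , Q-⊙ᶜ f γ Qf) , f≈g
      where
      g : Classical
      g = f ⊙ᶜ γ
      f≈g : f ≈ g
      f≈g = ⊙ᶜ⇒≈ f γ
      g-red′ : Reduced ⟦ g ⟧
      g-red′ = subst Reduced (sym (⟦⊙ᶜ⟧ f γ)) g-red
      c≤N : ∣ Classical.c g ∣ ℕ.≤ ∣ + 4 * determinant f ∣
      c≤N = subst (λ Δ → ∣ Classical.c g ∣ ℕ.≤ ∣ Δ ∣) (trans (disc-∼ f≈g) (disc-⟦⟧ f))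
              (reduced-bound ⟦ g ⟧ g-red′)
      a≤N : ∣ Classical.a g ∣ ℕ.≤ ∣ + 4 * determinant f ∣
      a≤N = ℕ.≤-trans (Reduced.∣a∣≤∣c∣ g-red′) c≤N
      b≤N : ∣ Classical.b g ∣ ℕ.≤ ∣ + 4 * determinant f ∣
      b≤N = ℕ.≤-trans
        (ℕ.≤-trans (ℕ.m≤n*m ∣ Classical.b g ∣ 2)
                   (ℕ.≤-reflexive (sym (ℤ.abs-* (+ 2) (Classical.b g)))))
        (ℕ.≤-trans (Reduced.∣b∣≤∣a∣ g-red′) a≤N)

InClassDerivedFrom : Classical → Classical → Set
InClassDerivedFrom g f = ∃ λ t → 1 ℕ.≤ t × f ≈ + t · g

determinant-· : ∀ d f → determinant (d · f) ≡ d * d * determinant f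
determinant-· d ⟨ a ,2· b , c ⟩ = identity d a b c
  where
  identity : ∀ d a b c → d * b * (d * b) - d * a * (d * c) ≡ d * d * (b * b - a * c)
  identity = solve-∀

abstract
  inClassDerivedFrom? : ∀ g → determinant g ℤ.< 0ℤ → ∀ f → Dec (InClassDerivedFrom g f)
  inClassDerivedFrom? g D<0 f = map′
    (λ (t , _ , 1≤t , f≈tg) → t , 1≤t , f≈tg)
    (λ (t , 1≤t , f≈tg) → t , s≤s (t-bound t f≈tg) , 1≤t , f≈tg)
    (ℕ.anyUpTo? dec (suc ∣ determinant f ∣))
    where
    negative : ∀ t → determinant (+ suc t · g) ℤ.< 0ℤ
    negative t = subst₂ ℤ._<_ (sym (determinant-· (+ suc t) g))
      (ℤ.*-zeroʳ (+ suc t * + suc t)) (ℤ.*-monoˡ-<-pos (+ suc t * + suc t) D<0)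

    dec : ∀ t → Dec (1 ℕ.≤ t × f ≈ + t · g)
    dec zero    = no λ ()
    dec (suc t) = map′ (λ tg≈f → s≤s z≤n , ∼-sym tg≈f) (∼-sym ∘ proj₂)
      (_∼?_ {⟦ + suc t · g ⟧}
        (subst (ℤ._< 0ℤ) (sym (disc-⟦⟧ (+ suc t · g))) (pos-4* (negative t))) ⟦ f ⟧)

    t-bound : ∀ t → f ≈ + t · g → t ℕ.≤ ∣ determinant f ∣
    t-bound t f≈tg = begin
      t                                 ≤⟨ n≤n*n t ⟩
      t ℕ.* t                           ≤⟨ ℕ.m≤m*n (t ℕ.* t) ∣ determinant g ∣ {{D≢0}} ⟩
      t ℕ.* t ℕ.* ∣ determinant g ∣     ≡⟨ cong (ℕ._* ∣ determinant g ∣) (ℤ.abs-* (+ t) (+ t)) ⟨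
      ∣ + t * + t ∣ ℕ.* ∣ determinant g ∣ ≡⟨ ℤ.abs-* (+ t * + t) (determinant g) ⟨
      ∣ + t * + t * determinant g ∣
        ≡⟨ cong ∣_∣ (trans (sym (determinant-· (+ t) g)) (determinant-≈ f (+ t · g) f≈tg)) ⟩
      ∣ determinant f ∣                 ∎
      where
      open ℕ.≤-Reasoning
      D≢0 : ℕ.NonZero ∣ determinant g ∣
      D≢0 = ℤ.≢-nonZero (ℤ.<⇒≢ D<0)

weight : Classical → ℚ
weight f =
  if does (inClassDerivedFrom? ⟨ + 1 ,2· + 0 , + 1 ⟩ -<+ f) then + 1 ℚ./ 2 else
  if does (inClassDerivedFrom? ⟨ + 2 ,2· + 1 , + 2 ⟩ -<+ f) then + 1 ℚ./ 3 else 1ℚ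

sum : List ℚ → ℚ
sum = foldr ℚ._+_ 0ℚ

unevenClasses : ∀ n → Representatives _≈_
  (λ f → PositiveDefiniteᶜ f × determinant f ≡ - + n × Uneven f)
unevenClasses n = classicalClasses Uneven uneven? uneven-⊙ᶜ (- + n)

evenClasses : ∀ n → Representatives _≈_
  (λ f → PositiveDefiniteᶜ f × determinant f ≡ - + n × Even f)
evenClasses n = classicalClasses Even even? even-⊙ᶜ (- + n)

-- Since weight respects ≈, the choice of representatives is immaterial.
F F₁ E : ℕ → ℚ
F  n = sum (map weight (reps (unevenClasses n)))
F₁ n = sum (map weight (reps (evenClasses n)))
E  n = F n ℚ.- F₁ n

primitiveClasses : ∀ Δ → Representatives _∼_
  (λ f → PositiveDefinite f × disc f ≡ Δ × Primitive f)
primitiveClasses = formClasses Primitive (λ f → content f ℤ.≟ 1ℤ) primitive-⊙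

h : ℤ → ℕ
h Δ = length (reps (primitiveClasses Δ))

hω : ℤ → ℚ
hω Δ = if does (Δ ℤ.≟ - + 4) then + 1 ℚ./ 2 else
       if does (Δ ℤ.≟ - + 3) then + 1 ℚ./ 3 else + h Δ ℚ./ 1

infix 4 _≡_[mod_]

_≡_[mod_] : ℤ → ℤ → ℤ → Set
x ≡ y [mod m ] = m ∣ x - y

NegativeDiscriminant : ℤ → Set
NegativeDiscriminant Δ = Δ ℤ.< 0ℤ × (Δ ≡ + 0 [mod + 4 ] ⊎ Δ ≡ + 1 [mod + 4 ])

Squarefree : ℤ → Set
Squarefree m = ∀ d → + (d ℕ.* d) ∣ m → d ≡ 1

-- The discriminants of quadratic fields, and 1, which no Δ < 0 has as Δ₁ below.
Fundamental : ℤ → Set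
Fundamental Δ =
    (Δ ≡ + 1 [mod + 4 ] × Squarefree Δ)
  ⊎ (∃ λ m → Δ ≡ + 4 * m × (m ≡ + 2 [mod + 4 ] ⊎ m ≡ + 3 [mod + 4 ]) × Squarefree m)

record Decomposition (Δ : ℤ) : Set where
  constructor decomposition
  field
    f           : ℕ
    Δ₁          : ℤ
    1≤f         : 1 ℕ.≤ f
    fundamental : Fundamental Δ₁
    Δ≡f²Δ₁      : Δ ≡ + (f ℕ.* f) * Δ₁

negativeDiscriminant? : ∀ Δ → Dec (NegativeDiscriminant Δ)
negativeDiscriminant? Δ =
  (Δ ℤ.<? 0ℤ) ×-dec ((4 ℕ.∣? ∣ Δ - + 0 ∣) ⊎-dec (4 ℕ.∣? ∣ Δ - + 1 ∣))

squarefree? : ∀ m → m ≢ 0ℤ → Squarefree m ⊎ ∃ λ d → 2 ℕ.≤ d × + (d ℕ.* d) ∣ m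
squarefree? m m≢0 with ℕ.anyUpTo? (λ d → (2 ℕ.≤? d) ×-dec (d ℕ.* d ℕ.∣? ∣ m ∣)) (suc ∣ m ∣)
... | yes (d , _ , 2≤d , d²∣m) = inj₂ (d , 2≤d , d²∣m)
... | no none = inj₁ squarefree
  where
  ∣m∣≢0 : ℕ.NonZero ∣ m ∣
  ∣m∣≢0 = ℤ.≢-nonZero m≢0
  squarefree : Squarefree m
  squarefree zero    0∣m  = contradiction (ℤ.∣i∣≡0⇒i≡0 (ℕ.0∣⇒≡0 0∣m)) m≢0
  squarefree (suc zero) _ = refl
  squarefree d@(suc (suc _)) d²∣m = contradiction
    (d , s≤s (ℕ.≤-trans (n≤n*n d) (ℕ.∣⇒≤ {{∣m∣≢0}} d²∣m)) , s≤s (s≤s z≤n) , d²∣m) none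

residue₂ : ∀ x → ∃ λ k → x ≡ + 2 * k ⊎ x ≡ 1ℤ + + 2 * k
residue₂ x with x ℤ.%ℕ 2 | ℤ.n%ℕd<d x 2 | x ℤ./ℕ 2 | ℤ.a≡a%ℕn+[a/ℕn]*n x 2
... | 0 | _ | q | eq = q , inj₁ (trans eq (trans (ℤ.+-identityˡ _) (ℤ.*-comm q (+ 2))))
... | 1 | _ | q | eq = q , inj₂ (trans eq (cong (λ z → 1ℤ + z) (ℤ.*-comm q (+ 2))))
... | suc (suc _) | s≤s (s≤s ()) | _ | _

mod⇐ : ∀ x r k → x ≡ r + k * + 4 → x ≡ r [mod + 4 ]
mod⇐ x r k eq = Signed.∣⇒∣ᵤ (Signed.divides k (trans (cong (_- r) eq) (identity r k)))
  where
  identity : ∀ r k → r + k * + 4 - r ≡ k * + 4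
  identity = solve-∀

mod⇒ : ∀ x r → x ≡ r [mod + 4 ] → ∃ λ k → x ≡ r + k * + 4
mod⇒ x r 4∣ with Signed.∣ᵤ⇒∣ {+ 4} {x - r} 4∣
... | Signed.divides k eq = k , trans (identity x r) (cong (λ z → r + z) eq)
  where
  identity : ∀ x r → x ≡ r + (x - r)
  identity = solve-∀

residue₄ : ∀ x → (x ≡ + 0 [mod + 4 ] ⊎ x ≡ + 1 [mod + 4 ])
               ⊎ (x ≡ + 2 [mod + 4 ] ⊎ x ≡ + 3 [mod + 4 ])
residue₄ x with x ℤ.%ℕ 4 | ℤ.n%ℕd<d x 4 | x ℤ./ℕ 4 | ℤ.a≡a%ℕn+[a/ℕn]*n x 4
... | 0 | _ | q | eq = inj₁ (inj₁ (mod⇐ x (+ 0) q eq))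
... | 1 | _ | q | eq = inj₁ (inj₂ (mod⇐ x (+ 1) q eq))
... | 2 | _ | q | eq = inj₂ (inj₁ (mod⇐ x (+ 2) q eq))
... | 3 | _ | q | eq = inj₂ (inj₂ (mod⇐ x (+ 3) q eq))
... | suc (suc (suc (suc _))) | s≤s (s≤s (s≤s (s≤s ()))) | _ | _

square-factor-mod : ∀ t Δ′ → t * t * Δ′ ≡ + 1 [mod + 4 ] → Δ′ ≡ + 1 [mod + 4 ]
square-factor-mod t Δ′ Δ≡1 with mod⇒ (t * t * Δ′) (+ 1) Δ≡1 | residue₂ t
... | j , eq | k , inj₁ refl = contradiction 4∣1 λ 4∣1 → ℕ.<⇒≱ {1} {4} (s≤s (s≤s z≤n)) (ℕ.∣⇒≤ 4∣1)
  where
  identity₁ : ∀ k Δ′ j → + 1 ≡ (+ 1 + j * + 4) - j * + 4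
  identity₁ = solve-∀
  identity₂ : ∀ k Δ′ j → + 2 * k * (+ 2 * k) * Δ′ - j * + 4 ≡ (k * k * Δ′ - j) * + 4
  identity₂ = solve-∀
  4∣1 : + 4 ∣ + 1
  4∣1 = Signed.∣⇒∣ᵤ (Signed.divides (k * k * Δ′ - j)
    (trans (identity₁ k Δ′ j) (trans (cong (_- j * + 4) (sym eq)) (identity₂ k Δ′ j))))
... | j , eq | k , inj₂ refl = mod⇐ Δ′ (+ 1) (j - (k * k + k) * Δ′)
    (trans (identity₁ k Δ′) (trans (cong (_- (k * k + k) * Δ′ * + 4) eq) (identity₂ k Δ′ j)))
  where
  identity₁ : ∀ k Δ′ → Δ′ ≡ (1ℤ + + 2 * k) * (1ℤ + + 2 * k) * Δ′ - (k * k + k) * Δ′ * + 4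
  identity₁ = solve-∀
  identity₂ : ∀ k Δ′ j →
    (+ 1 + j * + 4) - (k * k + k) * Δ′ * + 4 ≡ + 1 + (j - (k * k + k) * Δ′) * + 4
  identity₂ = solve-∀

negative-factor : ∀ n x → + n * x ℤ.< 0ℤ → x ℤ.< 0ℤ
negative-factor n -[1+ _ ] _ = -<+
negative-factor n (+ m) nm<0 = contradiction (subst (ℤ._< 0ℤ) (sym (ℤ.pos-* n m)) nm<0) λ { (+<+ ()) }

descend : ∀ Δ → NegativeDiscriminant Δ → Fundamental Δ
  ⊎ ∃ λ d → ∃ λ Δ′ → 2 ℕ.≤ d × NegativeDiscriminant Δ′ × Δ ≡ + (d ℕ.* d) * Δ′
descend Δ (Δ<0 , inj₂ Δ≡1) with squarefree? Δ (ℤ.<⇒≢ Δ<0)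
... | inj₁ sf = inj₁ (inj₁ (Δ≡1 , sf))
... | inj₂ (d , 2≤d , d²∣Δ) with Signed.∣ᵤ⇒∣ {+ (d ℕ.* d)} {Δ} d²∣Δ
...   | Signed.divides Δ′ eq = inj₂ (d , Δ′ , 2≤d ,
        (negative-factor (d ℕ.* d) Δ′ (subst (ℤ._< 0ℤ) Δ≡ Δ<0) ,
         inj₂ (square-factor-mod (+ d) Δ′
           (subst (_≡ + 1 [mod + 4 ]) (trans Δ≡ (cong (_* Δ′) (ℤ.pos-* d d))) Δ≡1))) ,
        Δ≡)
  where
  Δ≡ : Δ ≡ + (d ℕ.* d) * Δ′
  Δ≡ = trans eq (ℤ.*-comm Δ′ _)
descend Δ (Δ<0 , inj₁ Δ≡0) with mod⇒ Δ (+ 0) Δ≡0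
... | m , eq = helper (residue₄ m)
  where
  Δ≡4m : Δ ≡ + 4 * m
  Δ≡4m = trans eq (trans (ℤ.+-identityˡ _) (ℤ.*-comm m (+ 4)))
  m<0 : m ℤ.< 0ℤ
  m<0 = neg-4* (subst (ℤ._< 0ℤ) Δ≡4m Δ<0)
  helper : (m ≡ + 0 [mod + 4 ] ⊎ m ≡ + 1 [mod + 4 ]) ⊎ (m ≡ + 2 [mod + 4 ] ⊎ m ≡ + 3 [mod + 4 ]) →
    Fundamental Δ ⊎ ∃ λ d → ∃ λ Δ′ → 2 ℕ.≤ d × NegativeDiscriminant Δ′ × Δ ≡ + (d ℕ.* d) * Δ′
  helper (inj₁ m≡0∨1) = inj₂ (2 , m , s≤s (s≤s z≤n) , (m<0 , m≡0∨1) , Δ≡4m)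
  helper (inj₂ m≡2∨3) with squarefree? m (ℤ.<⇒≢ m<0)
  ... | inj₁ sf = inj₁ (inj₂ (m , Δ≡4m , m≡2∨3 , sf))
  ... | inj₂ (d , 2≤d , d²∣m) with Signed.∣ᵤ⇒∣ {+ (d ℕ.* d)} {m} d²∣m
  ...   | Signed.divides m′ m≡ = inj₂ (d , + 4 * m′ , 2≤d ,
          (negative-factor (d ℕ.* d) (+ 4 * m′) (subst (ℤ._< 0ℤ) Δ≡ Δ<0) ,
           inj₁ (mod⇐ (+ 4 * m′) (+ 0) m′ (trans (ℤ.*-comm (+ 4) m′) (sym (ℤ.+-identityˡ _))))) ,
          Δ≡)
    where
    identity : ∀ d² m′ → + 4 * (m′ * d²) ≡ d² * (+ 4 * m′)
    identity = solve-∀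
    Δ≡ : Δ ≡ + (d ℕ.* d) * (+ 4 * m′)
    Δ≡ = trans Δ≡4m (trans (cong (+ 4 *_) m≡) (identity (+ (d ℕ.* d)) m′))

abstract
  decompose : ∀ Δ → NegativeDiscriminant Δ → Decomposition Δ
  decompose Δ Δ-disc = go Δ Δ-disc (<-wellFounded ∣ Δ ∣)
    where
    go : ∀ Δ → NegativeDiscriminant Δ → Acc ℕ._<_ ∣ Δ ∣ → Decomposition Δ
    go Δ Δ-disc (acc rs) with descend Δ Δ-disc
    ... | inj₁ fundamental = decomposition 1 Δ (s≤s z≤n) fundamental (sym (ℤ.*-identityˡ Δ))
    ... | inj₂ (d , Δ′ , 2≤d , Δ′-disc@(Δ′<0 , _) , eq) =
      decomposition (d ℕ.* f) Δ₁ (ℕ.*-mono-≤ (ℕ.<⇒≤ 2≤d) 1≤f) fundamental Δ≡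
      where
      instance
        ∣Δ′∣≢0 : ℕ.NonZero ∣ Δ′ ∣
        ∣Δ′∣≢0 = ℤ.≢-nonZero (ℤ.<⇒≢ Δ′<0)
      smaller : ∣ Δ′ ∣ ℕ.< ∣ Δ ∣
      smaller = begin-strict
        ∣ Δ′ ∣                   <⟨ ℕ.m<m*n ∣ Δ′ ∣ (d ℕ.* d) (ℕ.≤-trans 2≤d (n≤n*n d)) ⟩
        ∣ Δ′ ∣ ℕ.* (d ℕ.* d)     ≡⟨ ℕ.*-comm ∣ Δ′ ∣ (d ℕ.* d) ⟩
        d ℕ.* d ℕ.* ∣ Δ′ ∣       ≡⟨ ℤ.abs-* (+ (d ℕ.* d)) Δ′ ⟨
        ∣ + (d ℕ.* d) * Δ′ ∣     ≡⟨ cong ∣_∣ eq ⟨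
        ∣ Δ ∣                    ∎
        where open ℕ.≤-Reasoning
      open Decomposition (go Δ′ Δ′-disc (rs smaller))
      identity : ∀ d f → d ℕ.* d ℕ.* (f ℕ.* f) ≡ d ℕ.* f ℕ.* (d ℕ.* f)
      identity = solveℕ-∀
      Δ≡ : Δ ≡ + (d ℕ.* f ℕ.* (d ℕ.* f)) * Δ₁
      Δ≡ = begin
        Δ                                         ≡⟨ eq ⟩
        + (d ℕ.* d) * Δ′                          ≡⟨ cong (+ (d ℕ.* d) *_) Δ≡f²Δ₁ ⟩
        + (d ℕ.* d) * (+ (f ℕ.* f) * Δ₁)          ≡⟨ ℤ.*-assoc (+ (d ℕ.* d)) (+ (f ℕ.* f)) Δ₁ ⟨
        + (d ℕ.* d) * + (f ℕ.* f) * Δ₁            ≡⟨ cong (_* Δ₁) (ℤ.pos-* (d ℕ.* d) (f ℕ.* f)) ⟨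
        + (d ℕ.* d ℕ.* (f ℕ.* f)) * Δ₁            ≡⟨ cong (λ n → + n * Δ₁) (identity d f) ⟩
        + (d ℕ.* f ℕ.* (d ℕ.* f)) * Δ₁            ∎
        where open ≡-Reasoning

-- The divisor t of f is suc i; the divisions Δ / t² are exact.
hurwitzSum : ∀ {Δ} → Decomposition Δ → ℚ
hurwitzSum {Δ} (decomposition f _ _ _ _) =
  sum (map (λ i → hω (Δ ℤ./ℕ (suc i ℕ.* suc i))) (filter (λ i → suc i ℕ.∣? f) (upTo f)))

-- H N is 0 by convention if - N is not a negative discriminant.
H : ℕ → ℚ
H N with negativeDiscriminant? (- + N)
... | yes Δ-disc = hurwitzSum (decompose (- + N) Δ-disc)
... | no  _      = 0ℚ

{-# OPTIONS --safe #-}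
{-
Sort the classical forms of determinant -n by the content κ of ax² + 2bxy + cy²: the form is κ g
with g primitive of discriminant D and κ² D = -4n, and for 4 ∤ n it is uneven or even according
as κ is odd or even.  Weights correspond, so F(n) and F₁(n) are sums of hω(-4n/κ²) over odd and
over even κ.  The t dividing the conductor of Δ are exactly those for which Δ/t² is a
discriminant.  Hence for n ≡ 1, 2 (mod 4) there are no even forms and F(n) = H(4n), while for
n ≡ 3 (mod 4), where all t are odd, F₁(n) = Σ hω(D) = H(n) and F(n) = Σ hω(4D), the sums being
over D = -n/t².

It remains to compare hω(4D) with hω(D) for D ≡ 1 (mod 4).  Every primitive form of discriminant
4D is equivalent to f(x, 2y) for some primitive f of discriminant D with odd leading coefficient,
and two such forms f(x, 2y) are equivalent iff the f are equivalent under Γ₀(2).  Over the class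
of f therefore lie the cosets of Γ₀(2) in SL₂(ℤ) that give an odd leading coefficient, modulo the
automorphs of f: one coset if D ≡ 1 (mod 8), all three if D ≡ 5 (mod 8).  For D < -4 the
automorphs are ±1 and act trivially; D = -3 is checked by reduction.
-}
module Submission where

open import Defs
open import Data.Bool.Base using (if_then_else_)
open import Data.Empty using (⊥; ⊥-elim)
open import Data.Integer.Base as ℤ
  using (ℤ; +_; -[1+_]; 0ℤ; 1ℤ; -1ℤ; ∣_∣; _+_; _*_; _-_; -_; +<+; -<+; +≤+)
open import Data.Integer.Divisibility using (_∣_)
import Data.Integer.Divisibility.Signed as Signed
import Data.Integer.DivMod as ℤ
import Data.Integer.Properties as ℤ
open import Data.Integer.Tactic.RingSolver using (solve-∀)
open import Data.List.Base using (List; []; _∷_; [_]; _++_; map; filter; concatMap; length; upTo)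
open import Data.List.Membership.Propositional using (_∈_; find; lose)
import Data.List.Membership.Propositional.Properties as ∈
import Data.List.Properties as List
open import Data.List.Relation.Binary.Permutation.Propositional as ↭ using (_↭_)
import Data.List.Relation.Binary.Permutation.Propositional.Properties as ↭
open import Data.List.Relation.Unary.All as All using (All; []; _∷_)
import Data.List.Relation.Unary.All.Properties as All
open import Data.List.Relation.Unary.AllPairs as AllPairs using (AllPairs; []; _∷_)
import Data.List.Relation.Unary.AllPairs.Properties as AllPairs
open import Data.List.Relation.Unary.Any as Any using (Any; here; there)
import Data.List.Relation.Unary.Unique.Propositional.Properties as Unique
open import Data.Nat.Base as ℕ using (ℕ; zero; suc; z≤n; s≤s; _%_; _≥_)
import Data.Nat.Coprimality as ℕ
import Data.Nat.Divisibility as ℕ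
import Data.Nat.DivMod as ℕ
import Data.Nat.GCD as ℕ
import Data.Nat.Properties as ℕ
open import Data.Nat.Tactic.RingSolver using () renaming (solve-∀ to solveℕ-∀)
open import Data.Product.Base using (∃; _×_; _,_; proj₁; proj₂)
open import Data.Rational.Base as ℚ using (ℚ; 0ℚ; 1ℚ)
import Data.Rational.Properties as ℚ
import Data.Rational.Unnormalised.Base as ℚᵘ
import Data.Rational.Unnormalised.Properties as ℚᵘ
open import Data.Sum.Base as Sum using (_⊎_; inj₁; inj₂)
open import Level using (Level)
open import Relation.Binary.PropositionalEquality
  using (_≡_; _≢_; refl; sym; trans; cong; cong₂; subst; subst₂; module ≡-Reasoning)
open import Relation.Nullary using (¬_; Dec; yes; no; does; contradiction)
open import Relation.Nullary.Decidable using (_×-dec_; _→-dec_; _⊎-dec_; from-yes; from-no)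

-- Sums over matched lists

-- The lists of representatives are opaque: only soundness, distinctness and exhaustiveness are
-- known of them. Counts are therefore not evaluated; two weighted sums are compared by a relation
-- that pairs every entry of one list with exactly one entry of the other. Only h(-4), h(-3) and
-- h(-12) are computed. The first two are needed because `hω` prescribes 1/2 and 1/3 without
-- mentioning `h`, and because the weight of a classical form is defined by equivalence to a
-- multiple of one fixed form: class number 1 turns that condition into a condition on the
-- discriminant alone. The factors 1 and 3 come from reduction mod 2. A coset of Γ₀(2) is determined
-- by the first column of its matrices mod 2, one of the three nonzero vectors, and the leading
-- coefficient is the value of the form there. For D ≡ 1 (mod 8) the form splits mod 2 and is odd at
-- exactly one of them; for D ≡ 5 (mod 8) it is x² + xy + y² and is odd at all three.

AllPairs-resp-↭ : ∀ {a r} {A : Set a} {R : A → A → Set r} → (∀ {x y} → R x y → R y x) →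
                  ∀ {xs ys} → xs ↭ ys → AllPairs R xs → AllPairs R ys
AllPairs-resp-↭ sym ↭.refl         rs       = rs
AllPairs-resp-↭ sym (↭.prep x p)   (r ∷ rs) = ↭.All-resp-↭ p r ∷ AllPairs-resp-↭ sym p rs
AllPairs-resp-↭ sym (↭.swap x y p) ((xy ∷ r) ∷ r′ ∷ rs) =
  (sym xy ∷ ↭.All-resp-↭ p r′) ∷ ↭.All-resp-↭ p r ∷ AllPairs-resp-↭ sym p rs
AllPairs-resp-↭ sym (↭.trans p q)  rs       = AllPairs-resp-↭ sym q (AllPairs-resp-↭ sym p rs)

sum-↭ : ∀ {xs ys} → xs ↭ ys → sum xs ≡ sum ys
sum-↭ ↭.refl          = refl
sum-↭ (↭.prep x p)    = cong (x ℚ.+_) (sum-↭ p)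
sum-↭ (↭.swap {xs = xs} {ys} x y p) = begin
  x ℚ.+ (y ℚ.+ sum xs)   ≡⟨ ℚ.+-assoc x y (sum xs) ⟨
  x ℚ.+ y ℚ.+ sum xs     ≡⟨ cong₂ ℚ._+_ (ℚ.+-comm x y) (sum-↭ p) ⟩
  y ℚ.+ x ℚ.+ sum ys     ≡⟨ ℚ.+-assoc y x (sum ys) ⟩
  y ℚ.+ (x ℚ.+ sum ys)   ∎
  where open ≡-Reasoning
sum-↭ (↭.trans p q)   = trans (sum-↭ p) (sum-↭ q)

sum-++ : ∀ xs ys → sum (xs ++ ys) ≡ sum xs ℚ.+ sum ys
sum-++ []       ys = sym (ℚ.+-identityˡ (sum ys))
sum-++ (x ∷ xs) ys = trans (cong (x ℚ.+_) (sum-++ xs ys)) (sym (ℚ.+-assoc x (sum xs) (sum ys)))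

sum-concatMap : ∀ {a b} {A : Set a} {B : Set b} (w : B → ℚ) (f : A → List B) xs →
                sum (map w (concatMap f xs)) ≡ sum (map (λ x → sum (map w (f x))) xs)
sum-concatMap w f []       = refl
sum-concatMap w f (x ∷ xs) = begin
  sum (map w (f x ++ concatMap f xs))
    ≡⟨ cong sum (List.map-++ w (f x) (concatMap f xs)) ⟩
  sum (map w (f x) ++ map w (concatMap f xs))
    ≡⟨ sum-++ (map w (f x)) _ ⟩
  sum (map w (f x)) ℚ.+ sum (map w (concatMap f xs))
    ≡⟨ cong (sum (map w (f x)) ℚ.+_) (sum-concatMap w f xs) ⟩
  sum (map w (f x)) ℚ.+ sum (map (λ y → sum (map w (f y))) xs) ∎
  where open ≡-Reasoning

sum-map-cong : ∀ {a} {A : Set a} {v w : A → ℚ} {xs} → All (λ x → v x ≡ w x) xs →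
               sum (map v xs) ≡ sum (map w xs)
sum-map-cong []       = refl
sum-map-cong (p ∷ ps) = cong₂ ℚ._+_ p (sum-map-cong ps)

sum-map-* : ∀ {a} {A : Set a} (q : ℚ) (w : A → ℚ) xs →
            sum (map (λ x → q ℚ.* w x) xs) ≡ q ℚ.* sum (map w xs)
sum-map-* q w []       = sym (ℚ.*-zeroʳ q)
sum-map-* q w (x ∷ xs) = trans (cong (q ℚ.* w x ℚ.+_) (sum-map-* q w xs))
                               (sym (ℚ.*-distribˡ-+ q (w x) (sum (map w xs))))

abstract
  fromℕ : ℕ → ℚ
  fromℕ n = + n ℚ./ 1

  fromℕ-def : ∀ n → fromℕ n ≡ + n ℚ./ 1
  fromℕ-def n = refl

  fromℕ-0 : fromℕ 0 ≡ 0ℚ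
  fromℕ-0 = refl

  fromℕ-1 : fromℕ 1 ≡ 1ℚ
  fromℕ-1 = refl

  fromℕ-suc : ∀ n → fromℕ (suc n) ≡ 1ℚ ℚ.+ fromℕ n
  fromℕ-suc n = ℚ.toℚᵘ-injective (begin-equality
    ℚ.toℚᵘ (fromℕ (suc n))          ≃⟨ ℚ.toℚᵘ-fromℚᵘ (ℚᵘ.mkℚᵘ (+ suc n) 0) ⟩
    ℚᵘ.mkℚᵘ (+ suc n) 0             ≡⟨ cong (λ z → ℚᵘ.mkℚᵘ z 0) (identity (+ n)) ⟩
    ℚᵘ.1ℚᵘ ℚᵘ.+ ℚᵘ.mkℚᵘ (+ n) 0     ≃⟨ ℚᵘ.+-congʳ ℚᵘ.1ℚᵘ (ℚ.toℚᵘ-fromℚᵘ (ℚᵘ.mkℚᵘ (+ n) 0)) ⟨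
    ℚᵘ.1ℚᵘ ℚᵘ.+ ℚ.toℚᵘ (fromℕ n)    ≃⟨ ℚ.toℚᵘ-homo-+ 1ℚ (fromℕ n) ⟨
    ℚ.toℚᵘ (1ℚ ℚ.+ fromℕ n)         ∎)
    where
    open ℚᵘ.≤-Reasoning
    identity : ∀ z → 1ℤ + z ≡ 1ℤ * 1ℤ + z * 1ℤ
    identity = solve-∀

sum-const : ∀ {a} {A : Set a} (q : ℚ) (xs : List A) →
            sum (map (λ _ → q) xs) ≡ q ℚ.* fromℕ (length xs)
sum-const q []       = sym (trans (cong (q ℚ.*_) fromℕ-0) (ℚ.*-zeroʳ q))
sum-const q (x ∷ xs) = begin
  q ℚ.+ sum (map (λ _ → q) xs)            ≡⟨ cong₂ ℚ._+_ (sym (ℚ.*-identityʳ q)) (sum-const q xs) ⟩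
  q ℚ.* 1ℚ ℚ.+ q ℚ.* fromℕ (length xs)    ≡⟨ ℚ.*-distribˡ-+ q 1ℚ (fromℕ (length xs)) ⟨
  q ℚ.* (1ℚ ℚ.+ fromℕ (length xs))        ≡⟨ cong (q ℚ.*_) (fromℕ-suc (length xs)) ⟨
  q ℚ.* fromℕ (suc (length xs))           ∎
  where open ≡-Reasoning

-- A bijection given as a relation: `S` may be far from functional on the whole types, since
-- uniqueness is asked only between distinct positions of the two lists. Equivalence of forms
-- supplies such relations without a choice of representatives.
record Matching {a b s} {A : Set a} {B : Set b} (S : A → B → Set s) (xs : List A) (ys : List B)
                : Set (a Level.⊔ b Level.⊔ s) where
  constructor matching
  field
    totalˡ  : All (λ x → Any (S x) ys) xs
    totalʳ  : All (λ y → Any (λ x → S x y) xs) ys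
    uniqueˡ : AllPairs (λ x x′ → ∀ y → S x y → ¬ S x′ y) xs
    uniqueʳ : AllPairs (λ y y′ → ∀ x → S x y → ¬ S x y′) ys

module _ {a b s : Level} {A : Set a} {B : Set b} {S : A → B → Set s} where

  -- Induction on `xs`: the partner of the head is permuted to the front of `ys` and removed
  -- together with it. By uniqueness on both sides, no remaining entry was matched with a removed
  -- one, so the rest is still a matching.
  sum-matching : (w : A → ℚ) (v : B → ℚ) → ∀ {xs ys} → Matching S xs ys →
                 (∀ {x y} → x ∈ xs → y ∈ ys → S x y → w x ≡ v y) →
                 sum (map w xs) ≡ sum (map v ys)
  sum-matching w v {[]}     {[]}    _ _ = refl
  sum-matching w v {[]}     {_ ∷ _} (matching _ (() ∷ _) _ _) _
  sum-matching w v {x ∷ xs} {ys} (matching (any ∷ totˡ) totʳ (uˡ ∷ uˡs) uʳ) w≡v with find any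
  ... | y , y∈ys , Sxy with ∈.∈-∃++ y∈ys
  ...   | us , vs , refl = begin
    w x ℚ.+ sum (map w xs)          ≡⟨ cong₂ ℚ._+_ (w≡v (here refl) y∈ys Sxy)
                                        (sum-matching w v rest λ x∈ y∈ →
                                          w≡v (there x∈) (↭.∈-resp-↭ (↭.↭-sym σ) (there y∈))) ⟩
    v y ℚ.+ sum (map v (us ++ vs))  ≡⟨ sum-↭ (↭.map⁺ v σ) ⟨
    sum (map v (us ++ [ y ] ++ vs)) ∎
    where
    open ≡-Reasoning
    σ : us ++ [ y ] ++ vs ↭ y ∷ us ++ vs
    σ = ↭.shift y us vs
    tailAny : ∀ {P : B → Set s} → ¬ P y → Any P (us ++ [ y ] ++ vs) → Any P (us ++ vs)
    tailAny ¬Py any = Any.tail ¬Py (↭.Any-resp-↭ σ any)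
    uʳ′ : AllPairs (λ y y′ → ∀ x → S x y → ¬ S x y′) (y ∷ us ++ vs)
    uʳ′ = AllPairs-resp-↭ (λ r x Sxy Sxy′ → r x Sxy′ Sxy) σ uʳ
    rest : Matching S xs (us ++ vs)
    rest = matching
      (All.zipWith (λ (r , any) → tailAny (r y Sxy) any) (uˡ , totˡ))
      (All.zipWith (λ (r , any) → Any.tail (λ Sxy′ → r x Sxy Sxy′) any)
        (AllPairs.head uʳ′ , All.tail (↭.All-resp-↭ σ totʳ)))
      uˡs
      (AllPairs.tail uʳ′)

pairs : ∀ {a b} {A : Set a} {B : Set b} → (A → List B) → List A → List (A × B)
pairs f = concatMap (λ x → map (x ,_) (f x))

module _ {a b : Level} {A : Set a} {B : Set b} (f : A → List B) where

  ∈-pairs⁻ : ∀ {x y} xs → (x , y) ∈ pairs f xs → x ∈ xs × y ∈ f x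
  ∈-pairs⁻ xs p∈ with find (∈.∈-concatMap⁻ (λ x → map (x ,_) (f x)) {xs = xs} p∈)
  ... | _ , x∈ , p∈′ with ∈.∈-map⁻ _ p∈′
  ...   | _ , y∈ , refl = x∈ , y∈

  ∈-pairs⁺ : ∀ {x y xs} → x ∈ xs → y ∈ f x → (x , y) ∈ pairs f xs
  ∈-pairs⁺ {x} x∈ y∈ = ∈.∈-concatMap⁺ (λ x → map (x ,_) (f x)) (lose x∈ (∈.∈-map⁺ (x ,_) y∈))

  AllPairs-pairs⁺ : ∀ {r} {R : A × B → A × B → Set r} {xs} →
    AllPairs (λ x x′ → ∀ {y y′} → y ∈ f x → y′ ∈ f x′ → R (x , y) (x′ , y′)) xs →
    All (λ x → AllPairs (λ y y′ → R (x , y) (x , y′)) (f x)) xs →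
    AllPairs R (pairs f xs)
  AllPairs-pairs⁺ across within = AllPairs.concat⁺
    (All.map⁺ (All.map AllPairs.map⁺ within))
    (AllPairs.map⁺ (AllPairs.map
      (λ r → All.map⁺ (All.tabulate λ y∈ → All.map⁺ (All.tabulate λ y′∈ → r y∈ y′∈))) across))

-- Parity

Evenℤ Oddℤ : ℤ → Set
Evenℤ x = ∃ λ k → x ≡ + 2 * k
Oddℤ  x = ∃ λ k → x ≡ 1ℤ + + 2 * k

even⊎odd : ∀ x → Evenℤ x ⊎ Oddℤ x
even⊎odd x with residue₂ x
... | k , inj₁ eq = inj₁ (k , eq)
... | k , inj₂ eq = inj₂ (k , eq)

even⇒2∣ : ∀ {x} → Evenℤ x → + 2 ∣ x
even⇒2∣ {x} (k , eq) = Signed.∣⇒∣ᵤ (Signed.divides k (trans eq (ℤ.*-comm (+ 2) k)))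

2∣⇒even : ∀ x → + 2 ∣ x → Evenℤ x
2∣⇒even x 2∣x with Signed.∣ᵤ⇒∣ {+ 2} {x} 2∣x
... | Signed.divides k eq = k , trans eq (ℤ.*-comm k (+ 2))

even-odd-⊥ : ∀ {x} → Evenℤ x → Oddℤ x → ⊥
even-odd-⊥ (j , x≡2j) (k , x≡1+2k) = ℕ.1+n≰n {1} (ℕ.∣⇒≤ (Signed.∣⇒∣ᵤ {+ 2} {1ℤ}
  (Signed.divides (j - k) (trans (identity₁ k)
    (trans (cong (_- + 2 * k) (trans (sym x≡1+2k) x≡2j)) (identity₂ j k))))))
  where
  identity₁ : ∀ k → 1ℤ ≡ (1ℤ + + 2 * k) - + 2 * k
  identity₁ = solve-∀
  identity₂ : ∀ j k → + 2 * j - + 2 * k ≡ (j - k) * + 2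
  identity₂ = solve-∀

even+even : ∀ {x y} → Evenℤ x → Evenℤ y → Evenℤ (x + y)
even+even (j , refl) (k , refl) = j + k , identity j k
  where
  identity : ∀ j k → + 2 * j + + 2 * k ≡ + 2 * (j + k)
  identity = solve-∀

odd+even : ∀ {x y} → Oddℤ x → Evenℤ y → Oddℤ (x + y)
odd+even (j , refl) (k , refl) = j + k , identity j k
  where
  identity : ∀ j k → 1ℤ + + 2 * j + + 2 * k ≡ 1ℤ + + 2 * (j + k)
  identity = solve-∀

odd+odd : ∀ {x y} → Oddℤ x → Oddℤ y → Evenℤ (x + y)
odd+odd (j , refl) (k , refl) = 1ℤ + j + k , identity j k
  where
  identity : ∀ j k → 1ℤ + + 2 * j + (1ℤ + + 2 * k) ≡ + 2 * (1ℤ + j + k)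
  identity = solve-∀

even*ˡ : ∀ {x} y → Evenℤ x → Evenℤ (x * y)
even*ˡ y (k , refl) = k * y , ℤ.*-assoc (+ 2) k y

even*ʳ : ∀ x {y} → Evenℤ y → Evenℤ (x * y)
even*ʳ x {y} e = subst Evenℤ (ℤ.*-comm y x) (even*ˡ x e)

odd*odd : ∀ {x y} → Oddℤ x → Oddℤ y → Oddℤ (x * y)
odd*odd (j , refl) (k , refl) = j + k + + 2 * (j * k) , identity j k
  where
  identity : ∀ j k → (1ℤ + + 2 * j) * (1ℤ + + 2 * k) ≡ 1ℤ + + 2 * (j + k + + 2 * (j * k))
  identity = solve-∀

even-neg : ∀ {x} → Evenℤ x → Evenℤ (- x)
even-neg (k , refl) = - k , identity k
  where
  identity : ∀ k → - (+ 2 * k) ≡ + 2 * (- k)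
  identity = solve-∀

odd-factorˡ : ∀ x y → Oddℤ (x * y) → Oddℤ x
odd-factorˡ x y xy-odd with even⊎odd x
... | inj₁ x-even = ⊥-elim (even-odd-⊥ (even*ˡ y x-even) xy-odd)
... | inj₂ x-odd  = x-odd

odd-cancel : ∀ x y → Oddℤ x → Evenℤ (x * y) → Evenℤ y
odd-cancel x y x-odd xy-even with even⊎odd y
... | inj₁ y-even = y-even
... | inj₂ y-odd  = ⊥-elim (even-odd-⊥ xy-even (odd*odd x-odd y-odd))

even-square⇒even : ∀ x → Evenℤ (x * x) → Evenℤ x
even-square⇒even x e with even⊎odd x
... | inj₁ x-even = x-even
... | inj₂ x-odd  = ⊥-elim (even-odd-⊥ e (odd*odd x-odd x-odd))

-- Multiples of forms

∣-multiple : ∀ e k x → e ∣ x → e ∣ k * x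
∣-multiple e k x e∣x = Signed.∣⇒∣ᵤ (Signed.∣n⇒∣m*n k (Signed.∣ᵤ⇒∣ {e} {x} e∣x))

infixl 7 _∗_

_∗_ : ℤ → Form → Form
k ∗ form a b c = form (k * a) (k * b) (k * c)

∗-⊙ : ∀ k f γ → (k ∗ f) ⊙ γ ≡ k ∗ (f ⊙ γ)
∗-⊙ k (form a b c) (sl₂ p q r s _) =
  form-cong (i₁ k a b c p r) (i₂ k a b c p q r s) (i₁ k a b c q s)
  where
  i₁ : ∀ k a b c x y → k * a * (x * x) + k * b * (x * y) + k * c * (y * y)
                     ≡ k * (a * (x * x) + b * (x * y) + c * (y * y))
  i₁ = solve-∀
  i₂ : ∀ k a b c p q r s →
    + 2 * (k * a * (p * q)) + k * b * (p * s + q * r) + + 2 * (k * c * (r * s))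
    ≡ k * (+ 2 * (a * (p * q)) + b * (p * s + q * r) + + 2 * (c * (r * s)))
  i₂ = solve-∀

∗-∼ : ∀ k {f g} → f ∼ g → k ∗ f ∼ k ∗ g
∗-∼ k {f} (via γ refl) = via γ (sym (∗-⊙ k f γ))

∗-cancel : ∀ k .{{_ : ℤ.NonZero k}} {f g} → k ∗ f ≡ k ∗ g → f ≡ g
∗-cancel k {form a b c} {form a′ b′ c′} eq = form-cong
  (ℤ.*-cancelˡ-≡ k a a′ (cong Form.a eq))
  (ℤ.*-cancelˡ-≡ k b b′ (cong Form.b eq))
  (ℤ.*-cancelˡ-≡ k c c′ (cong Form.c eq))

∗-∼-cancel : ∀ k .{{_ : ℤ.NonZero k}} {f g} → k ∗ f ∼ k ∗ g → f ∼ g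
∗-∼-cancel k {f} (via γ eq) = via γ (∗-cancel k (trans eq (∗-⊙ k f γ)))

disc-∗ : ∀ k f → disc (k ∗ f) ≡ k * k * disc f
disc-∗ k (form a b c) = identity k a b c
  where
  identity : ∀ k a b c → k * b * (k * b) - + 4 * (k * a * (k * c)) ≡ k * k * (b * b - + 4 * (a * c))
  identity = solve-∀

gcd₃-* : ∀ k x y z → ℕ.gcd (ℕ.gcd (k ℕ.* x) (k ℕ.* y)) (k ℕ.* z) ≡ k ℕ.* ℕ.gcd (ℕ.gcd x y) z
gcd₃-* k x y z = sym (trans (ℕ.c*gcd[m,n]≡gcd[cm,cn] k (ℕ.gcd x y) z)
                            (cong (λ d → ℕ.gcd d (k ℕ.* z)) (ℕ.c*gcd[m,n]≡gcd[cm,cn] k x y)))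

content-∗ : ∀ k f → content (k ∗ f) ≡ + (∣ k ∣ ℕ.* ∣ content f ∣)
content-∗ k (form a b c) = cong +_ (trans
  (cong₂ ℕ.gcd (cong₂ ℕ.gcd (ℤ.abs-* k a) (ℤ.abs-* k b)) (ℤ.abs-* k c))
  (gcd₃-* (∣ k ∣) (∣ a ∣) (∣ b ∣) (∣ c ∣)))

content-primitive-∗ : ∀ k f → Primitive f → content (k ∗ f) ≡ + ∣ k ∣
content-primitive-∗ k f f-prim =
  trans (content-∗ k f) (cong +_ (trans (cong (λ d → ∣ k ∣ ℕ.* ∣ d ∣) f-prim)
    (ℕ.*-identityʳ ∣ k ∣)))

-- The content of `k ∗ f` is the absolute value of `k`. This stands in for a Bézout combination of
-- the coefficients of `f`.
∣-primitive-multiple : ∀ e k f → Primitive f → CommonDivisor e (k ∗ f) → e ∣ k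
∣-primitive-multiple e k f@(form a b c) f-prim e∣ =
  subst (e ∣_) (content-primitive-∗ k f f-prim) (∣gcd₃⇐ {e} {k * a} {k * b} {k * c} e∣)

content-∼ : ∀ {f g} → f ∼ g → content g ≡ content f
content-∼ {f} (via γ refl) = content-unique (f ⊙ γ) f
  (λ e e∣ → subst (CommonDivisor e) (⊙-inverse f γ) (commonDivisor-⊙ e (f ⊙ γ) (inverse γ) e∣))
  (λ e → commonDivisor-⊙ e f γ)

primitive-∼ : ∀ {f g} → f ∼ g → Primitive f → Primitive g
primitive-∼ f∼g f-prim = trans (content-∼ f∼g) f-prim

primitive⇐ : ∀ f → (∀ e → CommonDivisor e f → e ∣ 1ℤ) → Primitive f
primitive⇐ f@(form a b c) h = cong +_ (ℕ.∣1⇒≡1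
  (h (content f) (∣gcd₃⇒ {content f} {a} {b} {c} ℕ.∣-refl)))

primitive⇒ : ∀ f → Primitive f → ∀ e → CommonDivisor e f → e ∣ 1ℤ
primitive⇒ (form a b c) f-prim e e∣ = subst (e ∣_) f-prim (∣gcd₃⇐ {e} {a} {b} {c} e∣)

posdef-∼ : ∀ {f g} → f ∼ g → PositiveDefinite f → PositiveDefinite g
posdef-∼ {f@(form a b c)} f∼g@(via γ@(sl₂ p q r s det) refl) (a>0 , Δ<0) = a′>0 , Δ′<0
  where
  g : Form
  g = f ⊙ γ
  Δ′<0 : disc g ℤ.< 0ℤ
  Δ′<0 = subst (ℤ._< 0ℤ) (sym (disc-∼ f∼g)) Δ<0
  a′ = Form.a g
  -- 4 a f(p,r) is a sum of squares, so f(p,r) is not negative; and it is not 0 as disc g < 0.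
  identity : ∀ a b c p r → + 4 * (a * (a * (p * p) + b * (p * r) + c * (r * r)))
    ≡ (+ 2 * a * p + b * r) * (+ 2 * a * p + b * r) + - (b * b - + 4 * (a * c)) * (r * r)
  identity = solve-∀
  0≤-Δ : ∀ Δ → Δ ℤ.< 0ℤ → 0ℤ ℤ.≤ - Δ
  0≤-Δ Δ Δ<0 = ℤ.<⇒≤ (ℤ.neg-mono-< Δ<0)
  0≤4aa′ : 0ℤ ℤ.≤ + 4 * (a * a′)
  0≤4aa′ = subst (0ℤ ℤ.≤_) (sym (identity a b c p r))
    (ℤ.+-mono-≤ (0≤square (+ 2 * a * p + b * r))
      (subst (ℤ._≤ - disc f * (r * r)) (ℤ.*-zeroʳ (- disc f))
        (ℤ.*-monoˡ-≤-nonNeg (- disc f) {{ℤ.nonNegative (0≤-Δ (disc f) Δ<0)}} (0≤square r))))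
  0≤aa′ : 0ℤ ℤ.≤ a * a′
  0≤aa′ = ℤ.*-cancelˡ-≤-pos 0ℤ (a * a′) (+ 4) 0≤4aa′
  0≤a′ : 0ℤ ℤ.≤ a′
  0≤a′ = ℤ.*-cancelˡ-≤-pos 0ℤ a′ a {{ℤ.positive a>0}}
    (subst (ℤ._≤ a * a′) (sym (ℤ.*-zeroʳ a)) 0≤aa′)
  a′≢0 : 0ℤ ≢ a′
  a′≢0 0≡a′ = ℤ.<⇒≱ Δ′<0 (subst (0ℤ ℤ.≤_)
    (trans (identity₂ (Form.b g) (Form.c g))
      (cong (λ z → Form.b g * Form.b g - + 4 * (z * Form.c g)) 0≡a′))
    (0≤square (Form.b g)))
    where
    identity₂ : ∀ b c → b * b ≡ b * b - + 4 * (0ℤ * c)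
    identity₂ = solve-∀
  a′>0 : 0ℤ ℤ.< a′
  a′>0 = ℤ.≤∧≢⇒< 0≤a′ a′≢0

odd-disc⇒odd-b : ∀ f → Oddℤ (disc f) → Oddℤ (Form.b f)
odd-disc⇒odd-b (form a b c) Δ-odd with even⊎odd b
... | inj₂ b-odd  = b-odd
... | inj₁ b-even = ⊥-elim (even-odd-⊥
  (even+even (even*ˡ b b-even) (even-neg (even*ˡ (a * c) (+ 2 , refl)))) Δ-odd)

-- up f (x , y) = f (x , 2y).
up : Form → Form
up (form a b c) = form a (+ 2 * b) (+ 4 * c)

disc-up : ∀ f → disc (up f) ≡ + 4 * disc f
disc-up (form a b c) = identity a b c
  where
  identity : ∀ a b c → + 2 * b * (+ 2 * b) - + 4 * (a * (+ 4 * c)) ≡ + 4 * (b * b - + 4 * (a * c))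
  identity = solve-∀

posdef-up : ∀ f → PositiveDefinite f → PositiveDefinite (up f)
posdef-up f@(form _ _ _) (a>0 , Δ<0) = a>0 , subst (ℤ._< 0ℤ) (sym (disc-up f)) (pos-4* Δ<0)

posdef-up⁻¹ : ∀ f → PositiveDefinite (up f) → PositiveDefinite f
posdef-up⁻¹ f@(form _ _ _) (a>0 , Δ<0) = a>0 , neg-4* (subst (ℤ._< 0ℤ) (disc-up f) Δ<0)

-- Conjugation by diag(1, 2) doubles `q` and halves `r`, so it keeps a matrix of Γ₀(2) integral.
up-∼ : ∀ f γ → Evenℤ (SL₂.r γ) → up f ∼ up (f ⊙ γ)
up-∼ (form a b c) (sl₂ p q _ s det) (k , refl) = via
  (sl₂ p (+ 2 * q) k s (trans (i₀ p q k s) det))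
  (form-cong (i₁ a b c p k) (i₂ a b c p q k s) (i₃ a b c q s))
  where
  i₀ : ∀ p q k s → p * s - + 2 * q * k ≡ p * s - q * (+ 2 * k)
  i₀ = solve-∀
  i₁ : ∀ a b c p k → a * (p * p) + b * (p * (+ 2 * k)) + c * (+ 2 * k * (+ 2 * k))
                   ≡ a * (p * p) + + 2 * b * (p * k) + + 4 * c * (k * k)
  i₁ = solve-∀
  i₂ : ∀ a b c p q k s →
    + 2 * (+ 2 * (a * (p * q)) + b * (p * s + q * (+ 2 * k)) + + 2 * (c * (+ 2 * k * s)))
    ≡ + 2 * (a * (p * (+ 2 * q))) + + 2 * b * (p * s + + 2 * q * k) + + 2 * (+ 4 * c * (k * s))
  i₂ = solve-∀
  i₃ : ∀ a b c q s → + 4 * (a * (q * q) + b * (q * s) + c * (s * s))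
     ≡ a * (+ 2 * q * (+ 2 * q)) + + 2 * b * (+ 2 * q * s) + + 4 * c * (s * s)
  i₃ = solve-∀

-- Mod 2 the last coefficient of the transformed `up f` is `a q²`, whereas that of `up g` is `4 c′`.
-- As `a` is odd, `q` is even, so the conjugation by diag(1, 2) can be undone over ℤ and lands in
-- Γ₀(2).
up-∼⁻¹ : ∀ f g → Oddℤ (Form.a f) → up f ∼ up g → ∃ λ γ → Evenℤ (SL₂.r γ) × g ≡ f ⊙ γ
up-∼⁻¹ (form a b c) (form a′ b′ c′) a-odd (via (sl₂ p q r s det) eq) with even⊎odd q
... | inj₂ q-odd = ⊥-elim (even-odd-⊥ (even*ˡ c′ (+ 2 , refl)) (subst Oddℤ (sym (cong Form.c eq))
  (odd+even (odd+even (odd*odd a-odd (odd*odd q-odd q-odd)) (even*ˡ (q * s) (b , refl)))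
            (even*ˡ (s * s) (even*ˡ c (+ 2 , refl))))))
... | inj₁ (k , refl) =
  sl₂ p k (+ 2 * r) s (trans (i₀ p k r s) det) , (r , refl) ,
  form-cong (trans (cong Form.a eq) (sym (i₁ a b c p r)))
    (ℤ.*-cancelˡ-≡ (+ 2) _ _ (trans (cong Form.b eq) (sym (i₂ a b c p k r s))))
    (ℤ.*-cancelˡ-≡ (+ 4) _ _ (trans (cong Form.c eq) (sym (i₃ a b c k s))))
  where
  i₀ : ∀ p k r s → p * s - k * (+ 2 * r) ≡ p * s - + 2 * k * r
  i₀ = solve-∀
  i₁ : ∀ a b c p k → a * (p * p) + b * (p * (+ 2 * k)) + c * (+ 2 * k * (+ 2 * k))
                   ≡ a * (p * p) + + 2 * b * (p * k) + + 4 * c * (k * k)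
  i₁ = solve-∀
  i₂ : ∀ a b c p q k s →
    + 2 * (+ 2 * (a * (p * q)) + b * (p * s + q * (+ 2 * k)) + + 2 * (c * (+ 2 * k * s)))
    ≡ + 2 * (a * (p * (+ 2 * q))) + + 2 * b * (p * s + + 2 * q * k) + + 2 * (+ 4 * c * (k * s))
  i₂ = solve-∀
  i₃ : ∀ a b c q s → + 4 * (a * (q * q) + b * (q * s) + c * (s * s))
     ≡ a * (+ 2 * q * (+ 2 * q)) + + 2 * b * (+ 2 * q * s) + + 4 * c * (s * s)
  i₃ = solve-∀

primitive-up : ∀ f → Primitive f → Oddℤ (Form.a f) → Primitive (up f)
primitive-up f@(form a b c) f-prim (k , a≡) = primitive⇐ (up f) λ e (e∣a , e∣2b , e∣4c) →
  let e∣4 : e ∣ + 4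
      e∣4 = ∣-primitive-multiple e (+ 4) f f-prim
              ( ∣-multiple e (+ 4) a e∣a
              , subst (e ∣_) (identity₂ b) (∣-multiple e (+ 2) (+ 2 * b) e∣2b)
              , e∣4c )
  -- `e` divides both `a` and 4, and `a² - 4 (k² + k) = 1` for `a = 1 + 2 k`.
  in subst (e ∣_) (trans (cong (λ a → a * a + + 4 * (- (k * k + k)) + + 4 * 0ℤ) a≡) (identity k))
       (∣-linear {e} {a} {+ 4} {+ 4} e∣a e∣4 e∣4 a (- (k * k + k)) 0ℤ)
  where
  identity₂ : ∀ b → + 2 * (+ 2 * b) ≡ + 4 * b
  identity₂ = solve-∀
  identity : ∀ k → (1ℤ + + 2 * k) * (1ℤ + + 2 * k) + + 4 * (- (k * k + k)) + + 4 * 0ℤ ≡ 1ℤ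
  identity = solve-∀

primitive-up⁻¹ : ∀ f → Primitive (up f) → Primitive f
primitive-up⁻¹ f@(form a b c) u-prim = primitive⇐ f λ e (e∣a , e∣b , e∣c) →
  primitive⇒ (up f) u-prim e (e∣a , ∣-multiple e (+ 2) b e∣b , ∣-multiple e (+ 4) c e∣c)

-- Discriminants of class number one

h≡1 : ∀ {Δ} g → PositiveDefinite g × disc g ≡ Δ × Primitive g →
      (∀ f → PositiveDefinite f × disc f ≡ Δ × Primitive f → f ∼ g) → h Δ ≡ 1
h≡1 {Δ} g Pg all∼g = one (reps R) (Representatives.sound R) (Representatives.distinct R)
                         (Representatives.exhaustive R g Pg)
  where
  R = primitiveClasses Δ
  one : ∀ xs → All (λ f → PositiveDefinite f × disc f ≡ Δ × Primitive f) xs →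
        AllPairs (λ x y → ¬ (x ∼ y)) xs → Any (g ∼_) xs → length xs ≡ 1
  one (_ ∷ [])    _               _                 _ = refl
  one (x ∷ y ∷ _) (Px ∷ Py ∷ _) ((x≁y ∷ _) ∷ _) _ =
    contradiction (∼-trans (all∼g x Px) (∼-sym (all∼g y Py))) x≁y

-- Over ℕ the discriminant equation has no subtraction, and the candidates can be searched by a
-- decision procedure.
record ReducedShape (n : ℕ) (f : Form) : Set where
  constructor shape
  field
    A C     : ℕ
    a≡      : Form.a f ≡ + A
    c≡      : Form.c f ≡ + C
    1≤A     : 1 ℕ.≤ A
    B≤A     : ∣ Form.b f ∣ ℕ.≤ A
    A≤C     : A ℕ.≤ C
    4AC≡    : 4 ℕ.* (A ℕ.* C) ≡ ∣ Form.b f ∣ ℕ.* ∣ Form.b f ∣ ℕ.+ n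

reducedShape : ∀ n f → Reduced f → disc f ≡ - + n → ReducedShape n f
reducedShape n f@(form (+ A) b c) (reduced f>0@(+<+ A>0 , Δ<0) B≤A A≤C) Δ≡ with c | positive-c f f>0
... | + C | _ = shape A C refl refl A>0 B≤A A≤C (ℤ.+-injective (begin
    + (4 ℕ.* (A ℕ.* C))              ≡⟨ trans (ℤ.pos-* 4 (A ℕ.* C)) (cong (+ 4 *_) (ℤ.pos-* A C)) ⟩
    + 4 * (+ A * + C)                ≡⟨ identity (b * b) (+ 4 * (+ A * + C)) ⟩
    b * b - (b * b - + 4 * (+ A * + C)) ≡⟨ cong₂ _-_ (square b) Δ≡ ⟩
    + (B ℕ.* B) - - + n              ≡⟨ cong (λ z → + (B ℕ.* B) + z) (ℤ.neg-involutive (+ n)) ⟩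
    + (B ℕ.* B ℕ.+ n)                ∎))
  where
  open ≡-Reasoning
  B = ∣ b ∣
  identity : ∀ x y → y ≡ x - (x - y)
  identity = solve-∀

-- From `B ≤ A ≤ C` follows `B² ≤ A C`, which cancels one of the four copies of `A C`.
shape-bound : ∀ {n f} (s : ReducedShape n f) → 3 ℕ.* (ReducedShape.A s ℕ.* ReducedShape.C s) ℕ.≤ n
shape-bound {n} {f} (shape A C _ _ _ B≤A A≤C 4AC≡) = ℕ.+-cancelˡ-≤ (A ℕ.* C) _ _ (begin
  A ℕ.* C ℕ.+ 3 ℕ.* (A ℕ.* C)   ≡⟨ 4AC≡ ⟩
  B ℕ.* B ℕ.+ n                 ≤⟨ ℕ.+-monoˡ-≤ n (ℕ.*-mono-≤ B≤A (ℕ.≤-trans B≤A A≤C)) ⟩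
  A ℕ.* C ℕ.+ n                 ∎)
  where
  open ℕ.≤-Reasoning
  B = ∣ Form.b f ∣

-- A reduced form of discriminant - n has 3 a c ≤ n, so for n ≤ 12 its coefficients
-- lie in a small box.
module _ (Q : ℕ → ℕ → ℕ → Set) (Q? : ∀ A B C → Dec (Q A B C)) (n : ℕ) where

  SmallShapes : Set
  SmallShapes = ∀ {A} → A ℕ.< 3 → ∀ {B} → B ℕ.< 3 → ∀ {C} → C ℕ.< 5 →
                (1 ℕ.≤ A × B ℕ.≤ A × A ℕ.≤ C × 4 ℕ.* (A ℕ.* C) ≡ B ℕ.* B ℕ.+ n) → Q A B C

  smallShapes? : Dec SmallShapes
  smallShapes? = ℕ.allUpTo? (λ A → ℕ.allUpTo? (λ B → ℕ.allUpTo? (λ C →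
    ((1 ℕ.≤? A) ×-dec (B ℕ.≤? A) ×-dec (A ℕ.≤? C) ×-dec (4 ℕ.* (A ℕ.* C) ℕ.≟ B ℕ.* B ℕ.+ n))
      →-dec Q? A B C) 5) 3) 3

  small-shape : n ℕ.≤ 12 → SmallShapes → ∀ {f} (s : ReducedShape n f) →
          Q (ReducedShape.A s) (∣ Form.b f ∣) (ReducedShape.C s)
  small-shape n≤12 check {f} s@(shape A C _ _ 1≤A B≤A A≤C 4AC≡) =
    check A<3 (ℕ.≤-<-trans B≤A A<3) (s≤s C≤4) (1≤A , B≤A , A≤C , 4AC≡)
    where
    instance
      A≢0 : ℕ.NonZero A
      A≢0 = ℕ.>-nonZero 1≤A
    AC≤4 : A ℕ.* C ℕ.≤ 4
    AC≤4 = ℕ.*-cancelˡ-≤ 3 (ℕ.≤-trans (shape-bound s) n≤12)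
    C≤4 : C ℕ.≤ 4
    C≤4 = ℕ.≤-trans (ℕ.m≤n*m C A) AC≤4
    A<3 : A ℕ.< 3
    A<3 = ℕ.≰⇒> λ 3≤A → ℕ.<⇒≱ {4} {9} (from-yes (4 ℕ.<? 9))
      (ℕ.≤-trans (ℕ.*-mono-≤ 3≤A (ℕ.≤-trans 3≤A A≤C)) AC≤4)

h[-4]≡1 : h (- + 4) ≡ 1
h[-4]≡1 = h≡1 (form (+ 1) (+ 0) (+ 1)) ((+<+ (s≤s z≤n) , -<+) , refl , refl) λ f (f>0 , Δ≡ , _) →
  let g , g-red , f∼g = reduce f f>0
  in ∼-trans f∼g (only g (reducedShape 4 g g-red (trans (disc-∼ f∼g) Δ≡)))
  where
  Q = λ A B C → A ≡ 1 × B ≡ 0 × C ≡ 1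
  Q? = λ A B C → (A ℕ.≟ 1) ×-dec (B ℕ.≟ 0) ×-dec (C ℕ.≟ 1)
  only : ∀ g → ReducedShape 4 g → g ∼ form (+ 1) (+ 0) (+ 1)
  only g@(form _ b _) s@(shape _ _ refl refl _ _ _ _)
    with refl , b≡0 , refl ← small-shape Q Q? 4 (from-yes (4 ℕ.≤? 12))
      (from-yes (smallShapes? Q Q? 4)) s
    with refl ← ℤ.∣i∣≡0⇒i≡0 {b} b≡0 = ∼-refl

h[-3]≡1 : h (- + 3) ≡ 1
h[-3]≡1 = h≡1 (form (+ 1) (+ 1) (+ 1)) ((+<+ (s≤s z≤n) , -<+) , refl , refl) λ f (f>0 , Δ≡ , _) →
  let g , g-red , f∼g = reduce f f>0
  in ∼-trans f∼g (only g (reducedShape 3 g g-red (trans (disc-∼ f∼g) Δ≡)))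
  where
  Q = λ A B C → A ≡ 1 × B ≡ 1 × C ≡ 1
  Q? = λ A B C → (A ℕ.≟ 1) ×-dec (B ℕ.≟ 1) ×-dec (C ℕ.≟ 1)
  -- `Reduced` allows both signs on the boundary where the middle coefficient is as large as `a`; a
  -- unit translation identifies them.
  unit : ∀ b → ∣ b ∣ ≡ 1 → form (+ 1) b (+ 1) ∼ form (+ 1) (+ 1) (+ 1)
  unit (+ _)     refl = ∼-refl
  unit (-[1+ _ ]) refl = translate (+ 1) -1ℤ (+ 1) (+ 1)
  only : ∀ g → ReducedShape 3 g → g ∼ form (+ 1) (+ 1) (+ 1)
  only g@(form _ b _) s@(shape _ _ refl refl _ _ _ _)
    with refl , b≡1 , refl ← small-shape Q Q? 3 (from-yes (3 ℕ.≤? 12))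
      (from-yes (smallShapes? Q Q? 3)) s
    = unit b b≡1

-- Serves the exceptional case D = -3. The other shape that survives the search, with coefficients
-- 2, ±2, 2, is discarded because 2 divides it.
h[-12]≡1 : h (- + 12) ≡ 1
h[-12]≡1 = h≡1 (form (+ 1) (+ 0) (+ 3)) ((+<+ (s≤s z≤n) , -<+) , refl , refl) λ f
  (f>0 , Δ≡ , f-prim) →
  let g , g-red , f∼g = reduce f f>0
  in ∼-trans f∼g (only g (reducedShape 12 g g-red (trans (disc-∼ f∼g) Δ≡)) (primitive-∼ f∼g f-prim))
  where
  Q = λ A B C → (A ≡ 1 × B ≡ 0 × C ≡ 3) ⊎ (A ≡ 2 × B ≡ 2 × C ≡ 2)
  Q? = λ A B C → ((A ℕ.≟ 1) ×-dec (B ℕ.≟ 0) ×-dec (C ℕ.≟ 3))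
           ⊎-dec ((A ℕ.≟ 2) ×-dec (B ℕ.≟ 2) ×-dec (C ℕ.≟ 2))
  imprimitive : ∀ b → ∣ b ∣ ≡ 2 → ¬ Primitive (form (+ 2) b (+ 2))
  imprimitive b eq prim = contradiction
    (primitive⇒ (form (+ 2) b (+ 2)) prim (+ 2) (ℕ.∣-refl , ℕ.∣-reflexive (sym eq) , ℕ.∣-refl))
    (from-no (2 ℕ.∣? 1))
  only : ∀ g → ReducedShape 12 g → Primitive g → g ∼ form (+ 1) (+ 0) (+ 3)
  only g@(form _ b _) s@(shape _ _ refl refl _ _ _ _) prim
    with small-shape Q Q? 12 ℕ.≤-refl (from-yes (smallShapes? Q Q? 12)) s
  ... | inj₁ (refl , b≡0 , refl) with refl ← ℤ.∣i∣≡0⇒i≡0 {b} b≡0 = ∼-refl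
  ... | inj₂ (refl , b≡2 , refl) = contradiction prim (imprimitive b b≡2)

-- ω Δ is 2/w, with w the number of automorphs of a form of discriminant Δ.
ω : ℤ → ℚ
ω Δ = if does (Δ ℤ.≟ - + 4) then + 1 ℚ./ 2 else
      if does (Δ ℤ.≟ - + 3) then + 1 ℚ./ 3 else 1ℚ

*-fromℕ-1 : ∀ q k → k ≡ 1 → q ≡ q ℚ.* fromℕ k
*-fromℕ-1 q k refl = sym (trans (cong (q ℚ.*_) fromℕ-1) (ℚ.*-identityʳ q))

-- At -4 and -3 the left side is a constant that ignores `h`, so the equation holds there only
-- because both class numbers are 1.
hω≡ω*h : ∀ Δ → hω Δ ≡ ω Δ ℚ.* fromℕ (h Δ)
hω≡ω*h Δ = helper (Δ ℤ.≟ - + 4) (Δ ℤ.≟ - + 3)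
  where
  helper : (d₄ : Dec (Δ ≡ - + 4)) (d₃ : Dec (Δ ≡ - + 3)) →
    (if does d₄ then + 1 ℚ./ 2 else if does d₃ then + 1 ℚ./ 3 else + h Δ ℚ./ 1)
    ≡ (if does d₄ then + 1 ℚ./ 2 else if does d₃ then + 1 ℚ./ 3 else 1ℚ) ℚ.* fromℕ (h Δ)
  helper (yes Δ≡-4) _          = *-fromℕ-1 (+ 1 ℚ./ 2) (h Δ) (trans (cong h Δ≡-4) h[-4]≡1)
  helper (no _)     (yes Δ≡-3) = *-fromℕ-1 (+ 1 ℚ./ 3) (h Δ) (trans (cong h Δ≡-3) h[-3]≡1)
  helper (no _)     (no _)     = trans (sym (fromℕ-def (h Δ))) (sym (ℚ.*-identityˡ (fromℕ (h Δ))))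

-- Class numbers of D and 4 D

odd-square : ∀ {b} → Oddℤ b → ∃ λ m → b * b ≡ 1ℤ + + 8 * m
odd-square (k , refl) with even⊎odd k
... | inj₁ (j , refl) = j * (1ℤ + + 2 * j) , identity j
  where
  identity : ∀ j → (1ℤ + + 2 * (+ 2 * j)) * (1ℤ + + 2 * (+ 2 * j)) ≡ 1ℤ + + 8 * (j * (1ℤ + + 2 * j))
  identity = solve-∀
... | inj₂ (j , refl) = (1ℤ + + 2 * j) * (1ℤ + j) , identity j
  where
  identity : ∀ j → (1ℤ + + 2 * (1ℤ + + 2 * j)) * (1ℤ + + 2 * (1ℤ + + 2 * j)) ≡
    1ℤ + + 8 * ((1ℤ + + 2 * j) * (1ℤ + j))
  identity = solve-∀

mod₈⇒ : ∀ x r → x ≡ r [mod + 8 ] → ∃ λ k → x ≡ r + + 8 * k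
mod₈⇒ x r 8∣ with Signed.∣ᵤ⇒∣ {+ 8} {x - r} 8∣
... | Signed.divides k eq = k , trans (identity x r)
  (cong (λ z → r + z) (trans eq (ℤ.*-comm k (+ 8))))
  where
  identity : ∀ x r → x ≡ r + (x - r)
  identity = solve-∀

1mod8⇒odd : ∀ {x} → x ≡ + 1 [mod + 8 ] → Oddℤ x
1mod8⇒odd {x} x≡1 with mod₈⇒ x (+ 1) x≡1
... | k , eq = + 4 * k , trans eq (identity k)
  where
  identity : ∀ k → + 1 + + 8 * k ≡ 1ℤ + + 2 * (+ 4 * k)
  identity = solve-∀

5mod8⇒odd : ∀ {x} → x ≡ + 5 [mod + 8 ] → Oddℤ x
5mod8⇒odd {x} x≡5 with mod₈⇒ x (+ 5) x≡5
... | k , eq = + 2 + + 4 * k , trans eq (identity k)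
  where
  identity : ∀ k → + 5 + + 8 * k ≡ 1ℤ + + 2 * (+ 2 + + 4 * k)
  identity = solve-∀

-- An odd `b` satisfies `b² ≡ 1` (mod 8), so the discriminant mod 8 decides the parity of `a c`:
-- even for `r = 1`, odd for `r = 5`.
outer-product : ∀ f r → Oddℤ (Form.b f) → disc f ≡ r [mod + 8 ] →
                ∃ λ m → + 4 * (Form.a f * Form.c f) ≡ 1ℤ - r + + 8 * m
outer-product f@(form a b c) r b-odd Δ≡r with odd-square b-odd | mod₈⇒ (disc f) r Δ≡r
... | m , b²≡ | k , Δ≡ = m - k , (begin
  + 4 * (a * c)                     ≡⟨ identity₁ (b * b) (+ 4 * (a * c)) ⟩
  b * b - (b * b - + 4 * (a * c))   ≡⟨ cong₂ _-_ b²≡ Δ≡ ⟩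
  1ℤ + + 8 * m - (r + + 8 * k)      ≡⟨ identity₂ m r k ⟩
  1ℤ - r + + 8 * (m - k)            ∎)
  where
  open ≡-Reasoning
  identity₁ : ∀ x y → y ≡ x - (x - y)
  identity₁ = solve-∀
  identity₂ : ∀ m r k → 1ℤ + + 8 * m - (r + + 8 * k) ≡ 1ℤ - r + + 8 * (m - k)
  identity₂ = solve-∀

1mod8⇒even-outer : ∀ f → disc f ≡ + 1 [mod + 8 ] → Evenℤ (Form.a f * Form.c f)
1mod8⇒even-outer f Δ≡1 =
  let m , eq = outer-product f (+ 1) (odd-disc⇒odd-b f (1mod8⇒odd {disc f} Δ≡1)) Δ≡1
  in m , ℤ.*-cancelˡ-≡ (+ 4) (Form.a f * Form.c f) (+ 2 * m) (trans eq (identity m))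
  where
  identity : ∀ m → 1ℤ - + 1 + + 8 * m ≡ + 4 * (+ 2 * m)
  identity = solve-∀

-- All three coefficients are odd, and this applies to every form of the discriminant: x² + xy + y²
-- has no zero mod 2 besides the origin.
5mod8⇒odd-a : ∀ f → disc f ≡ + 5 [mod + 8 ] → Oddℤ (Form.a f)
5mod8⇒odd-a f Δ≡5 =
  let m , eq = outer-product f (+ 5) (odd-disc⇒odd-b f (5mod8⇒odd {disc f} Δ≡5)) Δ≡5
  in odd-factorˡ (Form.a f) (Form.c f)
       (m - 1ℤ , ℤ.*-cancelˡ-≡ (+ 4) (Form.a f * Form.c f) (1ℤ + + 2 * (m - 1ℤ))
         (trans eq (identity m)))
  where
  identity : ∀ m → 1ℤ - + 5 + + 8 * m ≡ + 4 * (1ℤ + + 2 * (m - 1ℤ))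
  identity = solve-∀

-- The values at (1, 0), (0, 1) and (1, 1) are `a`, `c` and `a + b + c`. As `b` is odd they are not
-- all even; `invert`, after a translation if necessary, brings an odd one to the front.
odd-a-representative : ∀ f → Oddℤ (disc f) → ∃ λ g → f ∼ g × Oddℤ (Form.a g)
odd-a-representative f@(form a b c) Δ-odd with even⊎odd a | even⊎odd c
... | inj₂ a-odd  | _           = f , ∼-refl , a-odd
... | inj₁ a-even | inj₂ c-odd  = _ , invert a b c , c-odd
... | inj₁ a-even | inj₁ c-even =
  _ , ∼-trans (translate a b c 1ℤ) (invert a _ _) ,
  subst Oddℤ (identity a b c) (odd+even (odd-disc⇒odd-b f Δ-odd) (even+even a-even c-even))
  where
  identity : ∀ a b c → b + (a + c) ≡ a * (1ℤ * 1ℤ) + b * 1ℤ + c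
  identity = solve-∀

-- Multiply the equation by `A`, whose square is `1 + 4 (k² + k)`.
4∣odd* : ∀ {A C n} → Oddℤ A → A * C ≡ + 4 * n → ∃ λ m → C ≡ + 4 * m
4∣odd* {C = C} {n} (k , refl) AC≡ = (1ℤ + + 2 * k) * n - (k * k + k) * C ,
  trans (identity₁ k C) (trans (cong (λ z → (1ℤ + + 2 * k) * z - + 4 * ((k * k + k) * C)) AC≡)
    (identity₂ k n C))
  where
  identity₁ : ∀ k C → C ≡ (1ℤ + + 2 * k) * ((1ℤ + + 2 * k) * C) - + 4 * ((k * k + k) * C)
  identity₁ = solve-∀
  identity₂ : ∀ k n C → (1ℤ + + 2 * k) * (+ 4 * n) - + 4 * ((k * k + k) * C)
                      ≡ + 4 * ((1ℤ + + 2 * k) * n - (k * k + k) * C)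
  identity₂ = solve-∀

primitive⇒odd-outer : ∀ a b c → Primitive (form a (+ 2 * b) c) → Evenℤ a → Oddℤ c
primitive⇒odd-outer a b c prim a-even with even⊎odd c
... | inj₂ c-odd  = c-odd
... | inj₁ c-even = ⊥-elim (ℕ.1+n≰n {1} (ℕ.∣⇒≤ (primitive⇒ (form a (+ 2 * b) c) prim (+ 2)
    (even⇒2∣ a-even , even⇒2∣ (b , refl) , even⇒2∣ c-even))))

up-disc⁻¹ : ∀ {D} f → disc (up f) ≡ + 4 * D → disc f ≡ D
up-disc⁻¹ f eq = ℤ.*-cancelˡ-≡ (+ 4) _ _ (trans (sym (disc-up f)) eq)

-- Write g = (A, 2B, C), so that AC = B² - D. If B is odd, then 4 divides AC; primitivity makes A or
-- C odd, the other is a multiple of 4, and g is of the form `up f`, possibly after inversion. If B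
-- is even, then AC is odd, and the translation by 1 replaces B by the odd number B + A.
∼-up : ∀ {D} → D ≡ + 1 [mod + 4 ] → ∀ g → Primitive g → disc g ≡ + 4 * D →
       ∃ λ f → g ∼ up f
∼-up {D} D≡1 g@(form A M C) prim Δ≡ with mod⇒ D (+ 1) D≡1 | even⊎odd M
... | j , D≡ | inj₂ M-odd = ⊥-elim (even-odd-⊥
  (even+even (even*ˡ D (+ 2 , refl)) (even*ˡ (A * C) (+ 2 , refl)))
  (subst Oddℤ (trans (identity (M * M) (+ 4 * (A * C))) (cong (_+ + 4 * (A * C)) Δ≡))
    (odd*odd M-odd M-odd)))
  where
  identity : ∀ x y → x ≡ x - y + y
  identity = solve-∀
... | j , D≡ | inj₁ (B , refl) = parity B A C prim Δ≡
  where
  outer : ∀ A B C → disc (form A (+ 2 * B) C) ≡ + 4 * D → A * C ≡ B * B - D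
  outer A B C Δ≡ = trans (identity₁ A B C)
    (cong (λ D → B * B - D) (ℤ.*-cancelˡ-≡ (+ 4) _ D (trans (identity₂ A B C) Δ≡)))
    where
    identity₁ : ∀ A B C → A * C ≡ B * B - (B * B - A * C)
    identity₁ = solve-∀
    identity₂ : ∀ A B C → + 4 * (B * B - A * C) ≡ + 2 * B * (+ 2 * B) - + 4 * (A * C)
    identity₂ = solve-∀
  odd-B : ∀ B A C → Oddℤ B → Primitive (form A (+ 2 * B) C) → disc (form A (+ 2 * B) C) ≡ + 4 * D →
          ∃ λ f → form A (+ 2 * B) C ∼ up f
  odd-B B A C B-odd prim Δ≡ with odd-square B-odd
  ... | m , B²≡ = split (even⊎odd A)
    where
    AC≡ : A * C ≡ + 4 * (+ 2 * m - j)
    AC≡ = trans (outer A B C Δ≡) (trans (cong₂ _-_ B²≡ D≡) (identity m j))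
      where
      identity : ∀ m j → 1ℤ + + 8 * m - (+ 1 + j * + 4) ≡ + 4 * (+ 2 * m - j)
      identity = solve-∀
    split : Evenℤ A ⊎ Oddℤ A → ∃ λ f → form A (+ 2 * B) C ∼ up f
    split (inj₂ A-odd) with 4∣odd* A-odd AC≡
    ... | c , refl = form A B c , ∼-refl
    split (inj₁ A-even) with 4∣odd* (primitive⇒odd-outer A B C prim A-even)
      (trans (ℤ.*-comm C A) AC≡)
    ... | a , refl = form C (- B) a , subst (λ z → form (+ 4 * a) (+ 2 * B) C ∼ form C z (+ 4 * a))
                       (ℤ.neg-distribʳ-* (+ 2) B) (invert (+ 4 * a) (+ 2 * B) C)
  parity : ∀ B A C → Primitive (form A (+ 2 * B) C) → disc (form A (+ 2 * B) C) ≡ + 4 * D →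
           ∃ λ f → form A (+ 2 * B) C ∼ up f
  parity B A C prim Δ≡ with even⊎odd B
  ... | inj₂ B-odd  = odd-B B A C B-odd prim Δ≡
  ... | inj₁ B-even =
    let f , g′∼ = odd-B (B + A) A C′ (subst Oddℤ (ℤ.+-comm A B) (odd+even A-odd B-even))
                    (primitive-∼ g∼g′ prim) (trans (disc-∼ g∼g′) Δ≡)
    in f , ∼-trans g∼g′ g′∼
    where
    D-odd : Oddℤ D
    D-odd = + 2 * j , trans D≡ (identity j)
      where
      identity : ∀ j → + 1 + j * + 4 ≡ 1ℤ + + 2 * (+ 2 * j)
      identity = solve-∀
    A-odd : Oddℤ A
    A-odd = odd-factorˡ A C (subst Oddℤ (trans (identity (B * B) D) (sym (outer A B C Δ≡)))
      (odd+even (odd*odd (- 1ℤ , refl) D-odd) (even*ˡ B B-even)))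
      where
      identity : ∀ x y → (1ℤ + + 2 * - 1ℤ) * y + x ≡ x - y
      identity = solve-∀
    C′ : ℤ
    C′ = A * (1ℤ * 1ℤ) + + 2 * B * 1ℤ + C
    g∼g′ : form A (+ 2 * B) C ∼ form A (+ 2 * (B + A)) C′
    g∼g′ = subst (λ z → form A (+ 2 * B) C ∼ form A z C′) (identity A B)
      (translate A (+ 2 * B) C 1ℤ)
      where
      identity : ∀ A B → + 2 * B + 1ℤ * (+ 2 * A) ≡ + 2 * (B + A)
      identity = solve-∀

Class : ℤ → Form → Set
Class Δ f = PositiveDefinite f × disc f ≡ Δ × Primitive f

class-∼ : ∀ {Δ f g} → f ∼ g → Class Δ f → Class Δ g
class-∼ f∼g (f>0 , Δ≡ , prim) = posdef-∼ f∼g f>0 , trans (disc-∼ f∼g) Δ≡ , primitive-∼ f∼g prim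

class-up : ∀ {D f} → Oddℤ (Form.a f) → Class D f → Class (+ 4 * D) (up f)
class-up {f = f} a-odd (f>0 , Δ≡ , prim) =
  posdef-up f f>0 , trans (disc-up f) (cong (+ 4 *_) Δ≡) , primitive-up f prim a-odd

class-up⁻¹ : ∀ {D} f → Class (+ 4 * D) (up f) → Class D f
class-up⁻¹ f (u>0 , Δ≡ , prim) = posdef-up⁻¹ f u>0 , up-disc⁻¹ f Δ≡ , primitive-up⁻¹ f prim

odd-a⇐primitive-up : ∀ f → Primitive (up f) → Oddℤ (Form.a f)
odd-a⇐primitive-up (form a b c) prim with even⊎odd a
... | inj₂ a-odd  = a-odd
... | inj₁ a-even = ⊥-elim (even-odd-⊥ (even*ˡ c (+ 2 , refl))
                              (primitive⇒odd-outer a b (+ 4 * c) prim a-even))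

class-∼-up : ∀ {D} → D ≡ + 1 [mod + 4 ] → ∀ g → Class (+ 4 * D) g →
             ∃ λ f → Class D f × Oddℤ (Form.a f) × g ∼ up f
class-∼-up {D} D≡1 g g-class@(_ , Δ≡ , prim) = from-∼ (∼-up D≡1 g prim Δ≡)
  where
  from-∼ : (∃ λ f → g ∼ up f) → ∃ λ f → Class D f × Oddℤ (Form.a f) × g ∼ up f
  from-∼ (f , g∼) = f , class-up⁻¹ f (class-∼ g∼ g-class) ,
    odd-a⇐primitive-up f (primitive-∼ g∼ prim) , g∼

module _ {Δ : ℤ} where
  open Representatives (primitiveClasses Δ) using (sound; distinct; exhaustive)

  rep-class : ∀ {f} → f ∈ reps (primitiveClasses Δ) → Class Δ f
  rep-class = All.lookup sound

  reps-distinct : AllPairs (λ x y → ¬ (x ∼ y)) (reps (primitiveClasses Δ))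
  reps-distinct = distinct

  rep-of : ∀ {f} → Class Δ f → Any (f ∼_) (reps (primitiveClasses Δ))
  rep-of {f} = exhaustive f

8∣⇒4∣ : ∀ {D r} → D ≡ r [mod + 8 ] → D ≡ r [mod + 4 ]
8∣⇒4∣ = ℕ.∣-trans (ℕ.divides 2 refl)

5mod8⇒1mod4 : ∀ D → D ≡ + 5 [mod + 8 ] → D ≡ + 1 [mod + 4 ]
5mod8⇒1mod4 D D≡5 with mod₈⇒ D (+ 5) D≡5
... | k , eq = mod⇐ D (+ 1) (1ℤ + + 2 * k) (trans eq (identity k))
  where
  identity : ∀ k → + 5 + + 8 * k ≡ + 1 + (1ℤ + + 2 * k) * + 4
  identity = solve-∀

-- Discriminants D ≡ 1 (mod 8): one coset

module _ {D : ℤ} (D≡1 : D ≡ + 1 [mod + 8 ]) where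

  -- A chosen representative `x` may have an even leading coefficient, and then `up x` is not
  -- primitive; hence the detour through an equivalent `f`.
  DoubledClass : Form → Form → Set
  DoubledClass x y = ∃ λ f → x ∼ f × Oddℤ (Form.a f) × up f ∼ y

  -- Here `c` is even and `b` odd, so mod 2 the form is x (x + y), which is odd only at (1, 0). An
  -- odd value at the first column (p, r) of `γ` thus forces `r` to be even.
  even-r : ∀ f γ → disc f ≡ D → Oddℤ (Form.a f) → Oddℤ (Form.a (f ⊙ γ)) → Evenℤ (SL₂.r γ)
  even-r f@(form a b c) γ@(sl₂ p q r s _) refl a-odd a′-odd = by-parity (even⊎odd r) (even⊎odd p)
    where
    c-even : Evenℤ c
    c-even = odd-cancel a c a-odd (1mod8⇒even-outer f D≡1)
    by-parity : Evenℤ r ⊎ Oddℤ r → Evenℤ p ⊎ Oddℤ p → Evenℤ r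
    by-parity (inj₁ r-even) _             = r-even
    by-parity (inj₂ r-odd)  (inj₁ p-even) = ⊥-elim (even-odd-⊥
      (even+even (even+even (even*ʳ a (even*ˡ p p-even)) (even*ʳ b (even*ˡ r p-even)))
                 (even*ˡ (r * r) c-even)) a′-odd)
    by-parity (inj₂ r-odd)  (inj₂ p-odd)  = ⊥-elim (even-odd-⊥
      (even+even (odd+odd (odd*odd a-odd (odd*odd p-odd p-odd))
                          (odd*odd (odd-disc⇒odd-b f (1mod8⇒odd {disc f} D≡1))
                            (odd*odd p-odd r-odd)))
                 (even*ˡ (r * r) c-even)) a′-odd)

  doubled-matching : Matching DoubledClass (reps (primitiveClasses D))
    (reps (primitiveClasses (+ 4 * D)))
  doubled-matching = matching (All.tabulate total) (All.tabulate total′)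
    (AllPairs.map (λ x≁x′ y (f , x∼f , a-odd , f∼y) (f′ , x′∼f′ , a′-odd , f′∼y) →
      let γ , _ , eq = up-∼⁻¹ f f′ a-odd (∼-trans f∼y (∼-sym f′∼y))
      in x≁x′ (∼-trans x∼f (∼-trans (via γ eq) (∼-sym x′∼f′)))) reps-distinct)
    (distinct′ (All.tabulate rep-class) reps-distinct)
    where
    total : ∀ {x} → x ∈ reps (primitiveClasses D) →
      Any (DoubledClass x) (reps (primitiveClasses (+ 4 * D)))
    total {x} x∈ = from-odd-a (odd-a-representative x
      (subst Oddℤ (sym (proj₁ (proj₂ x-class))) (1mod8⇒odd {D} D≡1)))
      where
      x-class : Class D x
      x-class = rep-class {D} {x} x∈
      from-odd-a : (∃ λ f → x ∼ f × Oddℤ (Form.a f)) →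
        Any (DoubledClass x) (reps (primitiveClasses (+ 4 * D)))
      from-odd-a (f , x∼f , a-odd) = Any.map (λ f∼y → f , x∼f , a-odd , f∼y)
        (rep-of {+ 4 * D} {up f} (class-up {D} {f} a-odd (class-∼ {D} {x} {f} x∼f x-class)))
    total′ : ∀ {y} → y ∈ reps (primitiveClasses (+ 4 * D)) →
      Any (λ x → DoubledClass x y) (reps (primitiveClasses D))
    total′ {y} y∈ = from-up (class-∼-up (8∣⇒4∣ {D} {+ 1} D≡1) y (rep-class {+ 4 * D} {y} y∈))
      where
      from-up : (∃ λ f → Class D f × Oddℤ (Form.a f) × y ∼ up f) →
        Any (λ x → DoubledClass x y) (reps (primitiveClasses D))
      from-up (f , f-class , a-odd , y∼f) =
        Any.map (λ f∼x → f , ∼-sym f∼x , a-odd , ∼-sym y∼f) (rep-of {D} {f} f-class)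
    distinct′ : ∀ {ys} → All (Class (+ 4 * D)) ys → AllPairs (λ y y′ → ¬ (y ∼ y′)) ys →
                AllPairs (λ y y′ → ∀ x → DoubledClass x y → ¬ DoubledClass x y′) ys
    distinct′ [] [] = []
    distinct′ {y ∷ _} (y-class ∷ ys) (y≁ ∷ d) =
      All.map (λ y≁y′ x (f , x∼f , a-odd , f∼y) (f′ , x∼f′ , a′-odd , f′∼y′) →
      y≁y′ (∼-trans (∼-sym f∼y) (∼-trans
        (same f f′ (∼-trans (∼-sym x∼f) x∼f′)
          (proj₁ (proj₂ (class-up⁻¹ f (class-∼ (∼-sym f∼y) y-class)))) a-odd a′-odd) f′∼y′))) y≁
      ∷ distinct′ ys d
      where
      same : ∀ f f′ → f ∼ f′ → disc f ≡ D → Oddℤ (Form.a f) → Oddℤ (Form.a f′) → up f ∼ up f′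
      same f _ (via γ refl) Δ≡ a-odd a′-odd = up-∼ f γ (even-r f γ Δ≡ a-odd a′-odd)

  h-doubled : fromℕ (h (+ 4 * D)) ≡ fromℕ (h D)
  h-doubled = begin
    fromℕ (h (+ 4 * D))
      ≡⟨ ℚ.*-identityˡ (fromℕ (h (+ 4 * D))) ⟨
    1ℚ ℚ.* fromℕ (h (+ 4 * D))
      ≡⟨ sum-const 1ℚ (reps (primitiveClasses (+ 4 * D))) ⟨
    sum (map (λ _ → 1ℚ) (reps (primitiveClasses (+ 4 * D))))
      ≡⟨ sum-matching (λ _ → 1ℚ) (λ _ → 1ℚ) doubled-matching (λ _ _ _ → refl) ⟨
    sum (map (λ _ → 1ℚ) (reps (primitiveClasses D)))
      ≡⟨ sum-const 1ℚ (reps (primitiveClasses D)) ⟩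
    1ℚ ℚ.* fromℕ (h D)                                            ≡⟨ ℚ.*-identityˡ (fromℕ (h D)) ⟩
    fromℕ (h D)                                                   ∎
    where open ≡-Reasoning

-- Automorphs and the cosets of Γ₀(2)

automorph : ∀ f γ → let open SL₂ γ in
  Class (disc f) f → disc f ℤ.< - + 4 → f ⊙ γ ≡ f → q ≡ 0ℤ × r ≡ 0ℤ × p ≡ s
automorph f@(form a b c) γ@(sl₂ p q r s det) (f>0 , _ , prim) Δ<-4 eq = q≡0 , r≡0 , p≡s
  where
  Δ = disc f
  instance
    a≢0 : ℤ.NonZero a
    a≢0 = ℤ.≢-nonZero λ a≡0 → ℤ.<⇒≢ (proj₁ f>0) (sym a≡0)
  A = a * (p * p) + b * (p * r) + c * (r * r)
  B = + 2 * (a * (p * q)) + b * (p * s + q * r) + + 2 * (c * (r * s))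
  open ≡-Reasoning

  -- Let M be the matrix with rows (2a, b) and (b, 2c). Invariance is γᵀ M γ = M; in the form M γ⁻¹
  -- = γᵀ M it is linear in the entries of γ. The first row of this identity gives the present
  -- equation and `cr≡`.
  ar≡ : a * (s - p) ≡ b * r
  ar≡ = ℤ.*-cancelˡ-≡ (+ 2) _ _ (begin
    + 2 * (a * (s - p))
      ≡⟨ i₁ a b r s p ⟩
    (+ 2 * a * s - b * r) - (1ℤ * (+ 2 * a * p + b * r)) + + 2 * (b * r)
      ≡⟨ cong₂ (λ x y → x - y * (+ 2 * a * p + b * r) + + 2 * (b * r))
           (cong₂ (λ x y → + 2 * x * s - y * r) (sym (cong Form.a eq)) (sym (cong Form.b eq)))
             (sym det) ⟩
    (+ 2 * A * s - B * r) - ((p * s - q * r) * (+ 2 * a * p + b * r)) + + 2 * (b * r)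
      ≡⟨ i₂ a b c p q r s ⟩
    + 2 * (b * r) ∎)
    where
    i₁ : ∀ a b r s p → + 2 * (a * (s - p)) ≡ (+ 2 * a * s - b * r) - (1ℤ * (+ 2 * a * p + b * r))
      + + 2 * (b * r)
    i₁ = solve-∀
    i₂ : ∀ a b c p q r s →
      (+ 2 * (a * (p * p) + b * (p * r) + c * (r * r)) * s
       - (+ 2 * (a * (p * q)) + b * (p * s + q * r) + + 2 * (c * (r * s))) * r)
      - ((p * s - q * r) * (+ 2 * a * p + b * r)) + + 2 * (b * r) ≡ + 2 * (b * r)
    i₂ = solve-∀

  cr≡ : c * r ≡ - (a * q)
  cr≡ = ℤ.*-cancelˡ-≡ (+ 2) _ _ (begin
    + 2 * (c * r)
      ≡⟨ i₁ a b c p q r ⟩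
    1ℤ * (b * p + + 2 * c * r) - (- + 2 * a * q + b * p) + - + 2 * (a * q)
      ≡⟨ cong₂ (λ x y → x * (b * p + + 2 * c * r) - y + - + 2 * (a * q)) (sym det)
           (cong₂ (λ x y → - + 2 * x * q + y * p) (sym (cong Form.a eq)) (sym (cong Form.b eq))) ⟩
    (p * s - q * r) * (b * p + + 2 * c * r) - (- + 2 * A * q + B * p) + - + 2 * (a * q)
      ≡⟨ i₂ a b c p q r s ⟩
    + 2 * (- (a * q)) ∎)
    where
    i₁ : ∀ a b c p q r → + 2 * (c * r) ≡ 1ℤ * (b * p + + 2 * c * r) - (- + 2 * a * q + b * p)
      + - + 2 * (a * q)
    i₁ = solve-∀
    i₂ : ∀ a b c p q r s →
      (p * s - q * r) * (b * p + + 2 * c * r)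
      - (- + 2 * (a * (p * p) + b * (p * r) + c * (r * r)) * q
         + (+ 2 * (a * (p * q)) + b * (p * s + q * r) + + 2 * (c * (r * s))) * p)
      + - + 2 * (a * q) ≡ + 2 * (- (a * q))
    i₂ = solve-∀

  -- The coefficients of `r ∗ f` are `r a`, `r b = a (s - p)` and `r c = - a q`, all multiples of
  -- `a`; primitivity of `f` leaves `r` itself.
  a∣r : a ∣ r
  a∣r = ∣-primitive-multiple a r f prim
    ( multiple r refl
    , multiple (s - p) (trans (ℤ.*-comm (s - p) a) (trans ar≡ (ℤ.*-comm b r)))
    , multiple (- q) (trans (i q a) (trans (sym cr≡) (ℤ.*-comm c r))) )
    where
    multiple : ∀ k {x} → k * a ≡ x → a ∣ x
    multiple k ka≡x = Signed.∣⇒∣ᵤ (Signed.divides k (sym ka≡x))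
    i : ∀ q a → - q * a ≡ - (a * q)
    i = solve-∀

  u : ℤ
  u = Signed._∣_.quotient (Signed.∣ᵤ⇒∣ {a} {r} a∣r)
  r≡ua : r ≡ u * a
  r≡ua = Signed._∣_.equality (Signed.∣ᵤ⇒∣ {a} {r} a∣r)

  s-p≡ : s - p ≡ b * u
  s-p≡ = ℤ.*-cancelˡ-≡ a _ _ (trans ar≡ (trans (cong (b *_) r≡ua) (i a b u)))
    where
    i : ∀ a b u → b * (u * a) ≡ a * (b * u)
    i = solve-∀

  q≡ : q ≡ - (c * u)
  q≡ = ℤ.*-cancelˡ-≡ a _ _ (trans (i₁ a q)
    (trans (cong -_ (trans (sym cr≡) (cong (c *_) r≡ua))) (i₂ a c u)))
    where
    i₁ : ∀ a q → a * q ≡ - (- (a * q))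
    i₁ = solve-∀
    i₂ : ∀ a c u → - (c * (u * a)) ≡ a * (- (c * u))
    i₂ = solve-∀

  -- With t = p + s this is the Pell equation t² - Δ u² = 4.
  pell : - Δ * (u * u) + (s + p) * (s + p) ≡ + 4
  pell = begin
    - Δ * (u * u) + (s + p) * (s + p)
      ≡⟨ i₁ a b c p q r s u ⟩
    - (b * u * (b * u)) + + 4 * (c * u * (u * a)) + (s - p) * (s - p) + + 4 * (p * s - q * r)
      + + 4 * (q * r)
      ≡⟨ cong₂ (λ x y → - (b * u * (b * u)) + + 4 * (c * u * (u * a)) + x * x + + 4
        * (p * s - q * r) + + 4 * y)
           s-p≡ (cong₂ _*_ q≡ r≡ua) ⟩
    - (b * u * (b * u)) + + 4 * (c * u * (u * a)) + b * u * (b * u) + + 4 * (p * s - q * r) + + 4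
      * (- (c * u) * (u * a))
      ≡⟨ cong (λ d → - (b * u * (b * u)) + + 4 * (c * u * (u * a)) + b * u * (b * u) + + 4 * d
        + + 4 * (- (c * u) * (u * a))) det ⟩
    - (b * u * (b * u)) + + 4 * (c * u * (u * a)) + b * u * (b * u) + + 4 * 1ℤ + + 4
      * (- (c * u) * (u * a))
      ≡⟨ i₂ (b * u * (b * u)) (c * u) (u * a) ⟩
    + 4 ∎
    where
    i₁ : ∀ a b c p q r s u → - (b * b - + 4 * (a * c)) * (u * u) + (s + p) * (s + p)
       ≡ - (b * u * (b * u)) + + 4 * (c * u * (u * a)) + (s - p) * (s - p) + + 4 * (p * s - q * r)
         + + 4 * (q * r)
    i₁ = solve-∀
    i₂ : ∀ x y z → - x + + 4 * (y * z) + x + + 4 * 1ℤ + + 4 * (- y * z) ≡ + 4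
    i₂ = solve-∀

  u≡0 : u ≡ 0ℤ
  u≡0 = small-square u (- Δ) ((s + p) * (s + p)) (ℤ.neg-mono-< Δ<-4) (0≤square (s + p)) pell
    where
    -- With `N > 4`, a nonzero `u` would make `N u²` alone exceed 4. This is where discriminants
    -- below -4 are separated from -3 and -4.
    small-square : ∀ u N X → + 4 ℤ.< N → 0ℤ ℤ.≤ X → N * (u * u) + X ≡ + 4 → u ≡ 0ℤ
    small-square u N X 4<N 0≤X eq = by-size (∣ u ∣) refl
      where
      by-size : ∀ m → ∣ u ∣ ≡ m → u ≡ 0ℤ
      by-size zero    ∣u∣≡0 = ℤ.∣i∣≡0⇒i≡0 ∣u∣≡0
      by-size (suc k) ∣u∣≡  = contradiction
        (ℤ.<-≤-trans 4<N (subst₂ ℤ._≤_ (trans (ℤ.+-identityʳ _) (ℤ.*-identityʳ N)) eq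
          (ℤ.+-mono-≤ (ℤ.*-monoˡ-≤-nonNeg N {{ℤ.nonNegative (ℤ.≤-trans (+≤+ z≤n) (ℤ.<⇒≤ 4<N))}}
            1≤u²) 0≤X))) (ℤ.<-irrefl refl)
        where
        1≤u² : 1ℤ ℤ.≤ u * u
        1≤u² = subst (1ℤ ℤ.≤_) (sym (trans (square u) (cong (λ n → + (n ℕ.* n)) ∣u∣≡)))
          (+≤+ (s≤s z≤n))

  r≡0 : r ≡ 0ℤ
  r≡0 = trans r≡ua (trans (cong (_* a) u≡0) (ℤ.*-zeroˡ a))
  q≡0 : q ≡ 0ℤ
  q≡0 = trans q≡ (cong -_ (trans (cong (c *_) u≡0) (ℤ.*-zeroʳ c)))
  p≡s : p ≡ s
  p≡s = sym (ℤ.i-j≡0⇒i≡j s p (trans s-p≡ (trans (cong (b *_) u≡0) (ℤ.*-zeroʳ b))))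

-- γ and δ lie in the same left coset of Γ₀(2) iff cross γ δ is even.
cross : SL₂ → SL₂ → ℤ
cross γ δ = SL₂.r (inverse γ ⊡ δ)

-- `γ δ⁻¹` is an automorph of `f`, hence scalar, so the first columns of `γ` and `δ` are
-- proportional. Their determinant is `cross γ δ`.
cross-stabiliser : ∀ f γ δ → Class (disc f) f → disc f ℤ.< - + 4 → f ⊙ γ ≡ f ⊙ δ → cross γ δ ≡ 0ℤ
cross-stabiliser f γ@(sl₂ p q r s det) δ@(sl₂ p′ q′ r′ s′ det′) f-class Δ<-4 eq
  = vanishing (automorph f (γ ⊡ inverse δ) f-class Δ<-4
         (trans (sym (⊙-⊡ f γ (inverse δ))) (trans (cong (_⊙ inverse δ) eq) (⊙-inverse f δ))))
  where
  open ≡-Reasoning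
  P = p * s′ + q * (- r′)
  Q = p * (- q′) + q * p′
  R = r * s′ + s * (- r′)
  S = r * (- q′) + s * p′
  identity₁ : ∀ p q r s p′ q′ r′ s′ → (p′ * s′ - q′ * r′) * (- r * p′ + p * r′)
    ≡ ((p * s′ + q * (- r′)) * p′ + (p * (- q′) + q * p′) * r′) * r′
      - ((r * s′ + s * (- r′)) * p′ + (r * (- q′) + s * p′) * r′) * p′
  identity₁ = solve-∀
  identity₂ : ∀ S p′ r′ → (S * p′ + 0ℤ * r′) * r′ - (0ℤ * p′ + S * r′) * p′ ≡ 0ℤ
  identity₂ = solve-∀
  vanishing : Q ≡ 0ℤ × R ≡ 0ℤ × P ≡ S → - r * p′ + p * r′ ≡ 0ℤ
  vanishing (α-q , α-r , α-p≡s) = begin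
    - r * p′ + p * r′
      ≡⟨ trans (sym (ℤ.*-identityˡ _)) (cong (_* (- r * p′ + p * r′)) (sym det′)) ⟩
    (p′ * s′ - q′ * r′) * (- r * p′ + p * r′)
      ≡⟨ identity₁ p q r s p′ q′ r′ s′ ⟩
    (P * p′ + Q * r′) * r′ - (R * p′ + S * r′) * p′
      ≡⟨ cong₂ (λ Q R → (P * p′ + Q * r′) * r′ - (R * p′ + S * r′) * p′) α-q α-r ⟩
    (P * p′ + 0ℤ * r′) * r′ - (0ℤ * p′ + S * r′) * p′
      ≡⟨ cong (λ P → (P * p′ + 0ℤ * r′) * r′ - (0ℤ * p′ + S * r′) * p′) α-p≡s ⟩
    (S * p′ + 0ℤ * r′) * r′ - (0ℤ * p′ + S * r′) * p′
      ≡⟨ identity₂ S p′ r′ ⟩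
    0ℤ ∎

-- The first columns are (1, 0), (0, 1) and (1, 1), the three nonzero vectors mod 2; right
-- multiplication by Γ₀(2) preserves the first column mod 2.
cosets : List SL₂
cosets = identityₛₗ ∷ inversion ∷ sl₂ 1ℤ 0ℤ 1ℤ 1ℤ refl ∷ []

cosets-distinct : AllPairs (λ γ δ → Oddℤ (cross γ δ)) cosets
cosets-distinct = ((0ℤ , refl) ∷ (0ℤ , refl) ∷ []) ∷ ((-1ℤ , refl) ∷ []) ∷ [] ∷ []

cosets-cover : ∀ γ → Any (λ γᵢ → Evenℤ (cross γᵢ γ)) cosets
cosets-cover (sl₂ p q r s _) with even⊎odd r | even⊎odd p
... | inj₁ r-even | _           = here (even+even (even*ˡ p (0ℤ , refl)) (even*ʳ 1ℤ r-even))
... | inj₂ r-odd  | inj₁ p-even = there (here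
  (even+even (even*ʳ -1ℤ p-even) (even*ˡ r (0ℤ , refl))))
... | inj₂ r-odd  | inj₂ p-odd  = there (there (here
  (odd+odd (odd*odd { -1ℤ} (-1ℤ , refl) p-odd) (odd*odd {1ℤ} (0ℤ , refl) r-odd))))

-- As the lower left entry of `δ` is even, the first column of `γ ⊡ δ` is `p′` times that of `γ` mod
-- 2. The determinant of `δ` makes `p′` odd, so the factor can be cancelled.
cross-⊡ : ∀ γ δ η → Evenℤ (SL₂.r δ) → cross (γ ⊡ δ) η ≡ 0ℤ → Evenℤ (cross γ η)
cross-⊡ (sl₂ p q r s det) (sl₂ p′ q′ _ s′ det′) (sl₂ p″ q″ r″ s″ det″) (k , refl) eq with even⊎odd
  (- r * p″ + p * r″)
... | inj₁ even = even
... | inj₂ odd  = ⊥-elim (even-odd-⊥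
  (k * (s * p″ - q * r″) , trans (identity₁ p q r s p′ k p″ r″)
    (trans (cong (_+ + 2 * (k * (s * p″ - q * r″))) eq) (ℤ.+-identityˡ _)))
  (odd*odd odd p′-odd))
  where
  identity₁ : ∀ p q r s p′ k p″ r″ → (- r * p″ + p * r″) * p′
    ≡ - (r * p′ + s * (+ 2 * k)) * p″ + (p * p′ + q * (+ 2 * k)) * r″ + + 2
      * (k * (s * p″ - q * r″))
  identity₁ = solve-∀
  identity₂ : ∀ x y → x ≡ x - y + y
  identity₂ = solve-∀
  p′-odd : Oddℤ p′
  p′-odd = odd-factorˡ p′ s′ (subst Oddℤ
    (sym (trans (identity₂ (p′ * s′) (q′ * (+ 2 * k))) (cong (_+ q′ * (+ 2 * k)) det′)))
    (odd+even {1ℤ} (0ℤ , refl) (even*ʳ q′ (k , refl))))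

-- Discriminants D ≡ 5 (mod 8): three cosets

module _ {D : ℤ} (D≡5 : D ≡ + 5 [mod + 8 ]) (D<-4 : D ℤ.< - + 4) where

  TripledClass : Form × SL₂ → Form → Set
  TripledClass (x , γ) y = up (x ⊙ γ) ∼ y

  odd-a : ∀ f → disc f ≡ D → Oddℤ (Form.a f)
  odd-a f Δ≡ = 5mod8⇒odd-a f (subst (_≡ + 5 [mod + 8 ]) (sym Δ≡) D≡5)

  tripled-matching : Matching TripledClass (pairs (λ _ → cosets) (reps (primitiveClasses D)))
                                           (reps (primitiveClasses (+ 4 * D)))
  tripled-matching = matching (All.tabulate totalˡ) (All.tabulate totalʳ) uniqueˡ uniqueʳ
    where
    class-⊙ : ∀ x γ → Class D x → Class D (x ⊙ γ)
    class-⊙ x γ = class-∼ {D} {x} {x ⊙ γ} (via γ refl)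

    total : ∀ p → proj₁ p ∈ reps (primitiveClasses D) →
      Any (TripledClass p) (reps (primitiveClasses (+ 4 * D)))
    total (x , γ) x∈ = rep-of {+ 4 * D} {up (x ⊙ γ)}
      (class-up {D} {x ⊙ γ} (odd-a (x ⊙ γ) (proj₁ (proj₂ xγ-class))) xγ-class)
      where
      xγ-class : Class D (x ⊙ γ)
      xγ-class = class-⊙ x γ (rep-class {D} {x} x∈)

    totalˡ : ∀ {p} → p ∈ pairs (λ _ → cosets) (reps (primitiveClasses D)) →
             Any (TripledClass p) (reps (primitiveClasses (+ 4 * D)))
    totalˡ {p} p∈ = total p (proj₁ (∈-pairs⁻ (λ _ → cosets) (reps (primitiveClasses D)) p∈))

    coset-of : ∀ x γ → Any (λ γᵢ → up (x ⊙ γᵢ) ∼ up (x ⊙ γ)) cosets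
    coset-of x γ = Any.map
      (λ {γᵢ} even → subst (λ g → up (x ⊙ γᵢ) ∼ up g) (same γᵢ)
        (up-∼ (x ⊙ γᵢ) (inverse γᵢ ⊡ γ) even))
      (cosets-cover γ)
      where
      same : ∀ γᵢ → (x ⊙ γᵢ) ⊙ (inverse γᵢ ⊡ γ) ≡ x ⊙ γ
      same γᵢ = trans (sym (⊙-⊡ (x ⊙ γᵢ) (inverse γᵢ) γ)) (cong (_⊙ γ) (⊙-inverse x γᵢ))

    above : ∀ y f x → x ∈ reps (primitiveClasses D) → x ∼ f → y ∼ up f →
            Any (λ p → TripledClass p y) (pairs (λ _ → cosets) (reps (primitiveClasses D)))
    above y f x x∈ (via γ f≡xγ) y∼f = choose (find (coset-of x γ))
      where
      choose : (∃ λ γᵢ → γᵢ ∈ cosets × up (x ⊙ γᵢ) ∼ up (x ⊙ γ)) →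
               Any (λ p → TripledClass p y) (pairs (λ _ → cosets) (reps (primitiveClasses D)))
      choose (γᵢ , γᵢ∈ , u∼) = lose (∈-pairs⁺ (λ _ → cosets) x∈ γᵢ∈)
        (∼-trans u∼ (subst (λ g → up g ∼ y) f≡xγ (∼-sym y∼f)))

    totalʳ : ∀ {y} → y ∈ reps (primitiveClasses (+ 4 * D)) →
             Any (λ p → TripledClass p y) (pairs (λ _ → cosets) (reps (primitiveClasses D)))
    totalʳ {y} y∈ = from-up (class-∼-up (5mod8⇒1mod4 D D≡5) y (rep-class {+ 4 * D} {y} y∈))
      where
      from-up : (∃ λ f → Class D f × Oddℤ (Form.a f) × y ∼ up f) →
                Any (λ p → TripledClass p y) (pairs (λ _ → cosets) (reps (primitiveClasses D)))
      from-up (f , f-class , _ , y∼f) = from-rep (find (rep-of {D} {f} f-class))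
        where
        from-rep : (∃ λ x → x ∈ reps (primitiveClasses D) × f ∼ x) →
                   Any (λ p → TripledClass p y) (pairs (λ _ → cosets) (reps (primitiveClasses D)))
        from-rep (x , x∈ , f∼x) = above y f x x∈ (∼-sym f∼x) y∼f

    below : ∀ x γ x′ δ y → Class D x → TripledClass (x , γ) y → TripledClass (x′ , δ) y →
            ∃ λ η → Evenℤ (SL₂.r η) × x′ ⊙ δ ≡ x ⊙ γ ⊙ η
    below x γ x′ δ y x-class u∼y u′∼y = up-∼⁻¹ (x ⊙ γ) (x′ ⊙ δ)
      (odd-a (x ⊙ γ) (proj₁ (proj₂ (class-⊙ x γ x-class)))) (∼-trans u∼y (∼-sym u′∼y))

    Disjoint : Form × SL₂ → Form × SL₂ → Set
    Disjoint p p′ = ∀ y → TripledClass p y → ¬ TripledClass p′ y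

    across : ∀ {xs} → All (Class D) xs → AllPairs (λ x x′ → ¬ (x ∼ x′)) xs →
      AllPairs (λ x x′ → ∀ {γ δ} → γ ∈ cosets → δ ∈ cosets →
                         Disjoint (x , γ) (x′ , δ)) xs
    across [] [] = []
    across {x ∷ _} (x-class ∷ cs) (x≁ ∷ d) =
      All.map (λ {x′} x≁x′ {γ} {δ} _ _ y u u′ →
        x≁x′ (related x′ γ δ (below x γ x′ δ y x-class u u′))) x≁ ∷ across cs d
      where
      related : ∀ x′ γ δ → (∃ λ η → Evenℤ (SL₂.r η) × x′ ⊙ δ ≡ x ⊙ γ ⊙ η) → x ∼ x′
      related x′ γ δ (η , _ , eq) =
        ∼-trans {x} {x ⊙ γ ⊙ η} (∼-trans (via γ refl) (via η refl)) (∼-sym (via δ (sym eq)))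

    -- If `γ` and `δ` led to the same class above `x`, some `η` in Γ₀(2) would make `γ ⊡ η` and `δ`
    -- carry `x` to the same form. Automorphs being scalar, `γ` and `δ` would then lie in one coset.
    within : ∀ x γ δ → Class D x → Oddℤ (cross γ δ) → Disjoint (x , γ) (x , δ)
    within x γ δ x-class@(x>0 , Δ≡ , prim) odd y u u′ = excluded (below x γ x δ y x-class u u′)
      where
      excluded : ¬ ∃ λ η → Evenℤ (SL₂.r η) × x ⊙ δ ≡ x ⊙ γ ⊙ η
      excluded (η , η-even , eq) = even-odd-⊥
        (cross-⊡ γ η δ η-even (cross-stabiliser x (γ ⊡ η) δ (x>0 , refl , prim)
          (subst (ℤ._< - + 4) (sym Δ≡) D<-4) (sym (trans eq (⊙-⊡ x γ η))))) odd

    withins : ∀ x → Class D x → AllPairs (λ γ δ → Disjoint (x , γ) (x , δ)) cosets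
    withins x x-class = AllPairs.map {R = λ γ δ → Oddℤ (cross γ δ)}
      {S = λ γ δ → Disjoint (x , γ) (x , δ)}
      (λ {γ} {δ} → within x γ δ x-class) cosets-distinct

    uniqueˡ : AllPairs Disjoint (pairs (λ _ → cosets) (reps (primitiveClasses D)))
    uniqueˡ = AllPairs-pairs⁺ (λ _ → cosets) {R = Disjoint}
      (across (All.tabulate λ {x} → rep-class {D} {x}) (reps-distinct {D}))
      (All.tabulate λ {x} x∈ → withins x (rep-class {D} {x} x∈))

    uniqueʳ : AllPairs (λ y y′ → ∀ p → TripledClass p y → ¬ TripledClass p y′)
      (reps (primitiveClasses (+ 4 * D)))
    uniqueʳ = AllPairs.map (λ y≁y′ _ u∼y u∼y′ → y≁y′ (∼-trans (∼-sym u∼y) u∼y′))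
      (reps-distinct {+ 4 * D})

  h-tripled : fromℕ (h (+ 4 * D)) ≡ (+ 3 ℚ./ 1) ℚ.* fromℕ (h D)
  h-tripled = begin
    fromℕ (h (+ 4 * D))
      ≡⟨ ℚ.*-identityˡ (fromℕ (h (+ 4 * D))) ⟨
    1ℚ ℚ.* fromℕ (h (+ 4 * D))
      ≡⟨ sum-const 1ℚ (reps (primitiveClasses (+ 4 * D))) ⟨
    sum (map (λ _ → 1ℚ) (reps (primitiveClasses (+ 4 * D))))
      ≡⟨ sum-matching (λ _ → 1ℚ) (λ _ → 1ℚ) tripled-matching (λ _ _ _ → refl) ⟨
    sum (map (λ _ → 1ℚ) (pairs (λ _ → cosets) (reps (primitiveClasses D))))
      ≡⟨ sum-concatMap (λ _ → 1ℚ) (λ x → map (x ,_) cosets) (reps (primitiveClasses D)) ⟩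
    sum (map (λ _ → + 3 ℚ./ 1) (reps (primitiveClasses D)))
      ≡⟨ sum-const (+ 3 ℚ./ 1) (reps (primitiveClasses D)) ⟩
    (+ 3 ℚ./ 1) ℚ.* fromℕ (h D)                                   ∎
    where open ≡-Reasoning

-- Comparison of hω(4D) with hω(D)

ω≡1 : ∀ Δ → Δ ≢ - + 4 → Δ ≢ - + 3 → ω Δ ≡ 1ℚ
ω≡1 Δ Δ≢-4 Δ≢-3 = helper (Δ ℤ.≟ - + 4) (Δ ℤ.≟ - + 3)
  where
  helper : (d₄ : Dec (Δ ≡ - + 4)) (d₃ : Dec (Δ ≡ - + 3)) →
    (if does d₄ then + 1 ℚ./ 2 else if does d₃ then + 1 ℚ./ 3 else 1ℚ) ≡ 1ℚ
  helper (yes Δ≡-4) _          = contradiction Δ≡-4 Δ≢-4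
  helper (no _)     (yes Δ≡-3) = contradiction Δ≡-3 Δ≢-3
  helper (no _)     (no _)     = refl

hω≡h : ∀ Δ → Δ ≢ - + 4 → Δ ≢ - + 3 → hω Δ ≡ fromℕ (h Δ)
hω≡h Δ Δ≢-4 Δ≢-3 = trans (hω≡ω*h Δ)
  (trans (cong (ℚ._* fromℕ (h Δ)) (ω≡1 Δ Δ≢-4 Δ≢-3)) (ℚ.*-identityˡ (fromℕ (h Δ))))

4*≢-3 : ∀ D → + 4 * D ≢ - + 3
4*≢-3 D eq = even-odd-⊥ (even*ˡ D (+ 2 , refl)) (subst Oddℤ (sym eq) (- + 2 , refl))

4*≡-4⇒ : ∀ D → + 4 * D ≡ - + 4 → D ≡ -1ℤ
4*≡-4⇒ D eq = ℤ.*-cancelˡ-≡ (+ 4) D -1ℤ eq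

hω-doubled : ∀ D → D ≡ + 1 [mod + 8 ] → hω (+ 4 * D) ≡ hω D
hω-doubled D D≡1 = begin
  hω (+ 4 * D)
    -- The numbers tested for divisibility by 8, here and below, are the distances from 1 of the
    -- values -1, -4 and -3 that `D` has to avoid.
    ≡⟨ hω≡h (+ 4 * D) (λ eq → excluded (- + 1) (from-no (8 ℕ.∣? 2)) (4*≡-4⇒ D eq)) (4*≢-3 D) ⟩
  fromℕ (h (+ 4 * D))    ≡⟨ h-doubled D≡1 ⟩
  fromℕ (h D)
    ≡⟨ hω≡h D (excluded (- + 4) (from-no (8 ℕ.∣? 5))) (excluded (- + 3) (from-no (8 ℕ.∣? 4))) ⟨
  hω D                   ∎
  where
  open ≡-Reasoning
  excluded : ∀ z → ¬ (z ≡ + 1 [mod + 8 ]) → D ≢ z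
  excluded z z≢1 refl = z≢1 D≡1

hω[-3]≡⅓ : hω (- + 3) ≡ + 1 ℚ./ 3
hω[-3]≡⅓ = refl

-- The automorphs of x² + xy + y² are not all scalar, so three cosets need not give three classes.
-- They give a single one, and the weight makes up for it: 1 = 3 · 1/3.
hω-tripled-[-3] : ∀ D → D ≡ - + 3 → hω (+ 4 * D) ≡ (+ 3 ℚ./ 1) ℚ.* hω D
hω-tripled-[-3] D refl = begin
  hω (- + 12)                      ≡⟨ hω≡h (- + 12) (λ ()) (λ ()) ⟩
  fromℕ (h (- + 12))               ≡⟨ cong fromℕ h[-12]≡1 ⟩
  fromℕ 1                          ≡⟨ fromℕ-1 ⟩
  1ℚ                               ≡⟨⟩
  (+ 3 ℚ./ 1) ℚ.* (+ 1 ℚ./ 3)      ≡⟨ cong ((+ 3 ℚ./ 1) ℚ.*_) hω[-3]≡⅓ ⟨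
  (+ 3 ℚ./ 1) ℚ.* hω (- + 3)       ∎
  where open ≡-Reasoning

hω-tripled : ∀ D → D ℤ.< 0ℤ → D ≡ + 5 [mod + 8 ] → hω (+ 4 * D) ≡ (+ 3 ℚ./ 1) ℚ.* hω D
hω-tripled D D<0 D≡5 = by-cases (D ℤ.≟ - + 3)
  where
  open ≡-Reasoning
  excluded : ∀ z → ¬ (z ≡ + 5 [mod + 8 ]) → D ≢ z
  excluded z z≢5 refl = z≢5 D≡5
  D<-4 : ∀ D → D ℤ.< 0ℤ → D ≢ - + 3 → (∀ z → ¬ (z ≡ + 5 [mod + 8 ]) → D ≢ z) → D ℤ.< - + 4
  D<-4 -[1+ 0 ] _ _ ≢ = contradiction refl (≢ (- + 1) (from-no (8 ℕ.∣? 6)))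
  D<-4 -[1+ 1 ] _ _ ≢ = contradiction refl (≢ (- + 2) (from-no (8 ℕ.∣? 7)))
  D<-4 -[1+ 2 ] _ D≢-3 _ = contradiction refl D≢-3
  D<-4 -[1+ 3 ] _ _ ≢ = contradiction refl (≢ (- + 4) (from-no (8 ℕ.∣? 9)))
  D<-4 -[1+ suc (suc (suc (suc n))) ] _ _ _ = ℤ.-<- (s≤s (s≤s (s≤s (s≤s z≤n))))
  D<-4 (+ _) (+<+ ()) _ _
  by-cases : Dec (D ≡ - + 3) → hω (+ 4 * D) ≡ (+ 3 ℚ./ 1) ℚ.* hω D
  by-cases (yes D≡-3) = hω-tripled-[-3] D D≡-3
  by-cases (no D≢-3) = begin
    hω (+ 4 * D)
      ≡⟨ hω≡h (+ 4 * D) (λ eq → excluded (- + 1) (from-no (8 ℕ.∣? 6)) (4*≡-4⇒ D eq)) (4*≢-3 D) ⟩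
    fromℕ (h (+ 4 * D))           ≡⟨ h-tripled D≡5 (D<-4 D D<0 D≢-3 excluded) ⟩
    (+ 3 ℚ./ 1) ℚ.* fromℕ (h D)
      ≡⟨ cong ((+ 3 ℚ./ 1) ℚ.*_) (hω≡h D (excluded (- + 4) (from-no (8 ℕ.∣? 9))) D≢-3) ⟨
    (+ 3 ℚ./ 1) ℚ.* hω D          ∎

-- Divisors of the conductor

Residue₀₁ : ℤ → Set
Residue₀₁ x = x ≡ + 0 [mod + 4 ] ⊎ x ≡ + 1 [mod + 4 ]

coprime-square-divisor : ∀ {m n o} .{{_ : ℕ.NonZero m}} → ℕ.Coprime m n →
  m ℕ.* m ℕ.∣ n ℕ.* n ℕ.* o → m ℕ.* m ℕ.∣ o
coprime-square-divisor {m} {n} {o} m⊥n m²∣ = squared (once (ℕ.∣-trans (ℕ.m∣m*n m) m²∣))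
  where
  once : ∀ {x} → m ℕ.∣ n ℕ.* n ℕ.* x → m ℕ.∣ x
  once {x} m∣ = ℕ.coprime-divisor m⊥n (ℕ.coprime-divisor m⊥n (subst (m ℕ.∣_) (ℕ.*-assoc n n x) m∣))
  squared : m ℕ.∣ o → m ℕ.* m ℕ.∣ o
  squared (ℕ.divides q refl) = ℕ.*-monoˡ-∣ m
    (once (ℕ.*-cancelˡ-∣ m (subst (m ℕ.* m ℕ.∣_) (identity n q m) m²∣)))
    where
    identity : ∀ n q m → n ℕ.* n ℕ.* (q ℕ.* m) ≡ m ℕ.* (n ℕ.* n ℕ.* q)
    identity = solveℕ-∀

coprime-2 : ∀ {t} → Oddℤ (+ t) → ℕ.Coprime t 2
coprime-2 {t} t-odd {d} (d∣t , d∣2) with ℕ.∣⇒≤ d∣2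
coprime-2 t-odd {0} (d∣t , d∣2) | _ = contradiction (ℕ.0∣⇒≡0 d∣2) λ ()
coprime-2 t-odd {1} _           | _ = refl
coprime-2 {t} t-odd {2} (d∣t , _)   | _ = ⊥-elim (even-odd-⊥ (2∣⇒even (+ t) d∣t) t-odd)
coprime-2 t-odd {suc (suc (suc _))} _ | s≤s (s≤s ())

mod₄-unique : ∀ x r r′ → x ≡ r [mod + 4 ] → x ≡ r′ [mod + 4 ] → r′ ≡ r [mod + 4 ]
mod₄-unique x r r′ x≡r x≡r′ = Signed.∣⇒∣ᵤ {+ 4} {r′ - r} (subst (Signed._∣_ (+ 4)) (identity x r r′)
  (Signed.∣m∣n⇒∣m-n (Signed.∣ᵤ⇒∣ {+ 4} {x - r} x≡r) (Signed.∣ᵤ⇒∣ {+ 4} {x - r′} x≡r′)))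
  where
  identity : ∀ x r r′ → (x - r) - (x - r′) ≡ r′ - r
  identity = solve-∀

¬residue₀₁ : ∀ {x} → x ≡ + 2 [mod + 4 ] ⊎ x ≡ + 3 [mod + 4 ] → ¬ Residue₀₁ x
¬residue₀₁ {x} (inj₁ x≡2) (inj₁ x≡0) = from-no (4 ℕ.∣? 2) (mod₄-unique x (+ 0) (+ 2) x≡0 x≡2)
¬residue₀₁ {x} (inj₁ x≡2) (inj₂ x≡1) = from-no (4 ℕ.∣? 1) (mod₄-unique x (+ 1) (+ 2) x≡1 x≡2)
¬residue₀₁ {x} (inj₂ x≡3) (inj₁ x≡0) = from-no (4 ℕ.∣? 3) (mod₄-unique x (+ 0) (+ 3) x≡0 x≡3)
¬residue₀₁ {x} (inj₂ x≡3) (inj₂ x≡1) = from-no (4 ℕ.∣? 2) (mod₄-unique x (+ 1) (+ 3) x≡1 x≡3)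

odd-square-mod₄ : ∀ q x r → Oddℤ q → x ≡ r [mod + 4 ] → q * q * x ≡ r [mod + 4 ]
odd-square-mod₄ q x r (k , refl) x≡r =
  let j , eq = mod⇒ x r x≡r in
  mod⇐ (q * q * x) r (j + (k * k + k) * x)
    (trans (identity₁ k x) (trans (cong (_+ (k * k + k) * x * + 4) eq)
      (identity₂ r j ((k * k + k) * x))))
  where
  identity₁ : ∀ k x → (1ℤ + + 2 * k) * (1ℤ + + 2 * k) * x ≡ x + (k * k + k) * x * + 4
  identity₁ = solve-∀
  identity₂ : ∀ r j y → r + j * + 4 + y * + 4 ≡ r + (j + y) * + 4
  identity₂ = solve-∀

residue₀₁-square : ∀ q {x} → Residue₀₁ x → Residue₀₁ (q * q * x)
residue₀₁-square q {x} res = by-parity (even⊎odd q) res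
  where
  identity : ∀ k x → + 2 * k * (+ 2 * k) * x ≡ + 0 + k * k * x * + 4
  identity = solve-∀
  by-parity : Evenℤ q ⊎ Oddℤ q → Residue₀₁ x → Residue₀₁ (q * q * x)
  by-parity (inj₁ (k , eq)) _          = inj₁ (mod⇐ (q * q * x) (+ 0) (k * k * x)
    (trans (cong (λ q → q * q * x) eq) (identity k x)))
  by-parity (inj₂ q-odd) (inj₁ x≡0) = inj₁ (odd-square-mod₄ q x (+ 0) q-odd x≡0)
  by-parity (inj₂ q-odd) (inj₂ x≡1) = inj₂ (odd-square-mod₄ q x (+ 1) q-odd x≡1)

fundamental⇒residue₀₁ : ∀ {Δ} → Fundamental Δ → Residue₀₁ Δ
fundamental⇒residue₀₁ (inj₁ (Δ≡1 , _)) = inj₂ Δ≡1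
fundamental⇒residue₀₁ {Δ} (inj₂ (m , Δ≡4m , _)) =
  inj₁ (mod⇐ Δ (+ 0) m (trans Δ≡4m (trans (ℤ.*-comm (+ 4) m) (sym (ℤ.+-identityˡ _)))))

square-divides : ∀ t f x y → + (t ℕ.* t) * y ≡ + (f ℕ.* f) * x → t ℕ.* t ℕ.∣ f ℕ.* f ℕ.* ∣ x ∣
square-divides t f x y eq = subst (t ℕ.* t ℕ.∣_)
  (trans (sym (ℤ.abs-* (+ (t ℕ.* t)) y)) (trans (cong ∣_∣ eq) (ℤ.abs-* (+ (f ℕ.* f)) x)))
  (ℕ.m∣m*n (∣ y ∣))

-- Coprimality gives t² ∣ Δ₁, which settles squarefree Δ₁. If Δ₁ = 4m and t is odd, then t² ∣ m. If
-- t = 2u, then u² D = f² m yields u = 1, so D = f² m with f odd inherits the residue 2 or 3 of m,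
-- and D is not a discriminant.
coprime-conductor : ∀ t f Δ₁ D .{{_ : ℕ.NonZero t}} → ℕ.Coprime t f → Fundamental Δ₁ → Residue₀₁ D →
                    + (t ℕ.* t) * D ≡ + (f ℕ.* f) * Δ₁ → t ≡ 1
coprime-conductor t f Δ₁ D t⊥f (inj₁ (_ , sf)) _ eq =
  sf t (coprime-square-divisor t⊥f (square-divides t f Δ₁ D eq))
coprime-conductor t f Δ₁ D t⊥f (inj₂ (m , Δ₁≡4m , m≡2∨3 , sf)) D-res eq = by-parity (even⊎odd (+ t))
  where
  t²∣4m : t ℕ.* t ℕ.∣ 4 ℕ.* ∣ m ∣
  t²∣4m = subst (t ℕ.* t ℕ.∣_) (trans (cong ∣_∣ Δ₁≡4m) (ℤ.abs-* (+ 4) m))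
            (coprime-square-divisor t⊥f (square-divides t f Δ₁ D eq))
  by-parity : Evenℤ (+ t) ⊎ Oddℤ (+ t) → t ≡ 1
  by-parity (inj₂ t-odd) = sf t (coprime-square-divisor (coprime-2 t-odd) t²∣4m)
  by-parity (inj₁ t-even) = halved (even⇒2∣ t-even)
    where
    f-odd : 2 ℕ.∣ t → Oddℤ (+ f)
    f-odd 2∣t = odd (even⊎odd (+ f))
      where
      odd : Evenℤ (+ f) ⊎ Oddℤ (+ f) → Oddℤ (+ f)
      odd (inj₂ o) = o
      odd (inj₁ e) = contradiction (t⊥f {2} (2∣t , even⇒2∣ {+ f} e)) λ ()
    halved : 2 ℕ.∣ t → t ≡ 1
    halved 2∣t@(ℕ.divides u refl) = contradiction D-res (¬residue₀₁ {D} D≡2∨3)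
      where
      instance
        u≢0 : ℕ.NonZero u
        u≢0 = ℕ.m*n≢0⇒m≢0 u
      u²D≡ : + (u ℕ.* u) * D ≡ + (f ℕ.* f) * m
      u²D≡ = ℤ.*-cancelˡ-≡ (+ 4) _ _ (begin
        + 4 * (+ (u ℕ.* u) * D)         ≡⟨ cong (λ z → + 4 * (z * D)) (ℤ.pos-* u u) ⟩
        + 4 * (+ u * + u * D)           ≡⟨ identity₁ (+ u) D ⟩
        (+ u * + 2) * (+ u * + 2) * D   ≡⟨ cong (λ z → z * z * D) (ℤ.pos-* u 2) ⟨
        + (u ℕ.* 2) * + (u ℕ.* 2) * D   ≡⟨ cong (_* D) (ℤ.pos-* (u ℕ.* 2) (u ℕ.* 2)) ⟨
        + (t ℕ.* t) * D                 ≡⟨ eq ⟩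
        + (f ℕ.* f) * Δ₁                ≡⟨ cong (+ (f ℕ.* f) *_) Δ₁≡4m ⟩
        + (f ℕ.* f) * (+ 4 * m)         ≡⟨ identity₂ (+ (f ℕ.* f)) m ⟩
        + 4 * (+ (f ℕ.* f) * m)         ∎)
        where
        open ≡-Reasoning
        identity₁ : ∀ u D → + 4 * (u * u * D) ≡ (u * + 2) * (u * + 2) * D
        identity₁ = solve-∀
        identity₂ : ∀ x m → x * (+ 4 * m) ≡ + 4 * (x * m)
        identity₂ = solve-∀
      u⊥f : ℕ.Coprime u f
      u⊥f (d∣u , d∣f) = t⊥f (ℕ.∣-trans d∣u (ℕ.m∣m*n 2) , d∣f)
      u≡1 : u ≡ 1
      u≡1 = sf u (coprime-square-divisor u⊥f (square-divides u f m D u²D≡))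
      D≡f²m : D ≡ + f * + f * m
      D≡f²m = trans (sym (ℤ.*-identityˡ D)) (trans (cong (λ u → + (u ℕ.* u) * D) (sym u≡1))
                (trans u²D≡ (cong (_* m) (ℤ.pos-* f f))))
      D≡2∨3 : D ≡ + 2 [mod + 4 ] ⊎ D ≡ + 3 [mod + 4 ]
      D≡2∨3 = transfer m≡2∨3
        where
        transfer : m ≡ + 2 [mod + 4 ] ⊎ m ≡ + 3 [mod + 4 ] → D ≡ + 2 [mod + 4 ] ⊎ D ≡ + 3 [mod + 4 ]
        transfer (inj₁ m≡2) = inj₁ (subst (_≡ + 2 [mod + 4 ]) (sym D≡f²m)
          (odd-square-mod₄ (+ f) m (+ 2) (f-odd 2∣t) m≡2))
        transfer (inj₂ m≡3) = inj₂ (subst (_≡ + 3 [mod + 4 ]) (sym D≡f²m)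
          (odd-square-mod₄ (+ f) m (+ 3) (f-odd 2∣t) m≡3))

-- Dividing `t` and `f` by their gcd keeps the equation and makes them coprime, so the cofactor of
-- `t` is 1. Thus the condition `t ∣ f` in the Hurwitz sum can be read off from Δ alone.
conductor-maximal : ∀ t f Δ₁ D .{{_ : ℕ.NonZero t}} → Fundamental Δ₁ → Residue₀₁ D →
                    + (t ℕ.* t) * D ≡ + (f ℕ.* f) * Δ₁ → t ℕ.∣ f
conductor-maximal t f Δ₁ D fund D-res eq = subst (ℕ._∣ f) g≡t (ℕ.gcd[m,n]∣n t f)
  where
  g = ℕ.gcd t f
  instance
    g≢0 : ℕ.NonZero g
    g≢0 = ℕ.≢-nonZero (ℕ.gcd[m,n]≢0 t f (inj₁ (ℕ.≢-nonZero⁻¹ t)))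
  t′ = t ℕ./ g
  f′ = f ℕ./ g
  t≡ : t′ ℕ.* g ≡ t
  t≡ = ℕ.m/n*n≡m (ℕ.gcd[m,n]∣m t f)
  f≡ : f′ ℕ.* g ≡ f
  f≡ = ℕ.m/n*n≡m (ℕ.gcd[m,n]∣n t f)
  instance
    t′≢0 : ℕ.NonZero t′
    t′≢0 = ℕ.m*n≢0⇒m≢0 t′ {{subst ℕ.NonZero (sym t≡) it}}
      where
      it : ℕ.NonZero t
      it = ℕ.≢-nonZero (ℕ.≢-nonZero⁻¹ t)
    g²≢0 : ℤ.NonZero (+ (g ℕ.* g))
    g²≢0 = ℕ.m*n≢0 g g
  scale : ∀ x y z → + (x ℕ.* y ℕ.* (x ℕ.* y)) * z ≡ + (y ℕ.* y) * (+ (x ℕ.* x) * z)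
  scale x y z = begin
    + (x ℕ.* y ℕ.* (x ℕ.* y)) * z      ≡⟨ cong (λ n → + n * z) (identity x y) ⟩
    + (y ℕ.* y ℕ.* (x ℕ.* x)) * z      ≡⟨ cong (_* z) (ℤ.pos-* (y ℕ.* y) (x ℕ.* x)) ⟩
    + (y ℕ.* y) * + (x ℕ.* x) * z      ≡⟨ ℤ.*-assoc (+ (y ℕ.* y)) (+ (x ℕ.* x)) z ⟩
    + (y ℕ.* y) * (+ (x ℕ.* x) * z)    ∎
    where
    open ≡-Reasoning
    identity : ∀ x y → x ℕ.* y ℕ.* (x ℕ.* y) ≡ y ℕ.* y ℕ.* (x ℕ.* x)
    identity = solveℕ-∀
  eq′ : + (t′ ℕ.* t′) * D ≡ + (f′ ℕ.* f′) * Δ₁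
  eq′ = ℤ.*-cancelˡ-≡ (+ (g ℕ.* g)) _ _ (trans (sym (scale t′ g D))
    (trans (cong (λ n → + (n ℕ.* n) * D) t≡)
      (trans eq (trans (cong (λ n → + (n ℕ.* n) * Δ₁) (sym f≡)) (scale f′ g Δ₁)))))
  g≡t : g ≡ t
  g≡t = trans (sym (ℕ.*-identityˡ g)) (trans
    (cong (ℕ._* g) (sym (coprime-conductor t′ f′ Δ₁ D (ℕ.coprime-/gcd t f) fund D-res eq′))) t≡)

exact-/ℕ : ∀ x k d .{{_ : ℕ.NonZero d}} → x ≡ k * + d → + d * (x ℤ./ℕ d) ≡ x
exact-/ℕ x k d x≡kd = trans (ℤ.*-comm (+ d) q)
  (sym (trans x≡ (trans (cong (λ r → + r + q * + d) r≡0) (ℤ.+-identityˡ (q * + d)))))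
  where
  q = x ℤ./ℕ d
  r = x ℤ.%ℕ d
  x≡ : x ≡ + r + q * + d
  x≡ = ℤ.a≡a%ℕn+[a/ℕn]*n x d
  identity₁ : ∀ r y → r ≡ (r + y) - y
  identity₁ = solve-∀
  identity₂ : ∀ k q d → k * d - q * d ≡ (k - q) * d
  identity₂ = solve-∀
  d∣r : d ℕ.∣ r
  d∣r = Signed.∣⇒∣ᵤ {+ d} {+ r} (Signed.divides (k - q)
    (trans (identity₁ (+ r) (q * + d)) (trans (cong (_- q * + d) (trans (sym x≡) x≡kd))
      (identity₂ k q (+ d)))))
  r≡0 : r ≡ 0
  r≡0 = small r (ℤ.n%ℕd<d x d) d∣r
    where
    small : ∀ r → r ℕ.< d → d ℕ.∣ r → r ≡ 0
    small zero    _   _   = refl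
    small (suc r) r<d d∣r = contradiction (ℕ.∣⇒≤ d∣r) (ℕ.<⇒≱ r<d)

-- The t = suc i with i in I are those with Δ / t² a discriminant, and then D i = Δ / t².
record ConductorDivisors (Δ : ℤ) (I : List ℕ) (D : ℕ → ℤ) : Set where
  field
    unique   : AllPairs _≢_ I
    exact    : ∀ {i} → i ∈ I → + suc i * + suc i * D i ≡ Δ
    residue  : ∀ {i} → i ∈ I → Residue₀₁ (D i)
    complete : ∀ i D′ → + suc i * + suc i * D′ ≡ Δ → Residue₀₁ D′ → i ∈ I

conductorIndices : ∀ {Δ} → Decomposition Δ → List ℕ
conductorIndices d = filter (λ i → suc i ℕ.∣? f) (upTo f)
  where open Decomposition d

conductorDivisors : ∀ {Δ} (d : Decomposition Δ) →
  ConductorDivisors Δ (conductorIndices d) (λ i → Δ ℤ./ℕ (suc i ℕ.* suc i))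
conductorDivisors {Δ} (decomposition f Δ₁ 1≤f fund Δ≡) = record
  { unique   = Unique.filter⁺ divides? (Unique.upTo⁺ f)
  ; exact    = λ {i} i∈ → proj₁ (exact-residue i (proj₂ (∈.∈-filter⁻ divides? {xs = upTo f} i∈)))
  ; residue  = λ {i} i∈ → proj₂ (exact-residue i (proj₂ (∈.∈-filter⁻ divides? {xs = upTo f} i∈)))
  ; complete = λ i D′ eq res →
      let t∣f = conductor-maximal (suc i) f Δ₁ D′ fund res
                  (trans (cong (_* D′) (ℤ.pos-* (suc i) (suc i))) (trans eq Δ≡))
      in ∈.∈-filter⁺ divides? (∈.∈-upTo⁺ (ℕ.∣⇒≤ {{ℕ.>-nonZero 1≤f}} t∣f)) t∣f
  }
  where
  divides? : ∀ i → Dec (suc i ℕ.∣ f)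
  divides? i = suc i ℕ.∣? f
  exact-residue : ∀ i → suc i ℕ.∣ f →
    let D = Δ ℤ./ℕ (suc i ℕ.* suc i) in + suc i * + suc i * D ≡ Δ × Residue₀₁ D
  exact-residue i (ℕ.divides q f≡qt) =
    trans (cong (_* D) (sym (ℤ.pos-* t t))) t²D≡Δ ,
    subst Residue₀₁ (sym D≡) (residue₀₁-square (+ q) (fundamental⇒residue₀₁ fund))
    where
    t = suc i
    D = Δ ℤ./ℕ (t ℕ.* t)
    Δ≡′ : Δ ≡ + q * + q * Δ₁ * + (t ℕ.* t)
    Δ≡′ = trans Δ≡ (trans (cong (λ f → + (f ℕ.* f) * Δ₁) f≡qt)
      (trans (cong (λ n → + n * Δ₁) (identity₁ q t))
      (trans (cong (_* Δ₁) (trans (ℤ.pos-* (q ℕ.* q) (t ℕ.* t))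
        (cong (_* + (t ℕ.* t)) (ℤ.pos-* q q)))) (identity₂ (+ q) (+ (t ℕ.* t)) Δ₁))))
      where
      identity₁ : ∀ q t → q ℕ.* t ℕ.* (q ℕ.* t) ≡ q ℕ.* q ℕ.* (t ℕ.* t)
      identity₁ = solveℕ-∀
      identity₂ : ∀ q x y → q * q * x * y ≡ q * q * y * x
      identity₂ = solve-∀
    t²D≡Δ : + (t ℕ.* t) * D ≡ Δ
    t²D≡Δ = exact-/ℕ Δ (+ q * + q * Δ₁) (t ℕ.* t) Δ≡′
    D≡ : D ≡ + q * + q * Δ₁
    D≡ = ℤ.*-cancelˡ-≡ (+ (t ℕ.* t)) _ _ (trans t²D≡Δ (trans Δ≡′ (ℤ.*-comm _ (+ (t ℕ.* t)))))

-- `H` branches on a decision that carries its own proof of being a discriminant; the view exposes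
-- the branch together with that proof.
data HurwitzView (N : ℕ) : ℚ → Set where
  isDisc  : (Δ-disc : NegativeDiscriminant (- + N)) →
    HurwitzView N (hurwitzSum (decompose (- + N) Δ-disc))
  notDisc : ¬ NegativeDiscriminant (- + N) → HurwitzView N 0ℚ

hurwitzView : ∀ N → HurwitzView N (H N)
hurwitzView N with negativeDiscriminant? (- + N)
... | yes Δ-disc = isDisc Δ-disc
... | no ¬Δ-disc = notDisc ¬Δ-disc

H-conductorDivisors : ∀ N → NegativeDiscriminant (- + N) →
  ∃ λ I → ∃ λ D → ConductorDivisors (- + N) I D × H N ≡ sum (map (λ i → hω (D i)) I)
H-conductorDivisors N Δ-disc = from-view (hurwitzView N)
  where
  from-view : ∀ {q} → HurwitzView N q →
    ∃ λ I → ∃ λ D → ConductorDivisors (- + N) I D × q ≡ sum (map (λ i → hω (D i)) I)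
  from-view (isDisc Δ-disc′) = conductorIndices d , (λ i → - + N ℤ./ℕ (suc i ℕ.* suc i)) ,
    conductorDivisors d , refl
    where
    d : Decomposition (- + N)
    d = decompose (- + N) Δ-disc′
  from-view (notDisc ¬Δ-disc) = contradiction Δ-disc ¬Δ-disc

-- Classical classes sorted by content

h≡1⇒∼ : ∀ Δ f g → h Δ ≡ 1 → Class Δ f → Class Δ g → f ∼ g
h≡1⇒∼ Δ f g h≡1 f-class g-class = single (reps (primitiveClasses Δ)) h≡1 (rep-of {Δ} {f} f-class)
  (rep-of {Δ} {g} g-class)
  where
  single : ∀ xs → length xs ≡ 1 → Any (f ∼_) xs → Any (g ∼_) xs → f ∼ g
  single (x ∷ []) _ (here f∼x) (here g∼x) = ∼-trans f∼x (∼-sym g∼x)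

content-injective : ∀ k l {f g} → Primitive f → Primitive g → + k ∗ f ∼ + l ∗ g → k ≡ l
content-injective k l {f} {g} f-prim g-prim kf∼lg = ℤ.+-injective
  (trans (sym (content-primitive-∗ (+ k) f f-prim))
    (trans (sym (content-∼ kf∼lg)) (content-primitive-∗ (+ l) g g-prim)))

multiple-∼ : ∀ k l .{{_ : ℕ.NonZero k}} {f g} → Primitive f → Primitive g → + k ∗ f ∼ + l ∗ g →
  f ∼ g
multiple-∼ k l {f} {g} f-prim g-prim kf∼lg = ∗-∼-cancel (+ k)
  (subst (λ l → + k ∗ f ∼ + l ∗ g) (sym (content-injective k l f-prim g-prim kf∼lg)) kf∼lg)

⟦·⟧ : ∀ d f → ⟦ d · f ⟧ ≡ d ∗ ⟦ f ⟧
⟦·⟧ d ⟨ a ,2· b , c ⟩ = form-cong refl (identity d b) refl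
  where
  identity : ∀ d b → + 2 * (d * b) ≡ d * (+ 2 * b)
  identity = solve-∀

⟦·⟧-even : ∀ d a b c → ⟦ d · ⟨ + 2 * a ,2· b , + 2 * c ⟩ ⟧ ≡ (+ 2 * d) ∗ form a b c
⟦·⟧-even d a b c = form-cong (identity d a) (sym (ℤ.*-assoc (+ 2) d b)) (identity d c)
  where
  identity : ∀ d a → d * (+ 2 * a) ≡ + 2 * d * a
  identity = solve-∀

module _ (f : Classical) (κ : ℕ) .{{κ≢0 : ℕ.NonZero κ}} {Δ : ℤ} {g : Form} (g-class : Class Δ g)
         (f∼κg : ⟦ f ⟧ ∼ + κ ∗ g) where

  private
    g-prim : Primitive g
    g-prim = proj₂ (proj₂ g-class)
    disc-g : disc g ≡ Δ
    disc-g = proj₁ (proj₂ g-class)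
    e₄ e₃ : Classical
    e₄ = ⟨ + 1 ,2· + 0 , + 1 ⟩
    e₃ = ⟨ + 2 ,2· + 1 , + 2 ⟩
    x²+y² x²+xy+y² : Form
    x²+y² = form (+ 1) (+ 0) (+ 1)
    x²+xy+y² = form (+ 1) (+ 1) (+ 1)

  derived⇒-4 : InClassDerivedFrom e₄ f → Δ ≡ - + 4
  derived⇒-4 (t , _ , f≈te) = trans (sym disc-g) (sym (disc-∼ g∼e))
    where
    g∼e : g ∼ x²+y²
    g∼e = multiple-∼ κ t g-prim refl (∼-trans (∼-sym f∼κg) (subst (⟦ f ⟧ ∼_) (⟦·⟧ (+ t) e₄) f≈te))

  -4⇒derived : Δ ≡ - + 4 → InClassDerivedFrom e₄ f
  -4⇒derived Δ≡ = κ , ℕ.>-nonZero⁻¹ κ , subst (⟦ f ⟧ ∼_) (sym (⟦·⟧ (+ κ) e₄))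
    (∼-trans f∼κg (∗-∼ (+ κ) g∼e))
    where
    g∼e : g ∼ x²+y²
    g∼e = h≡1⇒∼ (- + 4) g x²+y² h[-4]≡1 (subst (λ Δ → Class Δ g) Δ≡ g-class)
      ((+<+ (s≤s z≤n) , -<+) , refl , refl)

  derived⇒-3 : InClassDerivedFrom e₃ f → Δ ≡ - + 3
  derived⇒-3 (t , _ , f≈te) = trans (sym disc-g) (sym (disc-∼ g∼e))
    where
    g∼e : g ∼ x²+xy+y²
    g∼e = multiple-∼ κ (2 ℕ.* t) g-prim refl (∼-trans (∼-sym f∼κg)
      (subst (⟦ f ⟧ ∼_) (trans (⟦·⟧-even (+ t) (+ 1) (+ 1) (+ 1))
        (cong (_∗ x²+xy+y²) (sym (ℤ.pos-* 2 t)))) f≈te))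

  -- The form (2, 2·1, 2) is twice x² + xy + y², so being derived from it requires an even content.
  -- This is automatic: -3 κ² is 4 times the determinant.
  κ-even : Δ ≡ - + 3 → Evenℤ (+ κ)
  κ-even Δ≡ = even (even⊎odd (+ κ))
    where
    κκΔ≡ : + κ * + κ * - + 3 ≡ + 4 * determinant f
    κκΔ≡ = trans (cong (+ κ * + κ *_) (trans (sym Δ≡) (sym disc-g)))
      (trans (sym (disc-∗ (+ κ) g)) (trans (disc-∼ f∼κg) (disc-⟦⟧ f)))
    even : Evenℤ (+ κ) ⊎ Oddℤ (+ κ) → Evenℤ (+ κ)
    even (inj₁ e) = e
    even (inj₂ o) = ⊥-elim (even-odd-⊥ (even*ˡ (determinant f) (+ 2 , refl))
      (subst Oddℤ κκΔ≡ (odd*odd (odd*odd o o) (- + 2 , refl))))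

  -3⇒derived : Δ ≡ - + 3 → InClassDerivedFrom e₃ f
  -3⇒derived Δ≡ = halved (even⇒2∣ (κ-even Δ≡))
    where
    g∼e : g ∼ x²+xy+y²
    g∼e = h≡1⇒∼ (- + 3) g x²+xy+y² h[-3]≡1 (subst (λ Δ → Class Δ g) Δ≡ g-class)
      ((+<+ (s≤s z≤n) , -<+) , refl , refl)
    halved : 2 ℕ.∣ κ → InClassDerivedFrom e₃ f
    halved (ℕ.divides u κ≡) = u , ℕ.>-nonZero⁻¹ u {{u≢0}} , subst (⟦ f ⟧ ∼_)
      (trans (cong (_∗ x²+xy+y²) (trans (cong +_ (trans κ≡ (ℕ.*-comm u 2))) (ℤ.pos-* 2 u)))
        (sym (⟦·⟧-even (+ u) (+ 1) (+ 1) (+ 1))))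
      (∼-trans f∼κg (∗-∼ (+ κ) g∼e))
      where
      u≢0 : ℕ.NonZero u
      u≢0 = ℕ.m*n≢0⇒m≢0 u {{subst ℕ.NonZero κ≡ (ℕ.>-nonZero (ℕ.>-nonZero⁻¹ κ))}}

  -- Equivalent multiples of primitive forms have the same content and equivalent primitive parts,
  -- so membership in a special class fixes Δ. Conversely, Δ = -4 or -3 puts `g` into the only class
  -- there is.
  weight≡ω : weight f ≡ ω Δ
  weight≡ω = helper (inClassDerivedFrom? e₄ -<+ f) (inClassDerivedFrom? e₃ -<+ f) (Δ ℤ.≟ - + 4)
    (Δ ℤ.≟ - + 3)
    where
    helper : (d₄ : Dec (InClassDerivedFrom e₄ f)) (d₃ : Dec (InClassDerivedFrom e₃ f))
             (Δ₄ : Dec (Δ ≡ - + 4)) (Δ₃ : Dec (Δ ≡ - + 3)) →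
             (if does d₄ then + 1 ℚ./ 2 else if does d₃ then + 1 ℚ./ 3 else 1ℚ)
             ≡ (if does Δ₄ then + 1 ℚ./ 2 else if does Δ₃ then + 1 ℚ./ 3 else 1ℚ)
    helper (yes _) _       (yes _) _       = refl
    helper (yes d) _       (no ¬Δ) _       = contradiction (derived⇒-4 d) ¬Δ
    helper (no ¬d) _       (yes Δ) _       = contradiction (-4⇒derived Δ) ¬d
    helper (no _)  (yes _) (no _)  (yes _) = refl
    helper (no _)  (yes d) (no _)  (no ¬Δ) = contradiction (derived⇒-3 d) ¬Δ
    helper (no _)  (no ¬d) (no _)  (yes Δ) = contradiction (-3⇒derived Δ) ¬d
    helper (no _)  (no _)  (no _)  (no _)  = refl

posdef-∗ : ∀ k .{{_ : ℕ.NonZero k}} f → PositiveDefinite f → PositiveDefinite (+ k ∗ f)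
posdef-∗ k@(suc _) f@(form a b c) (a>0 , Δ<0) =
  subst (ℤ._< + k * a) (ℤ.*-zeroʳ (+ k)) (ℤ.*-monoˡ-<-pos (+ k) a>0) ,
  subst₂ ℤ._<_ (sym (disc-∗ (+ k) f)) (ℤ.*-zeroʳ (+ k * + k)) (ℤ.*-monoˡ-<-pos (+ k * + k) Δ<0)

posdef-∗⁻¹ : ∀ k .{{_ : ℕ.NonZero k}} f → PositiveDefinite (+ k ∗ f) → PositiveDefinite f
posdef-∗⁻¹ k@(suc _) f@(form a b c) (ka>0 , Δ<0) =
  ℤ.*-cancelˡ-<-nonNeg (+ k) (subst (ℤ._< + k * a) (sym (ℤ.*-zeroʳ (+ k))) ka>0) ,
  negative-factor (k ℕ.* k) (disc f) (subst (ℤ._< 0ℤ)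
    (trans (disc-∗ (+ k) f) (cong (_* disc f) (sym (ℤ.pos-* k k)))) Δ<0)

-- (k b)² = 4 n + 4 (k a)(k c) is even, so the middle coefficient of `+ k ∗ g` is even and the
-- multiple is classical.
classical-form : ∀ k n g → + k * + k * disc g ≡ + 4 * n → ∃ λ f → ⟦ f ⟧ ≡ + k ∗ g ×
  determinant f ≡ n
classical-form k n g@(form a b c) eq = from-even
  (even-square⇒even (+ k * b) (subst Evenℤ kb²≡
    (even+even (even*ˡ n (+ 2 , refl)) (even*ˡ (+ k * a * (+ k * c)) (+ 2 , refl)))))
  where
  identity : ∀ k a b c → k * k * (b * b - + 4 * (a * c)) + + 4 * (k * a * (k * c)) ≡ k * b * (k * b)
  identity = solve-∀
  kb²≡ : + 4 * n + + 4 * (+ k * a * (+ k * c)) ≡ + k * b * (+ k * b)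
  kb²≡ = trans (cong (_+ + 4 * (+ k * a * (+ k * c))) (sym eq)) (identity (+ k) a b c)
  from-even : Evenℤ (+ k * b) → ∃ λ f → ⟦ f ⟧ ≡ + k ∗ g × determinant f ≡ n
  from-even (j , kb≡2j) = f , f≡ , ℤ.*-cancelˡ-≡ (+ 4) _ _
    (trans (sym (disc-⟦⟧ f)) (trans (cong disc f≡) (trans (disc-∗ (+ k) g) eq)))
    where
    f : Classical
    f = ⟨ + k * a ,2· j , + k * c ⟩
    f≡ : ⟦ f ⟧ ≡ + k ∗ g
    f≡ = form-cong refl (sym kb≡2j) refl

-- One count for uneven and even forms alike: the property `Q` enters only through `split` and
-- `recover`, which say that it selects the contents `κ i` with primitive parts of discriminant
-- `D i`, for `i` in `I`.
module WeightedCount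
  (n : ℕ) (Q : Classical → Set)
  (R : Representatives _≈_ (λ f → PositiveDefiniteᶜ f × determinant f ≡ - + n × Q f))
  (I : List ℕ) (κ : ℕ → ℕ) (D : ℕ → ℤ)
  (unique : AllPairs _≢_ I) (κ-injective : ∀ {i j} → κ i ≡ κ j → i ≡ j)
    (κ≢0 : ∀ i → ℕ.NonZero (κ i))
  (exact : ∀ {i} → i ∈ I → + κ i * + κ i * D i ≡ + 4 * - + n)
  (split : ∀ f → PositiveDefiniteᶜ f → determinant f ≡ - + n → Q f →
           ∃ λ i → ∃ λ g → i ∈ I × Primitive g × disc g ≡ D i × ⟦ f ⟧ ≡ + κ i ∗ g)
  (recover : ∀ f i g → i ∈ I → Primitive g → disc g ≡ D i → ⟦ f ⟧ ≡ + κ i ∗ g → Q f)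
  where

  private
    ClassesAt : ℕ → List Form
    ClassesAt i = reps (primitiveClasses (D i))

    P : Classical → Set
    P f = PositiveDefiniteᶜ f × determinant f ≡ - + n × Q f

    S : Classical → ℕ × Form → Set
    S f (i , g) = ⟦ f ⟧ ∼ + κ i ∗ g

    totalˡ : ∀ f → P f → Any (S f) (pairs ClassesAt I)
    totalˡ f (f>0 , det≡ , Qf) = from-split (split f f>0 det≡ Qf)
      where
      from-split : (∃ λ i → ∃ λ g → i ∈ I × Primitive g × disc g ≡ D i × ⟦ f ⟧ ≡ + κ i ∗ g) →
        Any (S f) (pairs ClassesAt I)
      from-split (i , g , i∈ , g-prim , disc≡ , f≡κg) =
        from-rep (find (rep-of {D i} {g} (g>0 , disc≡ , g-prim)))
        where
        g>0 : PositiveDefinite g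
        g>0 = posdef-∗⁻¹ (κ i) {{κ≢0 i}} g (subst PositiveDefinite f≡κg (⟦⟧-posdef f f>0))
        from-rep : (∃ λ g′ → g′ ∈ ClassesAt i × g ∼ g′) → Any (S f) (pairs ClassesAt I)
        from-rep (g′ , g′∈ , g∼g′) = lose (∈-pairs⁺ ClassesAt i∈ g′∈)
          (subst (_∼ + κ i ∗ g′) (sym f≡κg) (∗-∼ (+ κ i) g∼g′))

    totalʳ : ∀ i g → i ∈ I → Class (D i) g → Any (λ f → S f (i , g)) (reps R)
    totalʳ i g i∈ (g>0 , disc≡ , g-prim) =
      from-form (classical-form (κ i) (- + n) g (trans (cong (+ κ i * + κ i *_) disc≡) (exact i∈)))
      where
      from-form : (∃ λ f → ⟦ f ⟧ ≡ + κ i ∗ g × determinant f ≡ - + n) →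
        Any (λ f → S f (i , g)) (reps R)
      from-form (f , f≡κg , det≡) = Any.map
        (λ {f′} f≈f′ → ∼-trans (∼-sym f≈f′) (subst (⟦ f ⟧ ∼_) f≡κg ∼-refl))
        (Representatives.exhaustive R f (f>0 , det≡ , recover f i g i∈ g-prim disc≡ f≡κg))
        where
        f>0 : PositiveDefiniteᶜ f
        f>0 = ⟦⟧-posdef⁻¹ f (subst PositiveDefinite (sym f≡κg) (posdef-∗ (κ i) {{κ≢0 i}} g g>0))

    Separated : ℕ × Form → ℕ × Form → Set
    Separated p p′ = ∀ f → S f p → ¬ S f p′

    pair-class : ∀ {i g} → g ∈ ClassesAt i → Class (D i) g
    pair-class {i} {g} = rep-class {D i} {g}

    across : ∀ {i j} → i ≢ j → ∀ {g g′} → g ∈ ClassesAt i → g′ ∈ ClassesAt j →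
      Separated (i , g) (j , g′)
    across {i} {j} i≢j {g} {g′} g∈ g′∈ f Sg Sg′ =
      i≢j (κ-injective (content-injective (κ i) (κ j) {g} {g′}
      (proj₂ (proj₂ (pair-class {i} {g} g∈))) (proj₂ (proj₂ (pair-class {j} {g′} g′∈)))
        (∼-trans (∼-sym Sg) Sg′)))

    within : ∀ i {g g′} → ¬ (g ∼ g′) → Separated (i , g) (i , g′)
    within i {g} {g′} g≁g′ f Sg Sg′ = g≁g′
      (∗-∼-cancel (+ κ i) {{κ≢0 i}} {g} {g′} (∼-trans (∼-sym Sg) Sg′))

    Across : ℕ → ℕ → Set
    Across i j = ∀ {g g′} → g ∈ ClassesAt i → g′ ∈ ClassesAt j → Separated (i , g) (j , g′)

    acrosses : AllPairs Across I
    acrosses = AllPairs.map {R = _≢_} {S = Across}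
      (λ {i} {j} i≢j {g} {g′} → across {i} {j} i≢j {g} {g′}) unique

    withins : ∀ i → AllPairs (λ g g′ → Separated (i , g) (i , g′)) (ClassesAt i)
    withins i = AllPairs.map {R = λ g g′ → ¬ (g ∼ g′)} {S = λ g g′ → Separated (i , g) (i , g′)}
      (λ {g} {g′} → within i {g} {g′}) (reps-distinct {D i})

    separated : AllPairs Separated (pairs ClassesAt I)
    separated = AllPairs-pairs⁺ ClassesAt {R = Separated} acrosses
      (All.tabulate λ {i} _ → withins i)

    ∈⇒class : ∀ {p} → p ∈ pairs ClassesAt I → proj₁ p ∈ I × Class (D (proj₁ p)) (proj₂ p)
    ∈⇒class {i , g} p∈ = let i∈ , g∈ = ∈-pairs⁻ ClassesAt I p∈ in i∈ , pair-class {i} {g} g∈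

    classes-matching : Matching S (reps R) (pairs ClassesAt I)
    classes-matching = matching
      (All.map (λ {f} → totalˡ f) (Representatives.sound R))
      (All.tabulate λ {p} p∈ → totalʳ (proj₁ p) (proj₂ p) (proj₁ (∈⇒class p∈)) (proj₂ (∈⇒class p∈)))
      (AllPairs.map (λ {f} {f′} f≉f′ p Sf Sf′ → f≉f′ (∼-trans Sf (∼-sym Sf′)))
        (Representatives.distinct R))
      separated

  count : sum (map weight (reps R)) ≡ sum (map (λ i → hω (D i)) I)
  count = begin
    sum (map weight (reps R))
      ≡⟨ sum-matching weight (λ p → ω (D (proj₁ p))) classes-matching
           (λ {f} {p} _ p∈ Sfp → weight≡ω f (κ (proj₁ p)) {{κ≢0 (proj₁ p)}} (proj₂ (∈⇒class p∈))
             Sfp) ⟩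
    sum (map (λ p → ω (D (proj₁ p))) (pairs ClassesAt I))
      ≡⟨ sum-concatMap (λ p → ω (D (proj₁ p))) (λ i → map (i ,_) (ClassesAt i)) I ⟩
    sum (map (λ i → sum (map (λ p → ω (D (proj₁ p))) (map (i ,_) (ClassesAt i)))) I)
      ≡⟨ sum-map-cong (All.tabulate {xs = I} λ {i} _ → at i) ⟩
    sum (map (λ i → hω (D i)) I) ∎
    where
    open ≡-Reasoning
    at : ∀ i → sum (map (λ p → ω (D (proj₁ p))) (map (i ,_) (ClassesAt i))) ≡ hω (D i)
    at i = trans (cong sum (sym (List.map-∘ (ClassesAt i))))
      (trans (sum-const (ω (D i)) (ClassesAt i)) (sym (hω≡ω*h (D i))))

-- Contents of uneven and even forms

divisor-suc : ∀ f → PositiveDefiniteᶜ f → ∃ λ i → divisor f ≡ + suc i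
divisor-suc f f>0 = positive (∣ divisor f ∣) refl
  where
  positive : ∀ d → ∣ divisor f ∣ ≡ d → ∃ λ i → divisor f ≡ + suc i
  positive zero    ∣δ∣≡0 = contradiction ∣δ∣≡0 (ℕ.≢-nonZero⁻¹ (∣ divisor f ∣) {{divisor≢0 f f>0}})
  positive (suc i) ∣δ∣≡  = i , cong +_ ∣δ∣≡

primitive-halve⇒∣2 : ∀ e g → Primitiveᶜ g → CommonDivisor e ⟦ g ⟧ → e ∣ + 2
primitive-halve⇒∣2 e g@(⟨ a ,2· b , c ⟩) prim (e∣a , e∣2b , e∣c) =
  ∣-primitive-multiple e (+ 2) (halve g) prim
    (∣-multiple e (+ 2) a e∣a , e∣2b , ∣-multiple e (+ 2) c e∣c)

-- A common divisor of a, 2b, c divides 2a, 2b, 2c and hence 2; the value 2 itself would make the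
-- form even.
primitive-uneven : ∀ g → Primitiveᶜ g → ¬ OuterEven g → Primitive ⟦ g ⟧
primitive-uneven g@(⟨ a ,2· b , c ⟩) prim ¬even = primitive⇐ ⟦ g ⟧ λ e e∣g →
  one-or-two e e∣g (∣ e ∣) refl (primitive-halve⇒∣2 e g prim e∣g)
  where
  one-or-two : ∀ e → CommonDivisor e ⟦ g ⟧ → ∀ d → ∣ e ∣ ≡ d → d ℕ.∣ 2 → e ∣ 1ℤ
  one-or-two e _ 0 _ 0∣2 = contradiction (ℕ.0∣⇒≡0 0∣2) λ ()
  one-or-two e _ 1 ∣e∣≡1 _ = ℕ.∣-reflexive ∣e∣≡1
  one-or-two e (e∣a , _ , e∣c) 2 ∣e∣≡2 _ =
    contradiction (subst (ℕ._∣ ∣ a ∣) ∣e∣≡2 e∣a , subst (ℕ._∣ ∣ c ∣) ∣e∣≡2 e∣c) ¬even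
  one-or-two e _ (suc (suc (suc d))) _ d∣2 = contradiction (ℕ.∣⇒≤ d∣2) λ { (s≤s (s≤s ())) }

primitive-even : ∀ a b c → Primitiveᶜ ⟨ + 2 * a ,2· b , + 2 * c ⟩ → Primitive (form a b c)
primitive-even a b c prim = primitive⇐ (form a b c) λ e (e∣a , e∣b , e∣c) →
  primitive⇒ (form (+ 2 * a) b (+ 2 * c)) prim e
    (∣-multiple e (+ 2) a e∣a , e∣b , ∣-multiple e (+ 2) c e∣c)

uneven-split : ∀ f → PositiveDefiniteᶜ f → Uneven f →
               ∃ λ i → ∃ λ g → Primitive ⟦ g ⟧ × ⟦ f ⟧ ≡ + suc i ∗ ⟦ g ⟧
uneven-split f f>0 (g , f≡δg , prim , ¬even) =
  let i , δ≡ = divisor-suc f f>0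
  in i , g , primitive-uneven g prim ¬even ,
     trans (cong ⟦_⟧ (trans f≡δg (cong (_· g) δ≡))) (⟦·⟧ (+ suc i) g)

-- With both outer coefficients even, the primitive quotient is 2 (a x² + b x y + c y²), which
-- accounts for the factor 2 in the content.
even-split : ∀ f → PositiveDefiniteᶜ f → Even f →
             ∃ λ i → ∃ λ g → Primitive g × ⟦ f ⟧ ≡ + (2 ℕ.* suc i) ∗ g
even-split f f>0 (⟨ A ,2· b , C ⟩ , f≡δg , prim , 2∣A , 2∣C) =
  halved (2∣⇒even A 2∣A) (2∣⇒even C 2∣C)
  where
  halved : Evenℤ A → Evenℤ C → ∃ λ i → ∃ λ g → Primitive g × ⟦ f ⟧ ≡ + (2 ℕ.* suc i) ∗ g
  halved (a , A≡2a) (c , C≡2c) =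
    let i , δ≡ = divisor-suc f f>0
        g≡ = classical-cong A≡2a refl C≡2c
    in i , form a b c , primitive-even a b c (subst Primitiveᶜ g≡ prim) ,
       trans (cong ⟦_⟧ (trans f≡δg (cong₂ _·_ δ≡ g≡)))
         (trans (⟦·⟧-even (+ suc i) a b c) (cong (_∗ form a b c) (sym (ℤ.pos-* 2 (suc i)))))

divisor-multiple : ∀ t g → Primitiveᶜ g → divisor (+ t · g) ≡ + t
divisor-multiple t g@(⟨ a ,2· b , c ⟩) prim = content-primitive-∗ (+ t) (form a b c) prim

-- `f` being classical, `t b` is even; as `t` is odd, `b` is even and `g` is itself classical, with
-- divisor 1.
uneven-recover : ∀ f t g → Oddℤ (+ t) → Primitive g → ⟦ f ⟧ ≡ + t ∗ g → Uneven f
uneven-recover f t (form a b c) t-odd prim f≡tg =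
  from-even (odd-cancel (+ t) b t-odd (Classical.b f , sym (cong Form.b f≡tg)))
  where
  from-even : Evenℤ b → Uneven f
  from-even (b′ , b≡2b′) = g₀ , trans f≡tg₀ (cong (_· g₀) (sym δ≡t)) , g₀-prim , g₀-uneven
    where
    g₀ : Classical
    g₀ = ⟨ a ,2· b′ , c ⟩
    ⟦g₀⟧≡ : form a b c ≡ ⟦ g₀ ⟧
    ⟦g₀⟧≡ = form-cong refl b≡2b′ refl
    prim′ : Primitive ⟦ g₀ ⟧
    prim′ = subst Primitive ⟦g₀⟧≡ prim
    f≡tg₀ : f ≡ + t · g₀
    f≡tg₀ = ⟦⟧-injective (trans f≡tg (trans (cong (+ t ∗_) ⟦g₀⟧≡) (sym (⟦·⟧ (+ t) g₀))))
    g₀-prim : Primitiveᶜ g₀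
    g₀-prim = primitive⇐ (form a b′ c) λ e (e∣a , e∣b′ , e∣c) → primitive⇒ ⟦ g₀ ⟧ prim′ e
      (e∣a , ∣-multiple e (+ 2) b′ e∣b′ , e∣c)
    δ≡t : divisor f ≡ + t
    δ≡t = trans (cong divisor f≡tg₀) (divisor-multiple t g₀ g₀-prim)
    g₀-uneven : ¬ OuterEven g₀
    g₀-uneven (2∣a , 2∣c) = contradiction
      (primitive⇒ ⟦ g₀ ⟧ prim′ (+ 2) (2∣a , even⇒2∣ {+ 2 * b′} (b′ , refl) , 2∣c))
        (from-no (2 ℕ.∣? 1))

-- An odd discriminant makes `b` odd. A common divisor of 2a, b, 2c divides 2 and the odd number
-- `b`, so it divides 1.
even-recover : ∀ f t g → Oddℤ (disc g) → Primitive g → ⟦ f ⟧ ≡ + (2 ℕ.* t) ∗ g → Even f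
even-recover f t g@(form a b c) Δ-odd prim f≡tg =
  g₀ , trans f≡tg₀ (cong (_· g₀) (sym δ≡t)) , g₀-prim , even⇒2∣ {+ 2 * a} (a , refl) ,
    even⇒2∣ {+ 2 * c} (c , refl)
  where
  g₀ : Classical
  g₀ = ⟨ + 2 * a ,2· b , + 2 * c ⟩
  f≡tg₀ : f ≡ + t · g₀
  f≡tg₀ = ⟦⟧-injective (trans f≡tg (trans (cong (_∗ g) (ℤ.pos-* 2 t)) (sym (⟦·⟧-even (+ t) a b c))))
  g₀-prim : Primitiveᶜ g₀
  g₀-prim = primitive⇐ (form (+ 2 * a) b (+ 2 * c)) λ e (e∣2a , e∣b , e∣2c) → unit e e∣b
    (∣-primitive-multiple e (+ 2) g prim (e∣2a , ∣-multiple e (+ 2) b e∣b , e∣2c))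
    where
    unit : ∀ e → e ∣ b → e ∣ + 2 → e ∣ 1ℤ
    unit e e∣b e∣2 = from-odd (odd-disc⇒odd-b g Δ-odd)
      where
      identity : ∀ k → (1ℤ + + 2 * k) * 1ℤ + + 2 * (- k) + + 2 * 0ℤ ≡ 1ℤ
      identity = solve-∀
      from-odd : Oddℤ b → e ∣ 1ℤ
      from-odd (k , b≡) = subst (e ∣_) (trans (cong (λ b → b * 1ℤ + + 2 * (- k) + + 2 * 0ℤ) b≡)
        (identity k))
        (∣-linear {e} {b} {+ 2} {+ 2} e∣b e∣2 e∣2 1ℤ (- k) 0ℤ)
  δ≡t : divisor f ≡ + t
  δ≡t = trans (cong divisor f≡tg₀) (divisor-multiple t g₀ g₀-prim)

-- The congruence classes of n

neg-pos-* : ∀ m n → - + (m ℕ.* n) ≡ + m * - + n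
neg-pos-* m n = trans (cong -_ (ℤ.pos-* m n)) (ℤ.neg-distribʳ-* (+ m) (+ n))

negative : ∀ n → n ≥ 1 → - + n ℤ.< 0ℤ
negative (suc n) _ = -<+

disc-multiple : ∀ f t g → ⟦ f ⟧ ≡ + t ∗ g → + t * + t * disc g ≡ + 4 * determinant f
disc-multiple f t g f≡tg = trans (sym (disc-∗ (+ t) g)) (trans (cong disc (sym f≡tg)) (disc-⟦⟧ f))

even-index : ∀ t D n → + (2 ℕ.* t) * + (2 ℕ.* t) * D ≡ + 4 * n → + t * + t * D ≡ n
even-index t D n eq = ℤ.*-cancelˡ-≡ (+ 4) _ _
  (trans (identity (+ t) D) (trans (cong (λ z → z * z * D) (sym (ℤ.pos-* 2 t))) eq))
  where
  identity : ∀ t D → + 4 * (t * t * D) ≡ + 2 * t * (+ 2 * t) * D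
  identity = solve-∀

same-cofactor : ∀ i {D D′ Δ} → + suc i * + suc i * D ≡ Δ → + suc i * + suc i * D′ ≡ Δ → D ≡ D′
same-cofactor i {D} {D′} eq eq′ = ℤ.*-cancelˡ-≡ (+ suc i * + suc i) D D′ (trans eq (sym eq′))

0mod4 : ∀ x → Residue₀₁ (+ 4 * x)
0mod4 x = inj₁ (mod⇐ (+ 4 * x) (+ 0) x (trans (ℤ.*-comm (+ 4) x) (sym (ℤ.+-identityˡ _))))

-- The residue condition means that -n is not a discriminant. An even form would write -n as a
-- square times a discriminant, and so would an even `t` with -4n / t² a discriminant.
E≡H[4n] : ∀ n → n ≥ 1 → - + n ≡ + 2 [mod + 4 ] ⊎ - + n ≡ + 3 [mod + 4 ] → E n ≡ H (4 ℕ.* n)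
E≡H[4n] n n≥1 res = from-divisors (H-conductorDivisors (4 ℕ.* n)
  (negative (4 ℕ.* n) (ℕ.≤-trans n≥1 (ℕ.m≤n*m n 4)) , subst Residue₀₁ (sym (neg-pos-* 4 n))
    (0mod4 (- + n))))
  where
  ¬disc : ¬ Residue₀₁ (- + n)
  ¬disc = ¬residue₀₁ { - + n} res

  F₁≡0 : F₁ n ≡ 0ℚ
  -- No content is admissible: the index list is empty, and `suc` and `0ℤ` are placeholders.
  F₁≡0 = WeightedCount.count n Even (evenClasses n) [] suc (λ _ → 0ℤ) [] ℕ.suc-injective (λ _ → _)
    (λ ())
    (λ f f>0 det≡ f-even → contradiction (discriminant f f>0 det≡ f-even) ¬disc) (λ _ _ _ ())
    where
    discriminant : ∀ f → PositiveDefiniteᶜ f → determinant f ≡ - + n → Even f → Residue₀₁ (- + n)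
    discriminant f f>0 det≡ f-even = from-split (even-split f f>0 f-even)
      where
      disc-residue : ∀ g → Residue₀₁ (disc g)
      -- `b²` is read as `b² · 1`, a square times a number with residue 1.
      disc-residue (form a b c) = residue (residue₀₁-square b {1ℤ} (inj₂ (mod⇐ 1ℤ (+ 1) 0ℤ refl)))
        where
        residue : Residue₀₁ (b * b * 1ℤ) → Residue₀₁ (b * b - + 4 * (a * c))
        residue = Sum.map (shifted (+ 0)) (shifted (+ 1))
          where
          identity : ∀ r j y → r + j * + 4 - + 4 * y ≡ r + (j - y) * + 4
          identity = solve-∀
          shifted : ∀ r → b * b * 1ℤ ≡ r [mod + 4 ] → b * b - + 4 * (a * c) ≡ r [mod + 4 ]
          shifted r b²≡ = let j , eq = mod⇒ (b * b * 1ℤ) r b²≡ in mod⇐ (b * b - + 4 * (a * c)) r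
            (j - a * c)
            (trans (cong (_- + 4 * (a * c)) (trans (sym (ℤ.*-identityʳ (b * b))) eq))
              (identity r j (a * c)))
      from-split : (∃ λ i → ∃ λ g → Primitive g × ⟦ f ⟧ ≡ + (2 ℕ.* suc i) ∗ g) → Residue₀₁ (- + n)
      from-split (i , g , _ , f≡) = subst Residue₀₁
        (trans (even-index (suc i) (disc g) (determinant f) (disc-multiple f (2 ℕ.* suc i) g f≡))
          det≡)
        (residue₀₁-square (+ suc i) {disc g} (disc-residue g))

  from-divisors : (∃ λ I → ∃ λ D → ConductorDivisors (- + (4 ℕ.* n)) I D ×
    H (4 ℕ.* n) ≡ sum (map (λ i → hω (D i)) I)) →
                  E n ≡ H (4 ℕ.* n)
  from-divisors (I , D , cd , H≡) = trans (cong₂ ℚ._-_ F≡ F₁≡0) (trans (ℚ.+-identityʳ _) (sym H≡))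
    where
    open ConductorDivisors cd
    exact′ : ∀ {i} → i ∈ I → + suc i * + suc i * D i ≡ + 4 * - + n
    exact′ i∈ = trans (exact i∈) (neg-pos-* 4 n)

    odd-index : ∀ i → i ∈ I → Oddℤ (+ suc i)
    odd-index i i∈ = odd (even⊎odd (+ suc i))
      where
      odd : Evenℤ (+ suc i) ⊎ Oddℤ (+ suc i) → Oddℤ (+ suc i)
      odd (inj₂ t-odd)     = t-odd
      odd (inj₁ (u , t≡2u)) = contradiction
        (subst Residue₀₁ u²D≡ (residue₀₁-square u {D i} (residue i∈))) ¬disc
        where
        identity : ∀ u D → + 4 * (u * u * D) ≡ + 2 * u * (+ 2 * u) * D
        identity = solve-∀
        u²D≡ : u * u * D i ≡ - + n
        u²D≡ = ℤ.*-cancelˡ-≡ (+ 4) _ _ (trans (identity u (D i))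
          (trans (cong (λ t → t * t * D i) (sym t≡2u)) (exact′ i∈)))

    split : ∀ f → PositiveDefiniteᶜ f → determinant f ≡ - + n → Uneven f →
            ∃ λ i → ∃ λ g → i ∈ I × Primitive g × disc g ≡ D i × ⟦ f ⟧ ≡ + suc i ∗ g
    split f f>0 det≡ f-uneven = from-split (uneven-split f f>0 f-uneven)
      where
      from-split : (∃ λ i → ∃ λ g → Primitive ⟦ g ⟧ × ⟦ f ⟧ ≡ + suc i ∗ ⟦ g ⟧) →
                   ∃ λ i → ∃ λ g → i ∈ I × Primitive g × disc g ≡ D i × ⟦ f ⟧ ≡ + suc i ∗ g
      from-split (i , g , prim , f≡) = i , ⟦ g ⟧ , i∈ , prim ,
        same-cofactor i t²disc≡ (exact′ i∈) , f≡
        where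
        t²disc≡ : + suc i * + suc i * disc ⟦ g ⟧ ≡ + 4 * - + n
        t²disc≡ = trans (disc-multiple f (suc i) ⟦ g ⟧ f≡) (cong (+ 4 *_) det≡)
        i∈ : i ∈ I
        i∈ = complete i (disc ⟦ g ⟧) (trans t²disc≡ (sym (neg-pos-* 4 n)))
               (subst Residue₀₁ (sym (disc-⟦⟧ g)) (0mod4 (determinant g)))

    F≡ : F n ≡ sum (map (λ i → hω (D i)) I)
    F≡ = WeightedCount.count n Uneven (unevenClasses n) I suc D unique ℕ.suc-injective (λ _ → _)
      exact′ split
      (λ f i g i∈ prim _ f≡ → uneven-recover f (suc i) g (odd-index i i∈) prim f≡)

-- For n ≡ 3 (mod 4), uneven and even classes have contents t and 2 t, with t² ∣ n.
module ThreeModFour (n : ℕ) (n≥1 : n ≥ 1) (-n≡1 : - + n ≡ + 1 [mod + 4 ])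
  (I : List ℕ) (D : ℕ → ℤ) (cd : ConductorDivisors (- + n) I D) where

  open ConductorDivisors cd

  private
    odd-−n : Oddℤ (- + n)
    odd-−n = let j , eq = mod⇒ (- + n) (+ 1) -n≡1 in + 2 * j , trans eq (identity j)
      where
      identity : ∀ j → + 1 + j * + 4 ≡ 1ℤ + + 2 * (+ 2 * j)
      identity = solve-∀

    odd-square-index : ∀ {i} → i ∈ I → Oddℤ (+ suc i * + suc i)
    odd-square-index {i} i∈ = odd-factorˡ (+ suc i * + suc i) (D i)
      (subst Oddℤ (sym (exact i∈)) odd-−n)

  odd-index : ∀ {i} → i ∈ I → Oddℤ (+ suc i)
  odd-index {i} i∈ = odd-factorˡ (+ suc i) (+ suc i) (odd-square-index i∈)

  odd-D : ∀ {i} → i ∈ I → Oddℤ (D i)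
  odd-D {i} i∈ = odd-factorˡ (D i) (+ suc i * + suc i)
    (subst Oddℤ (trans (sym (exact i∈)) (ℤ.*-comm (+ suc i * + suc i) (D i))) odd-−n)

  private
    -- Any cofactor of a square in -n is again 1 (mod 4), so the discriminant condition of
    -- `complete` comes for free.
    index : ∀ i x → + suc i * + suc i * x ≡ - + n → i ∈ I
    index i x eq = complete i x eq (inj₂
      (square-factor-mod (+ suc i) x (subst (_≡ + 1 [mod + 4 ]) (sym eq) -n≡1)))

    exact-uneven : ∀ {i} → i ∈ I → + suc i * + suc i * (+ 4 * D i) ≡ + 4 * - + n
    exact-uneven {i} i∈ = trans (identity (+ suc i) (D i)) (cong (+ 4 *_) (exact i∈))
      where
      identity : ∀ t D → t * t * (+ 4 * D) ≡ + 4 * (t * t * D)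
      identity = solve-∀

    exact-even : ∀ {i} → i ∈ I → + (2 ℕ.* suc i) * + (2 ℕ.* suc i) * D i ≡ + 4 * - + n
    exact-even {i} i∈ = trans (cong (λ z → z * z * D i) (ℤ.pos-* 2 (suc i)))
      (trans (identity (+ suc i) (D i)) (cong (+ 4 *_) (exact i∈)))
      where
      identity : ∀ t D → + 2 * t * (+ 2 * t) * D ≡ + 4 * (t * t * D)
      identity = solve-∀

    split-uneven : ∀ f → PositiveDefiniteᶜ f → determinant f ≡ - + n → Uneven f →
      ∃ λ i → ∃ λ g → i ∈ I × Primitive g × disc g ≡ + 4 * D i × ⟦ f ⟧ ≡ + suc i ∗ g
    split-uneven f f>0 det≡ f-uneven = from-split (uneven-split f f>0 f-uneven)
      where
      from-split : (∃ λ i → ∃ λ g → Primitive ⟦ g ⟧ × ⟦ f ⟧ ≡ + suc i ∗ ⟦ g ⟧) →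
                   ∃ λ i → ∃ λ g → i ∈ I × Primitive g × disc g ≡ + 4 * D i × ⟦ f ⟧ ≡ + suc i ∗ g
      from-split (i , g , prim , f≡) = i , ⟦ g ⟧ , i∈ , prim ,
        trans (disc-⟦⟧ g) (cong (+ 4 *_) (same-cofactor i t²det≡ (exact i∈))) , f≡
        where
        identity : ∀ t D → + 4 * (t * t * D) ≡ t * t * (+ 4 * D)
        identity = solve-∀
        t²det≡ : + suc i * + suc i * determinant g ≡ - + n
        t²det≡ = ℤ.*-cancelˡ-≡ (+ 4) _ _ (trans (identity (+ suc i) (determinant g))
          (trans (cong (+ suc i * + suc i *_) (sym (disc-⟦⟧ g)))
            (trans (disc-multiple f (suc i) ⟦ g ⟧ f≡) (cong (+ 4 *_) det≡))))
        i∈ : i ∈ I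
        i∈ = index i (determinant g) t²det≡

    split-even : ∀ f → PositiveDefiniteᶜ f → determinant f ≡ - + n → Even f →
      ∃ λ i → ∃ λ g → i ∈ I × Primitive g × disc g ≡ D i × ⟦ f ⟧ ≡ + (2 ℕ.* suc i) ∗ g
    split-even f f>0 det≡ f-even = from-split (even-split f f>0 f-even)
      where
      from-split : (∃ λ i → ∃ λ g → Primitive g × ⟦ f ⟧ ≡ + (2 ℕ.* suc i) ∗ g) →
                   ∃ λ i → ∃ λ g → i ∈ I × Primitive g × disc g ≡ D i × ⟦ f ⟧ ≡ + (2 ℕ.* suc i) ∗ g
      from-split (i , g , prim , f≡) = i , g , i∈ , prim , same-cofactor i t²disc≡ (exact i∈) , f≡
        where
        t²disc≡ : + suc i * + suc i * disc g ≡ - + n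
        t²disc≡ = trans (even-index (suc i) (disc g) (determinant f)
          (disc-multiple f (2 ℕ.* suc i) g f≡)) det≡
        i∈ : i ∈ I
        i∈ = index i (disc g) t²disc≡

  F≡ : F n ≡ sum (map (λ i → hω (+ 4 * D i)) I)
  F≡ = WeightedCount.count n Uneven (unevenClasses n) I suc (λ i → + 4 * D i) unique
    ℕ.suc-injective (λ _ → _)
    exact-uneven split-uneven
    (λ f i g i∈ prim _ f≡ → uneven-recover f (suc i) g (odd-index i∈) prim f≡)

  F₁≡ : F₁ n ≡ sum (map (λ i → hω (D i)) I)
  F₁≡ = WeightedCount.count n Even (evenClasses n) I (λ i → 2 ℕ.* suc i) D unique
    (λ {i} {j} eq → ℕ.suc-injective (ℕ.*-cancelˡ-≡ (suc i) (suc j) 2 eq)) (λ _ → _)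
    exact-even split-even
    (λ f i g i∈ prim disc≡ f≡ → even-recover f (suc i) g (subst Oddℤ (sym disc≡) (odd-D i∈)) prim
      f≡)

  D<0 : ∀ {i} → i ∈ I → D i ℤ.< 0ℤ
  D<0 {i} i∈ = negative-factor (suc i ℕ.* suc i) (D i)
    (subst (ℤ._< 0ℤ) (trans (sym (exact i∈)) (cong (_* D i) (sym (ℤ.pos-* (suc i) (suc i)))))
      (negative n n≥1))

  -- The indices `t` are odd, so `t² ≡ 1` (mod 8) and division by `t²` preserves the residue.
  D-mod₈ : ∀ r → - + n ≡ r [mod + 8 ] → ∀ {i} → i ∈ I → D i ≡ r [mod + 8 ]
  D-mod₈ r -n≡r {i} i∈ = from-square (odd-square (odd-index i∈)) (mod₈⇒ (- + n) r -n≡r)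
    where
    from-square : (∃ λ m → + suc i * + suc i ≡ 1ℤ + + 8 * m) → (∃ λ k → - + n ≡ r + + 8 * k) →
      D i ≡ r [mod + 8 ]
    from-square (m , t²≡) (k , -n≡) = Signed.∣⇒∣ᵤ {+ 8} {D i - r}
      (Signed.divides (k - m * D i) (begin
      D i - r                                     ≡⟨ identity₁ (D i) r m ⟩
      (1ℤ + + 8 * m) * D i - + 8 * (m * D i) - r
        ≡⟨ cong (λ z → z - + 8 * (m * D i) - r)
          (trans (cong (_* D i) (sym t²≡)) (trans (exact i∈) -n≡)) ⟩
      r + + 8 * k - + 8 * (m * D i) - r           ≡⟨ identity₂ r k (m * D i) ⟩
      (k - m * D i) * + 8                         ∎))
      where
      open ≡-Reasoning
      identity₁ : ∀ D r m → D - r ≡ (1ℤ + + 8 * m) * D - + 8 * (m * D) - r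
      identity₁ = solve-∀
      identity₂ : ∀ r k y → r + + 8 * k - + 8 * y - r ≡ (k - y) * + 8
      identity₂ = solve-∀

E≡2H[n] : ∀ n → n ≥ 1 → - + n ≡ + 5 [mod + 8 ] → E n ≡ (+ 2 ℚ./ 1) ℚ.* H n
E≡2H[n] n n≥1 -n≡5 = from-divisors (H-conductorDivisors n (negative n n≥1 , inj₂ -n≡1))
  where
  -n≡1 : - + n ≡ + 1 [mod + 4 ]
  -n≡1 = 5mod8⇒1mod4 (- + n) -n≡5
  3x-x : ∀ x → (+ 3 ℚ./ 1) ℚ.* x ℚ.- x ≡ (+ 2 ℚ./ 1) ℚ.* x
  3x-x x = begin
    (+ 3 ℚ./ 1) ℚ.* x ℚ.- x
      ≡⟨ cong (λ y → (+ 3 ℚ./ 1) ℚ.* x ℚ.- y) (ℚ.*-identityˡ x) ⟨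
    (+ 3 ℚ./ 1) ℚ.* x ℚ.- 1ℚ ℚ.* x
      ≡⟨ cong ((+ 3 ℚ./ 1) ℚ.* x ℚ.+_) (ℚ.neg-distribˡ-* 1ℚ x) ⟩
    (+ 3 ℚ./ 1) ℚ.* x ℚ.+ (ℚ.- 1ℚ) ℚ.* x        ≡⟨ ℚ.*-distribʳ-+ x (+ 3 ℚ./ 1) (ℚ.- 1ℚ) ⟨
    (+ 2 ℚ./ 1) ℚ.* x                           ∎
    where open ≡-Reasoning
  from-divisors : (∃ λ I → ∃ λ D → ConductorDivisors (- + n) I D ×
    H n ≡ sum (map (λ i → hω (D i)) I)) →
                  E n ≡ (+ 2 ℚ./ 1) ℚ.* H n
  from-divisors (I , D , cd , H≡) = trans (cong₂ ℚ._-_ (trans F≡ tripled) F₁≡)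
    (trans (3x-x (sum (map (λ i → hω (D i)) I))) (cong ((+ 2 ℚ./ 1) ℚ.*_) (sym H≡)))
    where
    open ThreeModFour n n≥1 -n≡1 I D cd
    tripled : sum (map (λ i → hω (+ 4 * D i)) I) ≡ (+ 3 ℚ./ 1) ℚ.* sum (map (λ i → hω (D i)) I)
    tripled = trans (sum-map-cong (All.tabulate λ {i} i∈ →
      hω-tripled (D i) (D<0 i∈) (D-mod₈ (+ 5) -n≡5 i∈)))
      (sum-map-* (+ 3 ℚ./ 1) (λ i → hω (D i)) I)

E≡0 : ∀ n → n ≥ 1 → - + n ≡ + 1 [mod + 8 ] → E n ≡ 0ℚ
E≡0 n n≥1 -n≡1 = from-divisors (H-conductorDivisors n (negative n n≥1 , inj₂ -n≡1₄))
  where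
  -n≡1₄ : - + n ≡ + 1 [mod + 4 ]
  -n≡1₄ = 8∣⇒4∣ { - + n} {+ 1} -n≡1
  from-divisors : (∃ λ I → ∃ λ D → ConductorDivisors (- + n) I D ×
    H n ≡ sum (map (λ i → hω (D i)) I)) → E n ≡ 0ℚ
  from-divisors (I , D , cd , _) = trans (cong₂ ℚ._-_ (trans F≡ doubled) F₁≡)
    (ℚ.+-inverseʳ (sum (map (λ i → hω (D i)) I)))
    where
    open ThreeModFour n n≥1 -n≡1₄ I D cd
    doubled : sum (map (λ i → hω (+ 4 * D i)) I) ≡ sum (map (λ i → hω (D i)) I)
    doubled = sum-map-cong (All.tabulate λ {i} i∈ → hω-doubled (D i) (D-mod₈ (+ 1) -n≡1 i∈))

neg-mod : ∀ m r n .{{_ : ℕ.NonZero m}} → n % m ≡ r → - + n ≡ + m - + r [mod + m ]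
neg-mod m r n n%m≡r = Signed.∣⇒∣ᵤ {+ m} { - + n - (+ m - + r)}
  (Signed.divides (- + (n ℕ./ m) - 1ℤ) (begin
  - + n - (+ m - + r)                           ≡⟨ cong (λ z → - z - (+ m - + r)) n≡ ⟩
  - (+ r + + (n ℕ./ m) * + m) - (+ m - + r)     ≡⟨ identity (+ r) (+ (n ℕ./ m)) (+ m) ⟩
  (- + (n ℕ./ m) - 1ℤ) * + m                    ∎))
  where
  open ≡-Reasoning
  n≡ : + n ≡ + r + + (n ℕ./ m) * + m
  n≡ = trans (cong +_ (trans (ℕ.m≡m%n+[m/n]*n n m) (cong (ℕ._+ n ℕ./ m ℕ.* m) n%m≡r)))
    (cong (λ z → + r + z) (ℤ.pos-* (n ℕ./ m) m))
  identity : ∀ r q m → - (r + q * m) - (m - r) ≡ (- q - 1ℤ) * m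
  identity = solve-∀

theorem3 : (n : ℕ) → n ≥ 1 → n % 4 ≢ 0 →
    (n % 4 ≡ 1 ⊎ n % 4 ≡ 2 → E n ≡ H (4 ℕ.* n))
    × (n % 8 ≡ 3 → E n ≡ (+ 2 ℚ./ 1) ℚ.* H n)
    × (n % 8 ≡ 7 → E n ≡ 0ℚ)
theorem3 n n≥1 _ =
  -- Negation sends the residues 1 and 2 mod 4 to 3 and 2, hence the swap.
  (λ n≡1∨2 → E≡H[4n] n n≥1 (Sum.swap (Sum.map (neg-mod 4 1 n) (neg-mod 4 2 n) n≡1∨2))) ,
  (λ n≡3 → E≡2H[n] n n≥1 (neg-mod 8 3 n n≡3)) ,
  (λ n≡7 → E≡0 n n≥1 (neg-mod 8 7 n n≡7))
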